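{- Let $k\ge2$ be an integer and put $l=(k^2+k-2)/2$. Let $w_l$ be a real number such that there exist a constant $C_1$ and a polynomial $Q$ of degree $l-1$ with $$\#\{(d_0,d_1,\dots,d_l)\in\mathbb{Z}_{\ge1}^{l+1} : d_0d_1^2\cdots d_l^2\le x\} = C_1x + x^{1/2}Q(\log x)+O(x^{w_l+\varepsilon})$$ for every $\varepsilon>0$. Then there exist a constant $A_k$ and a polynomial $P_k$ of degree $(k^2+k-4)/2$ such that for every $\varepsilon>0$ $$\sum_{n\le x}\tau^{(e)}_{k*}(n)=A_kx+x^{1/2}P_k(\log x)+O(x^{v_k+\varepsilon}),\qquad v_k=\max\bigl(w_l,1/3\bigr).$$
   Context: For a positive integer $a$, ${\mathfrak t}_k(a)$ is the number of ordered $k$-tuples $({\mathfrak d}_1,\dots,{\mathfrak d}_k)$ of nonzero Gaussian integers, each taken up to associates (multiplication by $\pm1,\pm i$), whose product is associated to $a$ (equivalently, ordered $k$-tuples of ideals of $\mathbb{Z}[i]$ with product $a\mathbb{Z}[i]$). $\tau^{(e)}_{k*}$ is the multiplicative arithmetic function on positive integers with $\tau^{(e)}_{k*}(p^a)={\mathfrak t}_k(a)$ for every prime $p$ and $a\ge1$. (By a result of Krätzel one may take $w_l=(2l+1)/(4l+5)$.) -}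

module Defs where

open import Algebra.Apartness.Bundles using (HeytingCommutativeRing; HeytingField)
open import Algebra.Bundles using (CommutativeRing)
import Algebra.Definitions.RawMonoid as RawMonoidDefinitions
import Algebra.Properties.Ring as RingProperties
open import Data.Integer as ℤ using (ℤ; +_; -[1+_])
open import Data.List.Base as List
  using (List; []; _∷_; length; filter; deduplicate; upTo; cartesianProductWith)
open import Data.List.Relation.Unary.Any using (Any; any?)
open import Data.Nat.Base as ℕ using (ℕ; zero; suc)
open import Data.Nat.Coprimality using (Coprime)
open import Data.Nat.Primality using (Prime)
open import Data.Nat.ListAction using (sum)
import Data.Nat.Properties as ℕₚ
open import Data.Product.Base using (_×_; _,_; proj₁; Σ-syntax; ∃-syntax)
open import Data.Sum.Base using (_⊎_; inj₁; inj₂)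
open import Data.Vec.Base as Vec using (Vec; []; _∷_)
import Data.Vec.Relation.Binary.Pointwise.Inductive as Pointwise
open import Level using () renaming (_⊔_ to _⊔ˡ_; suc to lsuc)
open import Relation.Binary.Core using (Rel)
open import Relation.Binary.Definitions using (Decidable)
open import Relation.Binary.Lattice.Definitions using (Supremum)
open import Relation.Binary.PropositionalEquality using (_≡_; refl; cong)
open import Relation.Binary.Structures using (IsStrictPartialOrder)
open import Relation.Nullary.Decidable using (yes; no; ¬?)
open import Relation.Nullary.Negation using (¬_)

-- The k-tuples with entries in a given list.

tuples : ∀ {a} {A : Set a} (k : ℕ) → List A → List (Vec A k)
tuples zero    xs = [] ∷ []
tuples (suc k) xs = cartesianProductWith _∷_ xs (tuples k xs)

------------------------------------------------------------------------
-- Gaussian integers and 𝔱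

infix 5 _+_i

record ℤ[i] : Set where
  constructor _+_i
  field
    re im : ℤ

0ᵍ 1ᵍ : ℤ[i]
0ᵍ = + 0 + + 0 i
1ᵍ = + 1 + + 0 i

infixl 7 _*ᵍ_

_*ᵍ_ : ℤ[i] → ℤ[i] → ℤ[i]
(a + b i) *ᵍ (c + d i) =
  (a ℤ.* c ℤ.- b ℤ.* d) + (a ℤ.* d ℤ.+ b ℤ.* c) i

fromℕᵍ : ℕ → ℤ[i]
fromℕᵍ n = + n + + 0 i

_≟ᵍ_ : Decidable {A = ℤ[i]} _≡_
(a + b i) ≟ᵍ (c + d i) with a ℤ.≟ c | b ℤ.≟ d
... | yes refl | yes refl = yes refl
... | no a≢c   | _        = no λ eq → a≢c (cong ℤ[i].re eq)
... | yes _    | no b≢d   = no λ eq → b≢d (cong ℤ[i].im eq)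

units : List ℤ[i]
units = (+ 1 + + 0 i) ∷ (-[1+ 0 ] + + 0 i) ∷ (+ 0 + + 1 i) ∷ (+ 0 + -[1+ 0 ] i) ∷ []

Associated : Rel ℤ[i] _
Associated z z′ = Any (λ u → z ≡ u *ᵍ z′) units

associated? : Decidable Associated
associated? z z′ = any? (λ u → z ≟ᵍ (u *ᵍ z′)) units

productᵍ : ∀ {k} → Vec ℤ[i] k → ℤ[i]
productᵍ = Vec.foldr′ _*ᵍ_ 1ᵍ

-- The nonzero Gaussian integers with real and imaginary parts in [-a, a].
-- For a ≥ 1 they include all the divisors of a in ℤ[i], since a divisor of a
-- has norm at most a².

box : ℕ → List ℤ[i]
box a = filter (λ z → ¬? (z ≟ᵍ 0ᵍ)) (cartesianProductWith _+_i range range)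
  where
  range : List ℤ
  range = List.map (λ j → + j ℤ.- + a) (upTo (suc (2 ℕ.* a)))

𝔱 : (k a : ℕ) → ℕ
𝔱 k a =
  length
    (deduplicate (Pointwise.decidable associated?)
      (filter (λ ds → associated? (productᵍ ds) (fromℕᵍ a))
        (tuples k (box a))))

------------------------------------------------------------------------
-- Arithmetic functions.  The value at 0 is irrelevant throughout.

record IsMultiplicative (f : ℕ → ℕ) : Set where
  field
    f1≡1 : f 1 ≡ 1
    f-*  : ∀ m n → 1 ℕ.≤ m → 1 ℕ.≤ n → Coprime m n → f (m ℕ.* n) ≡ f m ℕ.* f n

-- τ is τ^{(e)}_{k*}.  These conditions determine τ n for every n ≥ 1.

record IsτE (k : ℕ) (τ : ℕ → ℕ) : Set where
  field
    isMultiplicative : IsMultiplicative τ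
    primePower       : ∀ p a → Prime p → 1 ℕ.≤ a → τ (p ℕ.^ a) ≡ 𝔱 k a

[1⋯_] : ℕ → List ℕ
[1⋯ n ] = List.map suc (upTo n)

summatory : (ℕ → ℕ) → ℕ → ℕ
summatory f N = sum (List.map f [1⋯ N ])

-- d₀ d₁² ⋯ dₗ²

weight : ∀ {l} → Vec ℕ (suc l) → ℕ
weight (d₀ ∷ ds) = d₀ ℕ.* Vec.foldr′ ℕ._*_ 1 (Vec.map (ℕ._^ 2) ds)

-- #{ (d₀, …, dₗ) : dᵢ ≥ 1, d₀ d₁² ⋯ dₗ² ≤ N }; each dᵢ in such a tuple is ≤ N.

divisorCount : (l N : ℕ) → ℕ
divisorCount l N = length (filter (λ ds → weight ds ℕₚ.≤? N) (tuples (suc l) [1⋯ N ]))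

------------------------------------------------------------------------
-- Real numbers

-- An ordered field whose apartness is the one given by its order, with binary
-- maxima (hence absolute values).

record OrderedField c ℓ₁ ℓ₂ : Set (lsuc (c ⊔ˡ ℓ₁ ⊔ˡ ℓ₂)) where
  field
    heytingField : HeytingField c ℓ₁ ℓ₂

  open HeytingField heytingField public

  infix  4 _<_ _≤_
  infixl 6 _⊔_

  field
    _<_ : Rel Carrier ℓ₂
    _⊔_ : Carrier → Carrier → Carrier

  _≤_ : Rel Carrier ℓ₂
  x ≤ y = ¬ (y < x)

  field
    isStrictPartialOrder : IsStrictPartialOrder _≈_ _<_
    #⇒<⊎>      : ∀ {x y} → x # y → x < y ⊎ y < x
    <⇒#        : ∀ {x y} → x < y → x # y
    +-monoˡ-<  : ∀ z {x y} → x < y → x + z < y + z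
    *-pos      : ∀ {x y} → 0# < x → 0# < y → 0# < x * y
    ⊔-supremum : Supremum _≤_ _⊔_

  open IsStrictPartialOrder isStrictPartialOrder public
    using (<-respˡ-≈; <-respʳ-≈)
    renaming (irrefl to <-irrefl; trans to <-trans)

  commutativeRing : CommutativeRing c ℓ₁
  commutativeRing = HeytingCommutativeRing.commutativeRing heytingCommutativeRing

  open RingProperties (CommutativeRing.ring commutativeRing)
    using (-1*x≈-x; -‿involutive; -0#≈0#)

  ∣_∣ : Carrier → Carrier
  ∣ x ∣ = x ⊔ (- x)

  fromℕ : ℕ → Carrier
  fromℕ n = n ×# 1#
    where open RawMonoidDefinitions (CommutativeRing.+-rawMonoid commutativeRing)
            renaming (_×_ to _×#_)

  1-0≈1 : 1# - 0# ≈ 1#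
  1-0≈1 = trans (+-congˡ -0#≈0#) (+-identityʳ 1#)

  1#0 : 1# # 0#
  1#0 = invertible⇒# (1# , trans (*-identityˡ _) 1-0≈1 , trans (*-identityʳ _) 1-0≈1)

  0<1 : 0# < 1#
  0<1 with #⇒<⊎> 1#0
  ... | inj₂ 0<1 = 0<1
  ... | inj₁ 1<0 = <-respʳ-≈ (trans (-1*x≈-x (- 1#)) (-‿involutive 1#)) (*-pos 0<-1 0<-1)
    where
    0<-1 : 0# < - 1#
    0<-1 = <-respˡ-≈ (-‿inverseʳ 1#) (<-respʳ-≈ (+-identityˡ (- 1#)) (+-monoˡ-< (- 1#) 1<0))

  0<fromℕ[1+n] : ∀ n → 0# < fromℕ (suc n)
  0<fromℕ[1+n] zero    = <-respʳ-≈ (sym (+-identityʳ 1#)) 0<1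
  0<fromℕ[1+n] (suc n) =
    <-trans (0<fromℕ[1+n] n)
      (<-respˡ-≈ (+-identityˡ _) (+-monoˡ-< (fromℕ (suc n)) 0<1))

  1/1+_ : ℕ → Carrier
  1/1+ n = proj₁ (#⇒invertible (#-sym (<⇒# (0<fromℕ[1+n] n))))

  ½ ⅓ : Carrier
  ½ = 1/1+ 1
  ⅓ = 1/1+ 2

  CauchySequence : (ℕ → Carrier) → Set (c ⊔ˡ ℓ₂)
  CauchySequence s = ∀ ε → 0# < ε →
    ∃[ N ] ∀ m n → N ℕ.≤ m → N ℕ.≤ n → ∣ s m - s n ∣ < ε

  ConvergesTo : (ℕ → Carrier) → Carrier → Set (c ⊔ˡ ℓ₂)
  ConvergesTo s x = ∀ ε → 0# < ε →
    ∃[ N ] ∀ n → N ℕ.≤ n → ∣ s n - x ∣ < ε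

-- The reals, axiomatised as the Cauchy-complete archimedean ordered field.
-- The axioms are constructive, so they hold of Bishop's reals as well as of
-- the classical ones.  The functions exp and log are not extra structure: they
-- exist in ℝ and the laws below determine them.

record RealNumbers c ℓ₁ ℓ₂ : Set (lsuc (c ⊔ˡ ℓ₁ ⊔ˡ ℓ₂)) where
  field
    orderedField : OrderedField c ℓ₁ ℓ₂

  open OrderedField orderedField public

  field
    archimedean : ∀ x → ∃[ n ] x < fromℕ n
    complete    : ∀ s → CauchySequence s → ∃[ x ] ConvergesTo s x

    exp         : Carrier → Carrier
    exp-cong    : ∀ {x y} → x ≈ y → exp x ≈ exp y
    exp-+       : ∀ x y → exp (x + y) ≈ exp x * exp y
    1+x≤exp[x]  : ∀ x → 1# + x ≤ exp x

    log         : ∀ x → 0# < x → Carrier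
    exp-log     : ∀ x (x>0 : 0# < x) → exp (log x x>0) ≈ x

  -- x ^ a for real x > 0

  pow : ∀ x → 0# < x → Carrier → Carrier
  pow x x>0 a = exp (a * log x x>0)

  -- Polynomials of degree exactly d; coefficients start at the constant term.

  record Polynomial (d : ℕ) : Set (c ⊔ˡ ℓ₂) where
    field
      coefficients : Vec Carrier (suc d)
      leading#0    : Vec.last coefficients # 0#

  eval : ∀ {d} → Polynomial d → Carrier → Carrier
  eval P x = Vec.foldr′ (λ a b → a + x * b) 0# (Polynomial.coefficients P)

  IsFloor : Carrier → ℕ → Set ℓ₂
  IsFloor x N = fromℕ N ≤ x × x < fromℕ (suc N)

  -- F ⌊x⌋ = A x + x^{1/2} P(log x) + O(x^{v+ε}) as x → ∞, for every ε > 0.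
  -- The implied constant K and the threshold x₀ may depend on ε.  The floor of
  -- a real is not computable, so it is quantified over.

  Expansion : (F : ℕ → ℕ) (A : Carrier) {d : ℕ} (P : Polynomial d) (v : Carrier) →
              Set (c ⊔ˡ ℓ₂)
  Expansion F A P v =
    ∀ ε → 0# < ε →
    ∃[ K ] ∃[ x₀ ] ∀ x (x>0 : 0# < x) N → x₀ ≤ x → IsFloor x N →
      ∣ fromℕ (F N) - (A * x + pow x x>0 ½ * eval P (log x x>0)) ∣
        ≤ K * pow x x>0 (v + ε)

{-# OPTIONS --safe #-}

-- With t the coefficients 1, 𝔱 k 1, 𝔱 k 2, …, the Dirichlet series of τ is
-- ζ(s) ζ(2s)^l G(s), where the local factor of G at p is t(x) (1 - x) (1 - x²)^l at
-- x = p^(-s).  Since 𝔱 k 1 = 1 and 𝔱 k 2 = l + 1, that factor is 1 + O(x³), so G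
-- converges absolutely for s > 1/3, and Σ_{n≤N} τ(n) = Σ_m g(m) D(N/m), where D is
-- the counting function of the hypothesis.  Inserting the expansion of D gives
-- A = C₁ G(1), and the leading coefficient of P is that of Q times G(1/2) ≠ 0.
--
-- The sum over m is a product, over the j < J, of operators Σ_{a≤L} c_j(a) E_j^a with
-- (E_j φ)(m) = φ(jm).  For all J and L at least N it equals the summatory function
-- exactly, with an error bound uniform in J and L, so that x may be kept fixed while
-- J, L → ∞: no rate of convergence is needed for the main terms.

module Submission where

open import Defs
open import Algebra.Bundles using (CommutativeRing)
import Algebra.Definitions.RawMonoid as RawMonoidDefinitions
import Algebra.Properties.Ring as RingProperties
import Algebra.Properties.Semiring.Exp as SemiringExp
import Algebra.Properties.Semiring.Mult as SemiringMult
import Algebra.Properties.Semiring.Mult.TCOptimised as SemiringMult′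
import Algebra.Solver.Ring
open import Algebra.Solver.Ring.AlmostCommutativeRing
  using (fromCommutativeRing; _-Raw-AlmostCommutative⟶_)
open import Data.Empty using (⊥; ⊥-elim)
open import Data.Fin.Base as Fin using (Fin)
open import Data.Integer.Base as ℤ using (ℤ; +_; -[1+_])
import Data.Integer.Properties as ℤₚ
open import Data.Integer.Solver using (module +-*-Solver)
open import Data.List.Base as List
  using (List; []; _∷_; _++_; length; filter; deduplicate; upTo; applyUpTo; cartesianProductWith)
open import Data.List.Membership.Propositional using (_∈_)
import Data.List.Membership.Propositional.Properties as ∈ₚ
open import Data.List.Membership.Propositional.Properties.WithK using (unique∧set⇒bag)
import Data.List.Properties as Listₚ
open import Data.List.Relation.Binary.BagAndSetEquality using (∼bag⇒↭)
open import Data.List.Relation.Binary.Permutation.Propositional.Properties using (↭-length)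
open import Data.List.Relation.Unary.All as All using (All; []; _∷_; all?)
import Data.List.Relation.Unary.All.Properties as Allₚ
open import Data.List.Relation.Unary.AllPairs using ([]; _∷_)
open import Data.List.Relation.Unary.Any using (Any; here; there; any?)
open import Data.List.Relation.Unary.Unique.Propositional using (Unique)
import Data.List.Relation.Unary.Unique.DecPropositional.Properties as UniqueDecₚ
import Data.List.Relation.Unary.Unique.Propositional.Properties as Uniqueₚ
open import Data.Maybe.Base using (Maybe; just; nothing)
open import Data.Nat.Base as ℕ using (ℕ; zero; suc; z≤n; s≤s; NonZero)
open import Data.Nat.Coprimality using (Coprime; coprime-divisor)
import Data.Nat.DivMod as ℕ/
open import Data.Nat.Divisibility as ∣ℕ
  using (_∣_; _∤_; _∣?_; divides; hasNonTrivialDivisor; ∣-trans; ∣-refl)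
open import Data.Nat.ListAction using (sum)
open import Data.Nat.Primality
  using (Prime; prime?; _Rough_; 2-rough; rough-1; ∤⇒rough-suc; rough∧∣⇒rough; rough∧∣⇒prime;
         prime⇒irreducible)
import Data.Nat.Properties as ℕₚ
open import Data.Nat.Solver using () renaming (module +-*-Solver to ℕ-Solver)
open import Data.Product.Base using (_×_; _,_; proj₁; proj₂; ∃-syntax; Σ-syntax)
import Data.Sign.Base as Sign
open import Data.Sum.Base using (_⊎_; inj₁; inj₂; [_,_]′)
open import Data.Vec.Base as Vec using (Vec; []; _∷_)
import Data.Vec.Properties as Vecₚ
open import Data.Vec.Relation.Binary.Pointwise.Inductive as Pointwise using (Pointwise; []; _∷_)
import Data.Vec.Relation.Unary.All as VecAll
open import Function.Base using (_∘_; id)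
open import Function.Bundles using (_⇔_; mk⇔; Equivalence)
import Level
open import Relation.Binary.Core using (Rel)
open import Relation.Binary.Definitions using (Decidable; DecidableEquality)
open import Relation.Binary.PropositionalEquality as ≡ using (_≡_)
open import Relation.Nullary.Decidable
  using (Dec; yes; no; ¬?; _×-dec_; _→-dec_; from-yes)
open import Relation.Nullary.Negation using (¬_)

-- The error has to be controlled for every m, not only for m ≤ x: when m > x the count D(⌊x/m⌋) is
-- 0 while the main term at x/m is not. Both ranges are put under one majorant x^(v+ε) m^(-σ) with σ
-- slightly above 1/3, which is where the maximum with 1/3 comes from. For m > x the term
-- (x/m)^(1/2) Q(log(x/m)) must be O((x/m)^σ), so σ also has to stay below 1/2. The functions m^(-σ)
-- are eigenfunctions of every dilation E_j. A weighted sup norm built from them turns bounds for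
-- the local factors into bounds for the whole product, and the coefficients g(m) are never formed.
-- The product runs over all j ≥ 2 with factor 1 at composite j, so that primes are sieved out index
-- by index. Since the order of the reals need not be decidable, comparisons of reals enter through
-- the stability of `≤` or through apartness and cotransitivity.

-- Order, absolute value and division in a constructive ordered field.

module FieldProperties {c ℓ₁ ℓ₂} (ℝ : RealNumbers c ℓ₁ ℓ₂) where
  open RealNumbers ℝ hiding (zero)

  ring = CommutativeRing.ring commutativeRing
  semiring = CommutativeRing.semiring commutativeRing

  open RingProperties ring using (-0#≈0#; -‿involutive; -‿distribˡ-*; -‿distribʳ-*; -‿+-comm)
    public
  module Mult = SemiringMult semiring
  module Mult′ = SemiringMult′ semiring
  open RawMonoidDefinitions (CommutativeRing.+-rawMonoid commutativeRing)
    using () renaming (_×′_ to _×′#_)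

  -- Integer coefficients, whose equality is decidable, let the ring solver cancel terms.
  ι : ℤ → Carrier
  ι (+ n)    = n ×′# 1#
  ι -[1+ n ] = - (suc n ×′# 1#)

  private
    ⟦_⟧ℕ : ℕ → Carrier
    ⟦ n ⟧ℕ = n ×′# 1#

    ⟦⟧ℕ-+ : ∀ m n → ⟦ m ℕ.+ n ⟧ℕ ≈ ⟦ m ⟧ℕ + ⟦ n ⟧ℕ
    ⟦⟧ℕ-+ = Mult′.×-homo-+ 1#

    ⟦⟧ℕ-* : ∀ m n → ⟦ m ℕ.* n ⟧ℕ ≈ ⟦ m ⟧ℕ * ⟦ n ⟧ℕ
    ⟦⟧ℕ-* = Mult′.×1-homo-*

    cancel : ∀ z x y → (z + x) - (z + y) ≈ x - y
    cancel z x y = trans (+-congˡ (sym (-‿+-comm z y))) (trans (+-congʳ (+-comm z x))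
      (trans (+-assoc x z _) (+-congˡ (trans (sym (+-assoc z (- z) (- y)))
        (trans (+-congʳ (-‿inverseʳ z)) (+-identityˡ (- y)))))))

    ι-⊖ : ∀ m n → ι (m ℤ.⊖ n) ≈ ⟦ m ⟧ℕ - ⟦ n ⟧ℕ
    ι-⊖ m       zero    = sym (trans (+-congˡ -0#≈0#) (+-identityʳ _))
    ι-⊖ zero    (suc n) = sym (+-identityˡ _)
    ι-⊖ (suc m) (suc n) rewrite ℤₚ.[1+m]⊖[1+n]≡m⊖n m n =
      trans (ι-⊖ m n) (sym (trans (+-cong (⟦⟧ℕ-+ 1 m) (-‿cong (⟦⟧ℕ-+ 1 n))) (cancel _ _ _)))

    ι-+ : ∀ a b → ι (a ℤ.+ b) ≈ ι a + ι b
    ι-+ (+ m)    (+ n)    = ⟦⟧ℕ-+ m n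
    ι-+ (+ m)    -[1+ n ] = ι-⊖ m (suc n)
    ι-+ -[1+ m ] (+ n)    = trans (ι-⊖ n (suc m)) (+-comm _ _)
    ι-+ -[1+ m ] -[1+ n ] =
      trans (-‿cong (trans (reflexive (≡.cong (λ p → ⟦ suc p ⟧ℕ) (≡.sym (ℕₚ.+-suc m n))))
        (⟦⟧ℕ-+ (suc m) (suc n)))) (sym (-‿+-comm _ _))

    ι-◃⁺ : ∀ n → ι (Sign.+ ℤ.◃ n) ≈ ⟦ n ⟧ℕ
    ι-◃⁺ zero    = refl
    ι-◃⁺ (suc n) = refl

    ι-◃⁻ : ∀ n → ι (Sign.- ℤ.◃ n) ≈ - ⟦ n ⟧ℕ
    ι-◃⁻ zero    = sym -0#≈0#
    ι-◃⁻ (suc n) = refl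

    ι-* : ∀ a b → ι (a ℤ.* b) ≈ ι a * ι b
    ι-* (+ m)    (+ n)    = trans (ι-◃⁺ (m ℕ.* n)) (⟦⟧ℕ-* m n)
    ι-* (+ m)    -[1+ n ] = trans (ι-◃⁻ (m ℕ.* suc n))
      (trans (-‿cong (⟦⟧ℕ-* m (suc n))) (-‿distribʳ-* _ _))
    ι-* -[1+ m ] (+ n)    = trans (ι-◃⁻ (suc m ℕ.* n))
      (trans (-‿cong (⟦⟧ℕ-* (suc m) n)) (-‿distribˡ-* _ _))
    ι-* -[1+ m ] -[1+ n ] = trans (⟦⟧ℕ-* (suc m) (suc n))
      (trans (sym (-‿involutive _)) (trans (-‿cong (-‿distribˡ-* _ _)) (-‿distribʳ-* _ _)))

    ι-neg : ∀ a → ι (ℤ.- a) ≈ - ι a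
    ι-neg (+ zero)  = sym -0#≈0#
    ι-neg (+ suc n) = refl
    ι-neg -[1+ n ]  = sym (-‿involutive _)

    ι-morphism : ℤ.+-*-rawRing -Raw-AlmostCommutative⟶ fromCommutativeRing commutativeRing
    ι-morphism = record
      { ⟦_⟧    = ι
      ; +-homo = ι-+
      ; *-homo = ι-*
      ; -‿homo = ι-neg
      ; 0-homo = refl
      ; 1-homo = refl
      }

    ι-≟ : ∀ a b → Maybe (ι a ≈ ι b)
    ι-≟ a b with a ℤₚ.≟ b
    ... | yes ≡.refl = just refl
    ... | no _       = nothing

  module Solver = Algebra.Solver.Ring ℤ.+-*-rawRing (fromCommutativeRing commutativeRing)
                    ι-morphism ι-≟
  open Solver using (solve; _:=_; _:+_; _:*_; _:-_; :-_; con)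

  abstract
    ¬#⇒≈ : ∀ {x y} → ¬ (x # y) → x ≈ y
    ¬#⇒≈ {x} {y} = proj₁ (tight x y)

    <-asym : ∀ {x y} → x < y → ¬ (y < x)
    <-asym x<y y<x = <-irrefl refl (<-trans x<y y<x)

    -- The substitute for trichotomy: `z` is apart from `x` or from `y`, and if it lies on the outer
    -- side of that one, transitivity compares it with the other.
    <-cotrans : ∀ {x y} → x < y → ∀ z → x < z ⊎ z < y
    <-cotrans {x} {y} x<y z with #-cotrans (<⇒# x<y) z
    ... | inj₁ x#z = [ inj₁ , (λ z<x → inj₂ (<-trans z<x x<y)) ]′ (#⇒<⊎> x#z)
    ... | inj₂ z#y = [ inj₂ , (λ y<z → inj₁ (<-trans x<y y<z)) ]′ (#⇒<⊎> z#y)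

    <⇒≤ : ∀ {x y} → x < y → x ≤ y
    <⇒≤ = <-asym

    ≤-refl : ∀ {x} → x ≤ x
    ≤-refl = <-irrefl refl

    ≤-reflexive : ∀ {x y} → x ≈ y → x ≤ y
    ≤-reflexive x≈y y<x = <-irrefl (sym x≈y) y<x

    <-≤-trans : ∀ {x y z} → x < y → y ≤ z → x < z
    <-≤-trans {z = z} x<y y≤z = [ id , ⊥-elim ∘ y≤z ]′ (<-cotrans x<y z)

    ≤-<-trans : ∀ {x y z} → x ≤ y → y < z → x < z
    ≤-<-trans {x} x≤y y<z = [ ⊥-elim ∘ x≤y , id ]′ (<-cotrans y<z x)

    ≤-trans : ∀ {x y z} → x ≤ y → y ≤ z → x ≤ z
    ≤-trans x≤y y≤z z<x = y≤z (<-≤-trans z<x x≤y)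

    ≤-antisym : ∀ {x y} → x ≤ y → y ≤ x → x ≈ y
    ≤-antisym x≤y y≤x = ¬#⇒≈ λ x#y → [ y≤x , x≤y ]′ (#⇒<⊎> x#y)

    -- ≤ is stable, so that a proof of x ≤ y may split on any comparison.
    ≤-cases : ∀ {x y} u v → (u < v → x ≤ y) → (v ≤ u → x ≤ y) → x ≤ y
    ≤-cases u v f g y<x = g (λ u<v → f u<v y<x) y<x

    +-mono-< : ∀ {x y u v} → x < y → u ≤ v → x + u < y + v
    +-mono-< {x} {y} {u} {v} x<y u≤v = <-≤-trans (+-monoˡ-< u x<y) λ y+v<y+u →
      u≤v (<-respˡ-≈ (lem y v) (<-respʳ-≈ (lem y u) (+-monoˡ-< (- y) y+v<y+u)))
      where
      lem : ∀ y v → y + v - y ≈ v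
      lem = solve 2 (λ y v → y :+ v :- y := v) refl

    +-mono-≤ : ∀ {x y u v} → x ≤ y → u ≤ v → x + u ≤ y + v
    +-mono-≤ {x} {y} {u} {v} x≤y u≤v y+v<x+u = x≤y
      (<-respˡ-≈ (lem y v) (<-respʳ-≈ (lem x v) (<-≤-trans (+-monoˡ-< (- v) y+v<x+u)
        λ p → u≤v (<-respˡ-≈ (lem₂ x v) (<-respʳ-≈ (lem₃ x u v) (+-monoˡ-< (v - x) p))))))
      where
      lem : ∀ y v → y + v - v ≈ y
      lem = solve 2 (λ y v → y :+ v :- v := y) refl
      lem₂ : ∀ x v → x + v - v + (v - x) ≈ v
      lem₂ = solve 2 (λ x v → x :+ v :- v :+ (v :- x) := v) refl
      lem₃ : ∀ x u v → x + u - v + (v - x) ≈ u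
      lem₃ = solve 3 (λ x u v → x :+ u :- v :+ (v :- x) := u) refl

    0≤y-x : ∀ {x y} → x ≤ y → 0# ≤ y - x
    0≤y-x {x} {y} x≤y = ≤-trans (≤-reflexive (sym (-‿inverseʳ x))) (+-mono-≤ x≤y ≤-refl)

    0<y-x : ∀ {x y} → x < y → 0# < y - x
    0<y-x {x} {y} x<y = <-respˡ-≈ (-‿inverseʳ x) (+-mono-< x<y ≤-refl)

    -- Inequalities are proved by exhibiting the difference as a nonnegative expression.
    ≤-diff : ∀ {x y} d → 0# ≤ d → y ≈ x + d → x ≤ y
    ≤-diff {x} {y} d 0≤d y≈x+d = ≤-trans (≤-reflexive (sym (+-identityʳ x)))
      (≤-trans (+-mono-≤ ≤-refl 0≤d) (≤-reflexive (sym y≈x+d)))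

    <-diff : ∀ {x y} d → 0# < d → y ≈ x + d → x < y
    <-diff {x} {y} d 0<d y≈x+d = <-respˡ-≈ (+-identityˡ x) (<-respʳ-≈ (trans (+-comm d x) (sym y≈x+d))
      (+-monoˡ-< x 0<d))

    +-nonneg : ∀ {x y} → 0# ≤ x → 0# ≤ y → 0# ≤ x + y
    +-nonneg 0≤x 0≤y = ≤-trans (≤-reflexive (sym (+-identityˡ 0#))) (+-mono-≤ 0≤x 0≤y)

    neg-mono-≤ : ∀ {x y} → x ≤ y → - y ≤ - x
    neg-mono-≤ {x} {y} x≤y = ≤-diff (y - x) (0≤y-x x≤y)
      (solve 2 (λ x y → :- x := :- y :+ (y :- x)) refl x y)

    neg-mono-< : ∀ {x y} → x < y → - y < - x
    neg-mono-< {x} {y} x<y = <-diff (y - x) (0<y-x x<y)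
      (solve 2 (λ x y → :- x := :- y :+ (y :- x)) refl x y)

    inverse-#0 : ∀ {w x} → w * x ≈ 1# → x # 0#
    inverse-#0 {w} {x} wx≈1 = invertible⇒# (w
      , trans (solve 2 (λ w x → w :* (x :- con (+ 0)) := w :* x) refl w x) wx≈1
      , trans (solve 2 (λ w x → (x :- con (+ 0)) :* w := w :* x) refl w x) wx≈1)

    #0-inverse : ∀ {x} → x # 0# → ∃[ w ] w * x ≈ 1#
    #0-inverse {x} x#0 = proj₁ (#⇒invertible x#0)
      , trans (solve 2 (λ w x → w :* x := w :* (x :- con (+ 0))) refl _ x)
          (proj₁ (proj₂ (#⇒invertible x#0)))

    -- The signs of `x` and `y` cannot be tested. But x y < 0 makes x y invertible, hence both
    -- factors invertible and apart from 0, hence both positive, which contradicts x y < 0.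
    *-nonneg : ∀ {x y} → 0# ≤ x → 0# ≤ y → 0# ≤ x * y
    *-nonneg {x} {y} 0≤x 0≤y xy<0 = <-asym xy<0 (*-pos (pos x y 0≤x xy≈) (pos y x 0≤y yx≈))
      where
      w,wxy≈1 : ∃[ w ] w * (x * y) ≈ 1#
      w,wxy≈1 = #0-inverse (<⇒# xy<0)
      xy≈ : ∃[ w ] w * (x * y) ≈ 1#
      xy≈ = w,wxy≈1
      yx≈ : ∃[ w ] w * (y * x) ≈ 1#
      yx≈ = proj₁ w,wxy≈1 , trans (*-congˡ (*-comm y x)) (proj₂ w,wxy≈1)
      pos : ∀ x y → 0# ≤ x → ∃[ w ] w * (x * y) ≈ 1# → 0# < x
      pos x y 0≤x (w , wxy≈1) = [ ⊥-elim ∘ 0≤x , id ]′ (#⇒<⊎> (inverse-#0 {w * y}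
        (trans (solve 3 (λ w x y → w :* y :* x := w :* (x :* y)) refl w x y) wxy≈1)))

    *-monoˡ-≤ : ∀ {x y} z → 0# ≤ z → x ≤ y → z * x ≤ z * y
    *-monoˡ-≤ {x} {y} z 0≤z x≤y = ≤-diff (z * (y - x)) (*-nonneg 0≤z (0≤y-x x≤y))
      (solve 3 (λ x y z → z :* y := z :* x :+ z :* (y :- x)) refl x y z)

    *-monoʳ-≤ : ∀ {x y} z → 0# ≤ z → x ≤ y → x * z ≤ y * z
    *-monoʳ-≤ {x} {y} z 0≤z x≤y = ≤-diff (z * (y - x)) (*-nonneg 0≤z (0≤y-x x≤y))
      (solve 3 (λ x y z → y :* z := x :* z :+ z :* (y :- x)) refl x y z)

    *-monoˡ-< : ∀ {x y} z → 0# < z → x < y → z * x < z * y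
    *-monoˡ-< {x} {y} z 0<z x<y = <-diff (z * (y - x)) (*-pos 0<z (0<y-x x<y))
      (solve 3 (λ x y z → z :* y := z :* x :+ z :* (y :- x)) refl x y z)

    *-mono-≤ : ∀ {x y u v} → 0# ≤ x → 0# ≤ v → x ≤ y → u ≤ v → x * u ≤ y * v
    *-mono-≤ {x} {v = v} 0≤x 0≤v x≤y u≤v = ≤-trans (*-monoˡ-≤ x 0≤x u≤v) (*-monoʳ-≤ v 0≤v x≤y)

    0≤1 : 0# ≤ 1#
    0≤1 = <⇒≤ 0<1

    +-pos : ∀ {x y} → 0# < x → 0# ≤ y → 0# < x + y
    +-pos 0<x 0≤y = <-respˡ-≈ (+-identityˡ 0#) (+-mono-< 0<x 0≤y)

    inverse : ∀ {x} → 0# < x → Carrier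
    inverse 0<x = proj₁ (#⇒invertible (#-sym (<⇒# 0<x)))

    inverse-* : ∀ {x} (0<x : 0# < x) → inverse 0<x * x ≈ 1#
    inverse-* {x} 0<x = trans
      (solve 2 (λ j x → j :* x := j :* (x :- con (+ 0))) refl (inverse 0<x) x)
      (proj₁ (proj₂ (#⇒invertible (#-sym (<⇒# 0<x)))))

    *≈1⇒pos : ∀ {x y} → 0# < x → y * x ≈ 1# → 0# < y
    *≈1⇒pos {x} {y} 0<x yx≈1 =
      [ (λ y<0 → ⊥-elim (<-asym 0<1 (1<0 y<0))) , id ]′ (#⇒<⊎> (inverse-#0 (trans (*-comm x y) yx≈1)))
      where
      1<0 : y < 0# → 1# < 0#
      1<0 y<0 = <-respˡ-≈ (trans (*-comm x y) yx≈1) (<-respʳ-≈ (zeroʳ x) (*-monoˡ-< x 0<x y<0))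

    inverse-pos : ∀ {x} (0<x : 0# < x) → 0# < inverse 0<x
    inverse-pos 0<x = *≈1⇒pos 0<x (inverse-* 0<x)

    x≤∣x∣ : ∀ x → x ≤ ∣ x ∣
    x≤∣x∣ x = proj₁ (⊔-supremum x (- x))

    -x≤∣x∣ : ∀ x → - x ≤ ∣ x ∣
    -x≤∣x∣ x = proj₁ (proj₂ (⊔-supremum x (- x)))

    ∣∣-least : ∀ {x y} → x ≤ y → - x ≤ y → ∣ x ∣ ≤ y
    ∣∣-least {x} {y} p q = proj₂ (proj₂ (⊔-supremum x (- x))) y p q

    ∣∣-mono : ∀ {x y} → x ≈ y → ∣ x ∣ ≤ ∣ y ∣
    ∣∣-mono {x} {y} x≈y = ∣∣-least (≤-trans (≤-reflexive x≈y) (x≤∣x∣ y))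
      (≤-trans (≤-reflexive (-‿cong x≈y)) (-x≤∣x∣ y))

    ∣∣-cong : ∀ {x y} → x ≈ y → ∣ x ∣ ≈ ∣ y ∣
    ∣∣-cong x≈y = ≤-antisym (∣∣-mono x≈y) (∣∣-mono (sym x≈y))

    0≤∣x∣ : ∀ x → 0# ≤ ∣ x ∣
    0≤∣x∣ x = ≤-cases x 0#
      (λ x<0 → ≤-trans (≤-trans (≤-reflexive (sym -0#≈0#)) (neg-mono-≤ (<⇒≤ x<0))) (-x≤∣x∣ x))
      (λ 0≤x → ≤-trans 0≤x (x≤∣x∣ x))

    -x≤x : ∀ {x} → 0# ≤ x → - x ≤ x
    -x≤x {x} 0≤x = ≤-diff (x + x) (+-nonneg 0≤x 0≤x) (solve 1 (λ x → x := :- x :+ (x :+ x)) refl x)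

    0≤x⇒∣x∣≈x : ∀ {x} → 0# ≤ x → ∣ x ∣ ≈ x
    0≤x⇒∣x∣≈x {x} 0≤x = ≤-antisym (∣∣-least ≤-refl (-x≤x 0≤x)) (x≤∣x∣ x)

    ∣-x∣≈∣x∣ : ∀ x → ∣ - x ∣ ≈ ∣ x ∣
    ∣-x∣≈∣x∣ x = ≤-antisym
      (∣∣-least (-x≤∣x∣ x) (≤-trans (≤-reflexive (-‿involutive x)) (x≤∣x∣ x)))
      (∣∣-least (≤-trans (≤-reflexive (sym (-‿involutive x))) (-x≤∣x∣ (- x))) (x≤∣x∣ (- x)))

    ∣x+y∣≤∣x∣+∣y∣ : ∀ x y → ∣ x + y ∣ ≤ ∣ x ∣ + ∣ y ∣
    ∣x+y∣≤∣x∣+∣y∣ x y = ∣∣-least (+-mono-≤ (x≤∣x∣ x) (x≤∣x∣ y))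
      (≤-trans (≤-reflexive (sym (-‿+-comm x y))) (+-mono-≤ (-x≤∣x∣ x) (-x≤∣x∣ y)))

    ∣x-y∣≤∣x∣+∣y∣ : ∀ x y → ∣ x - y ∣ ≤ ∣ x ∣ + ∣ y ∣
    ∣x-y∣≤∣x∣+∣y∣ x y = ≤-trans (∣x+y∣≤∣x∣+∣y∣ x (- y)) (+-mono-≤ ≤-refl (≤-reflexive (∣-x∣≈∣x∣ y)))

    half-≤ : ∀ {x y} → x + x ≤ y + y → x ≤ y
    half-≤ h y<x = h (+-mono-< y<x (<⇒≤ y<x))

    -- 2(ab ± xy) = (a ± x)(b + y) + (a ∓ x)(b - y)
    ∣∣-*-bound : ∀ {x y a b} → x ≤ a → - x ≤ a → y ≤ b → - y ≤ b → ∣ x * y ∣ ≤ a * b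
    ∣∣-*-bound {x} {y} {a} {b} x≤a -x≤a y≤b -y≤b = ∣∣-least
      (half-≤ (≤-diff ((a - x) * (b - - y) + (a - - x) * (b - y))
        (+-nonneg (*-nonneg (0≤y-x x≤a) (0≤y-x -y≤b)) (*-nonneg (0≤y-x -x≤a) (0≤y-x y≤b)))
        (solve 4 (λ x y a b → a :* b :+ a :* b := x :* y :+ x :* y :+
          ((a :- x) :* (b :- :- y) :+ (a :- :- x) :* (b :- y))) refl x y a b)))
      (half-≤ (≤-diff ((a - x) * (b - y) + (a - - x) * (b - - y))
        (+-nonneg (*-nonneg (0≤y-x x≤a) (0≤y-x y≤b)) (*-nonneg (0≤y-x -x≤a) (0≤y-x -y≤b)))
        (solve 4 (λ x y a b → a :* b :+ a :* b := :- (x :* y) :+ :- (x :* y) :+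
          ((a :- x) :* (b :- y) :+ (a :- :- x) :* (b :- :- y))) refl x y a b)))

    ∣x*y∣≤∣x∣*∣y∣ : ∀ x y → ∣ x * y ∣ ≤ ∣ x ∣ * ∣ y ∣
    ∣x*y∣≤∣x∣*∣y∣ x y = ∣∣-*-bound (x≤∣x∣ x) (-x≤∣x∣ x) (x≤∣x∣ y) (-x≤∣x∣ y)

    ∣x∣≤y⇒ : ∀ {x y} → ∣ x ∣ ≤ y → - y ≤ x
    ∣x∣≤y⇒ {x} p = ≤-trans (neg-mono-≤ (≤-trans (-x≤∣x∣ x) p)) (≤-reflexive (-‿involutive x))

    ∣0∣≈0 : ∣ 0# ∣ ≈ 0#
    ∣0∣≈0 = 0≤x⇒∣x∣≈x ≤-refl

    fromℕ-+ : ∀ m n → fromℕ (m ℕ.+ n) ≈ fromℕ m + fromℕ n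
    fromℕ-+ = Mult.×-homo-+ 1#

    fromℕ-* : ∀ m n → fromℕ (m ℕ.* n) ≈ fromℕ m * fromℕ n
    fromℕ-* = Mult.×1-homo-*

    fromℕ-nonneg : ∀ n → 0# ≤ fromℕ n
    fromℕ-nonneg zero    = ≤-refl
    fromℕ-nonneg (suc n) = <⇒≤ (0<fromℕ[1+n] n)

    fromℕ-mono : ∀ {m n} → m ℕ.≤ n → fromℕ m ≤ fromℕ n
    fromℕ-mono {n = n} z≤n = fromℕ-nonneg n
    fromℕ-mono (s≤s m≤n)   = +-mono-≤ ≤-refl (fromℕ-mono m≤n)

    1≤fromℕ : ∀ n → 1# ≤ fromℕ (suc n)
    1≤fromℕ n = ≤-diff (fromℕ n) (fromℕ-nonneg n) refl

    1/1+-* : ∀ n → (1/1+ n) * fromℕ (suc n) ≈ 1#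
    1/1+-* n = inverse-* (0<fromℕ[1+n] n)

    0<1/1+ : ∀ n → 0# < 1/1+ n
    0<1/1+ n = inverse-pos (0<fromℕ[1+n] n)

    ½+½≈1 : ½ + ½ ≈ 1#
    ½+½≈1 = trans (solve 1 (λ h → h :+ h := h :* (con (+ 1) :+ (con (+ 1) :+ con (+ 0)))) refl ½)
      (1/1+-* 1)

    ⅓+⅓+⅓≈1 : ⅓ + ⅓ + ⅓ ≈ 1#
    ⅓+⅓+⅓≈1 = trans (solve 1 (λ h → h :+ h :+ h
        := h :* (con (+ 1) :+ (con (+ 1) :+ (con (+ 1) :+ con (+ 0))))) refl ⅓)
      (1/1+-* 2)

    0<½ : 0# < ½
    0<½ = 0<1/1+ 1

    0<⅓ : 0# < ⅓
    0<⅓ = 0<1/1+ 2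

    half-pos : ∀ {x} → 0# < x → 0# < ½ * x
    half-pos 0<x = *-pos 0<½ 0<x

    half+half : ∀ x → ½ * x + ½ * x ≈ x
    half+half x = trans (sym (distribʳ x ½ ½)) (trans (*-congʳ ½+½≈1) (*-identityˡ x))

    half< : ∀ {x} → 0# < x → ½ * x < x
    half< {x} 0<x = <-diff (½ * x) (half-pos 0<x) (sym (half+half x))

    -- A positive common lower bound stands in for the minimum: cotransitivity on x/2 < x puts `y`
    -- above x/2 or below `x`, and x/2 or `y` itself is the witness.
    positive-min : ∀ {x y} → 0# < x → 0# < y → ∃[ z ] (0# < z × z ≤ x × z ≤ y)
    positive-min {x} {y} 0<x 0<y =
      [ (λ x/2<y → ½ * x , half-pos 0<x , <⇒≤ (half< 0<x) , <⇒≤ x/2<y)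
      , (λ y<x → y , 0<y , <⇒≤ y<x , ≤-refl) ]′ (<-cotrans (half< 0<x) y)

-- Finite sums.

module Sums {c ℓ₁ ℓ₂} (ℝ : RealNumbers c ℓ₁ ℓ₂) where
  open RealNumbers ℝ hiding (zero)
  open FieldProperties ℝ
  open Solver using (solve; _:=_; _:+_; _:*_; _:-_; :-_; con)

  ∑ : ℕ → (ℕ → Carrier) → Carrier
  ∑ zero    f = 0#
  ∑ (suc n) f = ∑ n f + f n

  abstract
    ∑-cong< : ∀ n {f g} → (∀ a → a ℕ.< n → f a ≈ g a) → ∑ n f ≈ ∑ n g
    ∑-cong< zero    f≈g = refl
    ∑-cong< (suc n) f≈g =
      +-cong (∑-cong< n λ a a<n → f≈g a (ℕₚ.m≤n⇒m≤1+n a<n)) (f≈g n ℕₚ.≤-refl)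

    ∑-cong : ∀ n {f g} → (∀ a → f a ≈ g a) → ∑ n f ≈ ∑ n g
    ∑-cong n f≈g = ∑-cong< n λ a _ → f≈g a

    ∑-zero : ∀ n {f} → (∀ a → f a ≈ 0#) → ∑ n f ≈ 0#
    ∑-zero zero    f≈0 = refl
    ∑-zero (suc n) f≈0 = trans (+-cong (∑-zero n f≈0) (f≈0 n)) (+-identityˡ 0#)

    ∑-+ : ∀ n f g → ∑ n (λ a → f a + g a) ≈ ∑ n f + ∑ n g
    ∑-+ zero    f g = sym (+-identityˡ 0#)
    ∑-+ (suc n) f g = trans (+-congʳ (∑-+ n f g))
      (solve 4 (λ u v w z → u :+ v :+ (w :+ z) := u :+ w :+ (v :+ z)) refl _ _ _ _)

    ∑-*ˡ : ∀ n x f → ∑ n (λ a → x * f a) ≈ x * ∑ n f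
    ∑-*ˡ zero    x f = sym (zeroʳ x)
    ∑-*ˡ (suc n) x f = trans (+-congʳ (∑-*ˡ n x f)) (sym (distribˡ x _ _))

    ∑-*ʳ : ∀ n x f → ∑ n (λ a → f a * x) ≈ ∑ n f * x
    ∑-*ʳ n x f = trans (∑-cong n λ a → *-comm (f a) x) (trans (∑-*ˡ n x f) (*-comm x _))

    ∑-neg : ∀ n f → ∑ n (λ a → - f a) ≈ - ∑ n f
    ∑-neg zero    f = sym -0#≈0#
    ∑-neg (suc n) f = trans (+-congʳ (∑-neg n f)) (-‿+-comm _ _)

    ∑-sub : ∀ n f g → ∑ n (λ a → f a - g a) ≈ ∑ n f - ∑ n g
    ∑-sub n f g = trans (∑-+ n f (λ a → - g a)) (+-congˡ (∑-neg n g))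

    ∑-swap : ∀ m n (f : ℕ → ℕ → Carrier) → ∑ m (λ a → ∑ n (f a)) ≈ ∑ n (λ b → ∑ m (λ a → f a b))
    ∑-swap zero    n f = sym (∑-zero n λ _ → refl)
    ∑-swap (suc m) n f = trans (+-congʳ (∑-swap m n f)) (sym (∑-+ n _ (f m)))

    ∑-head : ∀ n f → ∑ (suc n) f ≈ f 0 + ∑ n (f ∘ suc)
    ∑-head zero    f = +-comm 0# (f 0)
    ∑-head (suc n) f = trans (+-congʳ (∑-head n f)) (+-assoc _ _ _)

    ∑-split : ∀ m n f → ∑ (m ℕ.+ n) f ≈ ∑ m f + ∑ n (λ a → f (m ℕ.+ a))
    ∑-split m zero    f rewrite ℕₚ.+-identityʳ m = sym (+-identityʳ _)
    ∑-split m (suc n) f rewrite ℕₚ.+-suc m n = trans (+-congʳ (∑-split m n f)) (+-assoc _ _ _)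

    ∑-extend : ∀ {m n f} → m ℕ.≤ n → (∀ a → m ℕ.≤ a → f a ≈ 0#) → ∑ n f ≈ ∑ m f
    ∑-extend {m} {n} {f} m≤n f≈0 = trans
      (reflexive (≡.cong (λ p → ∑ p f) (≡.sym (ℕₚ.m+[n∸m]≡n m≤n))))
      (trans (∑-split m (n ℕ.∸ m) f)
        (trans (+-congˡ (∑-zero (n ℕ.∸ m) λ a → f≈0 _ (ℕₚ.m≤m+n m a))) (+-identityʳ _)))

    ∑-mono< : ∀ n {f g} → (∀ a → a ℕ.< n → f a ≤ g a) → ∑ n f ≤ ∑ n g
    ∑-mono< zero    f≤g = ≤-refl
    ∑-mono< (suc n) f≤g =
      +-mono-≤ (∑-mono< n λ a a<n → f≤g a (ℕₚ.m≤n⇒m≤1+n a<n)) (f≤g n ℕₚ.≤-refl)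

    ∑-mono : ∀ n {f g} → (∀ a → f a ≤ g a) → ∑ n f ≤ ∑ n g
    ∑-mono n f≤g = ∑-mono< n λ a _ → f≤g a

    ∑-nonneg : ∀ n {f} → (∀ a → 0# ≤ f a) → 0# ≤ ∑ n f
    ∑-nonneg n 0≤f = ≤-trans (≤-reflexive (sym (∑-zero n λ _ → refl))) (∑-mono n 0≤f)

    ∑-∣∣ : ∀ n f → ∣ ∑ n f ∣ ≤ ∑ n (λ a → ∣ f a ∣)
    ∑-∣∣ zero    f = ≤-reflexive ∣0∣≈0
    ∑-∣∣ (suc n) f = ≤-trans (∣x+y∣≤∣x∣+∣y∣ _ _) (+-mono-≤ (∑-∣∣ n f) ≤-refl)

    ≤∑ : ∀ n {f} → (∀ a → 0# ≤ f a) → ∀ a → a ℕ.< n → f a ≤ ∑ n f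
    ≤∑ (suc n) {f} 0≤f a a<1+n with ℕₚ.m≤n⇒m<n∨m≡n (ℕₚ.≤-pred a<1+n)
    ... | inj₁ a<n    = ≤-diff (∑ n f - f a + f n) (+-nonneg (0≤y-x (≤∑ n 0≤f a a<n)) (0≤f n))
      (solve 3 (λ s u v → s :+ v := u :+ (s :- u :+ v)) refl _ _ _)
    ... | inj₂ ≡.refl = ≤-diff (∑ n f) (∑-nonneg n 0≤f) (+-comm _ _)

-- Limits of sequences.

module Limits {c ℓ₁ ℓ₂} (ℝ : RealNumbers c ℓ₁ ℓ₂) where
  open RealNumbers ℝ hiding (zero)
  open FieldProperties ℝ
  open Solver using (solve; _:=_; _:+_; _:*_; _:-_; :-_; con)

  Vanishing : (ℕ → Carrier) → Set (c Level.⊔ ℓ₂)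
  Vanishing e = ∀ ε → 0# < ε → ∃[ N ] ∀ n → N ℕ.≤ n → e n < ε

  abstract
    lim-const : ∀ x → ConvergesTo (λ _ → x) x
    lim-const x ε 0<ε = 0 , λ n _ → ≤-<-trans
      (≤-reflexive (trans (∣∣-cong (-‿inverseʳ x)) ∣0∣≈0)) 0<ε

    lim-cong : ∀ {s t x y} → (∀ n → s n ≈ t n) → x ≈ y → ConvergesTo s x → ConvergesTo t y
    lim-cong s≈t x≈y s⟶x ε 0<ε with s⟶x ε 0<ε
    ... | N , h = N , λ n N≤n → ≤-<-trans
      (≤-reflexive (∣∣-cong (+-cong (sym (s≈t n)) (-‿cong (sym x≈y))))) (h n N≤n)

    lim-+ : ∀ {s t x y} → ConvergesTo s x → ConvergesTo t y → ConvergesTo (λ n → s n + t n) (x + y)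
    lim-+ {s} {t} {x} {y} s⟶x t⟶y ε 0<ε with s⟶x (½ * ε) (half-pos 0<ε) | t⟶y (½ * ε) (half-pos 0<ε)
    ... | M , f | N , g = M ℕ.+ N , λ n M+N≤n → ≤-<-trans
      (≤-trans (∣∣-mono (solve 4 (λ s t x y → s :+ t :- (x :+ y) := (s :- x) :+ (t :- y)) refl _ _ _ _))
        (∣x+y∣≤∣x∣+∣y∣ _ _))
      (<-≤-trans (+-mono-< (f n (ℕₚ.m+n≤o⇒m≤o M M+N≤n)) (<⇒≤ (g n (ℕₚ.m+n≤o⇒n≤o M M+N≤n))))
        (≤-reflexive (half+half ε)))

    -- Dividing by k + 1 instead of k keeps the divisor positive when k = 0.
    scaled-< : ∀ {k a ε} (0<k+1 : 0# < k + 1#) → 0# ≤ a → a < ε * inverse 0<k+1 → k * a < ε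
    scaled-< {k} {a} {ε} 0<k+1 0≤a a<ε/k = ≤-<-trans
      (≤-diff a 0≤a (solve 2 (λ k d → (k :+ con (+ 1)) :* d := k :* d :+ d) refl k a))
      (<-≤-trans (*-monoˡ-< (k + 1#) 0<k+1 a<ε/k) (≤-reflexive
        (trans (solve 3 (λ K ε j → K :* (ε :* j) := ε :* (j :* K)) refl (k + 1#) ε _)
          (trans (*-congˡ (inverse-* 0<k+1)) (*-identityʳ ε)))))

    0<x+1 : ∀ {x} → 0# ≤ x → 0# < x + 1#
    0<x+1 {x} 0≤x = <-respʳ-≈ (+-comm 1# x) (+-pos 0<1 0≤x)

    lim-*ˡ : ∀ {s x} k → ConvergesTo s x → ConvergesTo (λ n → k * s n) (k * x)
    lim-*ˡ {s} {x} k s⟶x ε 0<ε =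
      let 0<k+1 = 0<x+1 (0≤∣x∣ k)
          N , h = s⟶x (ε * inverse 0<k+1) (*-pos 0<ε (inverse-pos 0<k+1))
      in N , λ n N≤n → ≤-<-trans
        (≤-trans (∣∣-mono (solve 3 (λ k s x → k :* s :- k :* x := k :* (s :- x)) refl k (s n) x))
          (∣x*y∣≤∣x∣*∣y∣ k _))
        (scaled-< 0<k+1 (0≤∣x∣ _) (h n N≤n))

    lim-sub : ∀ {s t x y} → ConvergesTo s x → ConvergesTo t y → ConvergesTo (λ n → s n - t n) (x - y)
    lim-sub s⟶x t⟶y = lim-+ s⟶x
      (lim-cong (λ n → neg _) (neg _) (lim-*ˡ (- 1#) t⟶y))
      where
      neg : ∀ x → - 1# * x ≈ - x
      neg = solve 1 (λ x → :- con (+ 1) :* x := :- x) refl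

    lim-unsuc : ∀ {s x} → ConvergesTo (s ∘ suc) x → ConvergesTo s x
    lim-unsuc {s} {x} s⟶x ε 0<ε with s⟶x ε 0<ε
    ... | N , h = suc N , λ { (suc n) (s≤s N≤n) → h n N≤n }

    lim-≤ : ∀ {s x K} N → ConvergesTo s x → (∀ n → N ℕ.≤ n → s n ≤ K) → x ≤ K
    lim-≤ {s} {x} {K} M s⟶x s≤K K<x with s⟶x (x - K) (0<y-x K<x)
    ... | N , h = <-irrefl refl (≤-<-trans
      (≤-diff (K - s (M ℕ.+ N)) (0≤y-x (s≤K (M ℕ.+ N) (ℕₚ.m≤m+n M N)))
        (solve 3 (λ x s K → :- (s :- x) := x :- K :+ (K :- s)) refl _ _ _))
      (≤-<-trans (-x≤∣x∣ (s (M ℕ.+ N) - x)) (h (M ℕ.+ N) (ℕₚ.m≤n+m N M))))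

    lim-≥ : ∀ {s x K} N → ConvergesTo s x → (∀ n → N ℕ.≤ n → K ≤ s n) → K ≤ x
    lim-≥ {s} {x} {K} M s⟶x K≤s x<K with s⟶x (K - x) (0<y-x x<K)
    ... | N , h = <-irrefl refl (≤-<-trans
      (≤-diff (s (M ℕ.+ N) - K) (0≤y-x (K≤s (M ℕ.+ N) (ℕₚ.m≤m+n M N)))
        (solve 3 (λ x s K → s :- x := K :- x :+ (s :- K)) refl _ _ _))
      (≤-<-trans (x≤∣x∣ (s (M ℕ.+ N) - x)) (h (M ℕ.+ N) (ℕₚ.m≤n+m N M))))

    lim-eventually-≥ : ∀ {s x y} → ConvergesTo s x → y < x → ∃[ N ] ∀ n → N ℕ.≤ n → y ≤ s n
    lim-eventually-≥ {s} {x} {y} s⟶x y<x with s⟶x (x - y) (0<y-x y<x)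
    ... | N , h = N , λ n N≤n → <⇒≤ (<-diff (x - y - ∣ s n - x ∣ + (∣ s n - x ∣ - - (s n - x)))
      (+-pos (0<y-x (h n N≤n)) (0≤y-x (-x≤∣x∣ _)))
      (solve 4 (λ s x y a → s := y :+ (x :- y :- a :+ (a :- :- (s :- x)))) refl _ _ _ _))

    -- Carries an error bound that is uniform in n over to the limit of the main terms.
    lim-∣∣ : ∀ {s x y K} N → ConvergesTo s x → (∀ n → N ℕ.≤ n → ∣ y - s n ∣ ≤ K) → ∣ y - x ∣ ≤ K
    lim-∣∣ {s} {x} {y} {K} N s⟶x h = ∣∣-least
      (lim-≤ N y-s⟶ λ n N≤n → ≤-trans (x≤∣x∣ _) (h n N≤n))
      (≤-trans (neg-mono-≤ (lim-≥ N y-s⟶ λ n N≤n → ∣x∣≤y⇒ (h n N≤n))) (≤-reflexive (-‿involutive K)))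
      where
      y-s⟶ : ConvergesTo (λ n → y - s n) (y - x)
      y-s⟶ = lim-sub (lim-const y) s⟶x

    converges : ∀ s e → Vanishing e → (∀ m n → n ℕ.≤ m → ∣ s m - s n ∣ ≤ e n) →
                ∃[ x ] ConvergesTo s x
    converges s e e→0 h = complete s cauchy
      where
      cauchy : CauchySequence s
      cauchy ε 0<ε with e→0 (½ * ε) (half-pos 0<ε)
      ... | N , e<ε/2 = N , λ m n N≤m N≤n → ≤-<-trans
        (≤-trans (∣∣-mono (solve 3 (λ a b c → a :- b := (a :- c) :- (b :- c)) refl _ _ (s N)))
          (≤-trans (∣x-y∣≤∣x∣+∣y∣ _ _) (+-mono-≤ (h m N N≤m) (h n N N≤n))))
        (<-≤-trans (+-mono-< (e<ε/2 N ℕₚ.≤-refl) (<⇒≤ (e<ε/2 N ℕₚ.≤-refl))) (≤-reflexive (half+half ε)))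

    vanishing-*ˡ : ∀ {e} K → 0# ≤ K → (∀ n → 0# ≤ e n) → Vanishing e → Vanishing (λ n → K * e n)
    vanishing-*ˡ {e} K 0≤K 0≤e e→0 ε 0<ε =
      let N , h = e→0 (ε * inverse (0<x+1 0≤K)) (*-pos 0<ε (inverse-pos (0<x+1 0≤K)))
      in N , λ n N≤n → scaled-< (0<x+1 0≤K) (0≤e n) (h n N≤n)

    vanishing-+ : ∀ {e f} → Vanishing e → Vanishing f → Vanishing (λ n → e n + f n)
    vanishing-+ e→0 f→0 ε 0<ε with e→0 (½ * ε) (half-pos 0<ε) | f→0 (½ * ε) (half-pos 0<ε)
    ... | M , g | N , h = M ℕ.+ N , λ n M+N≤n → <-≤-trans
      (+-mono-< (g n (ℕₚ.m+n≤o⇒m≤o M M+N≤n)) (<⇒≤ (h n (ℕₚ.m+n≤o⇒n≤o M M+N≤n))))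
      (≤-reflexive (half+half ε))

-- The exponential function and geometric series.

module Exponential {c ℓ₁ ℓ₂} (ℝ : RealNumbers c ℓ₁ ℓ₂) where
  open RealNumbers ℝ hiding (zero)
  open FieldProperties ℝ
  open Sums ℝ
  open Limits ℝ
  open Solver using (solve; _:=_; _:+_; _:*_; _:-_; :-_; con)
  open SemiringExp semiring public using (_^_; ^-homo-*)

  abstract
    x≤exp[x] : ∀ x → x ≤ exp x
    x≤exp[x] x = ≤-trans (≤-diff 1# 0≤1 (+-comm 1# x)) (1+x≤exp[x] x)

    -- With e = exp 0 one has e = e², so e > 1 would give e < e²; the other inequality is 1 + 0 ≤
    -- exp 0.
    exp-0 : exp 0# ≈ 1#
    exp-0 = ≤-antisym
      (λ 1<e → <-irrefl (trans (sym (exp-cong (+-identityˡ 0#))) (exp-+ 0# 0#))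
        (<-respˡ-≈ (*-identityʳ _) (*-monoˡ-< (exp 0#) (<-trans 0<1 1<e) 1<e)))
      (≤-trans (≤-reflexive (sym (+-identityʳ 1#))) (1+x≤exp[x] 0#))

    exp-+-neg : ∀ x → exp x * exp (- x) ≈ 1#
    exp-+-neg x = trans (sym (exp-+ x (- x))) (trans (exp-cong (-‿inverseʳ x)) exp-0)

    square-nonneg : ∀ x → 0# ≤ x * x
    square-nonneg x = ≤-cases x 0#
      (λ x<0 → ≤-trans (*-nonneg (0≤y-x (<⇒≤ x<0)) (0≤y-x (<⇒≤ x<0)))
        (≤-reflexive (solve 1 (λ x → (con (+ 0) :- x) :* (con (+ 0) :- x) := x :* x) refl x)))
      (λ 0≤x → *-nonneg 0≤x 0≤x)

    -- exp x is the square of exp (x/2). Strict positivity follows since exp x is invertible, with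
    -- inverse exp (- x), and so apart from 0.
    exp-nonneg : ∀ x → 0# ≤ exp x
    exp-nonneg x = ≤-trans (square-nonneg (exp (½ * x)))
      (≤-reflexive (trans (sym (exp-+ _ _)) (exp-cong (half+half x))))

    exp-pos : ∀ x → 0# < exp x
    exp-pos x = [ ⊥-elim ∘ exp-nonneg x , id ]′
      (#⇒<⊎> (inverse-#0 (trans (*-comm (exp (- x)) (exp x)) (exp-+-neg x))))

    exp-sub : ∀ x y → exp y ≈ exp x * exp (y - x)
    exp-sub x y = trans (exp-cong (solve 2 (λ x y → y := x :+ (y :- x)) refl x y)) (exp-+ x (y - x))

    exp-mono-≤ : ∀ {x y} → x ≤ y → exp x ≤ exp y
    exp-mono-≤ {x} {y} x≤y = ≤-trans (≤-reflexive (sym (*-identityʳ _)))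
      (≤-trans (*-monoˡ-≤ (exp x) (exp-nonneg x)
        (≤-trans (≤-diff (y - x) (0≤y-x x≤y) refl) (1+x≤exp[x] (y - x))))
      (≤-reflexive (sym (exp-sub x y))))

    exp-mono-< : ∀ {x y} → x < y → exp x < exp y
    exp-mono-< {x} {y} x<y = <-respˡ-≈ (*-identityʳ _)
      (<-≤-trans (*-monoˡ-< (exp x) (exp-pos x)
        (<-≤-trans (<-diff (y - x) (0<y-x x<y) refl) (1+x≤exp[x] (y - x))))
      (≤-reflexive (sym (exp-sub x y))))

    exp-cancel-≤ : ∀ {x y} → exp x ≤ exp y → x ≤ y
    exp-cancel-≤ ex≤ey y<x = ex≤ey (exp-mono-< y<x)

    exp-injective : ∀ {x y} → exp x ≈ exp y → x ≈ y
    exp-injective ex≈ey = ≤-antisym (exp-cancel-≤ (≤-reflexive ex≈ey))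
      (exp-cancel-≤ (≤-reflexive (sym ex≈ey)))

    exp[-x]≤1 : ∀ {x} → 0# ≤ x → exp (- x) ≤ 1#
    exp[-x]≤1 0≤x = ≤-trans (exp-mono-≤ (≤-trans (neg-mono-≤ 0≤x) (≤-reflexive -0#≈0#)))
      (≤-reflexive exp-0)

    exp[-x]<1 : ∀ {x} → 0# < x → exp (- x) < 1#
    exp[-x]<1 0<x = <-≤-trans (exp-mono-< (<-≤-trans (neg-mono-< 0<x) (≤-reflexive -0#≈0#)))
      (≤-reflexive exp-0)

    exp[-x]-vanishes : ∀ ε → 0# < ε → ∃[ T ] ∀ x → T ≤ x → exp (- x) < ε
    -- At T = - log (ε/2) the value is exactly ε/2, which leaves room for a strict inequality.
    exp[-x]-vanishes ε 0<ε = - log (½ * ε) (half-pos 0<ε) , λ x T≤x → ≤-<-trans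
      (≤-trans (exp-mono-≤ (≤-trans (neg-mono-≤ T≤x) (≤-reflexive (-‿involutive _))))
        (≤-reflexive (exp-log _ (half-pos 0<ε))))
      (<-diff (½ * ε) (half-pos 0<ε) (sym (half+half ε)))

    exp-fromℕ : ∀ x n → exp (fromℕ n * x) ≈ exp x ^ n
    exp-fromℕ x zero    = trans (exp-cong (zeroˡ x)) exp-0
    exp-fromℕ x (suc n) = trans
      (exp-cong (solve 2 (λ n x → (con (+ 1) :+ n) :* x := x :+ n :* x) refl (fromℕ n) x))
      (trans (exp-+ x _) (*-congˡ (exp-fromℕ x n)))

    ^-nonneg : ∀ {x} n → 0# ≤ x → 0# ≤ x ^ n
    ^-nonneg zero    0≤x = 0≤1
    ^-nonneg (suc n) 0≤x = *-nonneg 0≤x (^-nonneg n 0≤x)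

    ^-pos : ∀ {x} n → 0# < x → 0# < x ^ n
    ^-pos zero    0<x = 0<1
    ^-pos (suc n) 0<x = *-pos 0<x (^-pos n 0<x)

    ^-mono-≤ : ∀ {x y} n → 0# ≤ x → x ≤ y → x ^ n ≤ y ^ n
    ^-mono-≤ zero    0≤x x≤y = ≤-refl
    ^-mono-≤ (suc n) 0≤x x≤y = *-mono-≤ 0≤x (^-nonneg n (≤-trans 0≤x x≤y)) x≤y (^-mono-≤ n 0≤x x≤y)

    ^-≤1 : ∀ {x} n → 0# ≤ x → x ≤ 1# → x ^ n ≤ 1#
    ^-≤1 zero    0≤x x≤1 = ≤-refl
    ^-≤1 (suc n) 0≤x x≤1 = ≤-trans (*-mono-≤ 0≤x 0≤1 x≤1 (^-≤1 n 0≤x x≤1)) (≤-reflexive (*-identityˡ 1#))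

    x≤K*exp[κ*x] : ∀ {κ} (0<κ : 0# < κ) x → x ≤ inverse 0<κ * exp (κ * x)
    x≤K*exp[κ*x] {κ} 0<κ x = ≤-trans
      (≤-reflexive (sym (trans (sym (*-assoc _ _ _)) (trans (*-congʳ (inverse-* 0<κ)) (*-identityˡ x)))))
      (*-monoˡ-≤ _ (<⇒≤ (inverse-pos 0<κ)) (x≤exp[x] (κ * x)))

    exp-halves : ∀ κ x → exp (½ * κ * x) * exp (½ * κ * x) ≈ exp (κ * x)
    exp-halves κ x = trans (sym (exp-+ _ _))
      (exp-cong (trans (sym (distribʳ x _ _)) (*-congʳ (half+half κ))))

    1≤exp[κ*x] : ∀ {κ x} → 0# ≤ κ → 0# ≤ x → 1# ≤ exp (κ * x)
    1≤exp[κ*x] 0≤κ 0≤x = ≤-trans (≤-diff _ (*-nonneg 0≤κ 0≤x) refl) (1+x≤exp[x] _)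

    -- One factor `x` is paid for with half of the exponent, x ≤ (2/κ) exp(κx/2), and the other
    -- factors, by induction, with the other half.
    x^n≤K*exp[κ*x] : ∀ n κ → 0# < κ → ∃[ K ] (0# ≤ K × (∀ x → 0# ≤ x → x ^ n ≤ K * exp (κ * x)))
    x^n≤K*exp[κ*x] zero κ 0<κ = 1# , 0≤1 , λ x 0≤x →
      ≤-trans (1≤exp[κ*x] (<⇒≤ 0<κ) 0≤x) (≤-reflexive (sym (*-identityˡ _)))
    x^n≤K*exp[κ*x] (suc n) κ 0<κ =
      let w = inverse (half-pos 0<κ)
          0≤w = <⇒≤ (inverse-pos (half-pos 0<κ))
          K , 0≤K , h = x^n≤K*exp[κ*x] n (½ * κ) (half-pos 0<κ)
      in w * K , *-nonneg 0≤w 0≤K , λ x 0≤x → ≤-trans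
        (*-mono-≤ 0≤x (*-nonneg 0≤K (exp-nonneg _)) (x≤K*exp[κ*x] (half-pos 0<κ) x) (h x 0≤x))
        (≤-reflexive (trans (solve 3 (λ w e K → w :* e :* (K :* e) := w :* K :* (e :* e)) refl w _ K)
          (*-congˡ (exp-halves κ x))))

    geometric : ∀ {ρ} n → ∑ n (ρ ^_) * (1# - ρ) ≈ 1# - ρ ^ n
    geometric {ρ} zero    = solve 1 (λ r → con (+ 0) :* (con (+ 1) :- r) := con (+ 1) :- con (+ 1)) refl ρ
    geometric {ρ} (suc n) = trans (distribʳ _ _ _) (trans (+-congʳ (geometric n))
      (solve 2 (λ r p → con (+ 1) :- p :+ p :* (con (+ 1) :- r) := con (+ 1) :- r :* p) refl ρ (ρ ^ n)))

    *≤⇒≤inverse* : ∀ {x y z} (0<x : 0# < x) → y * x ≤ z → y ≤ inverse 0<x * z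
    *≤⇒≤inverse* {x} {y} 0<x yx≤z = ≤-trans
      (≤-reflexive (sym (trans (solve 3 (λ w x y → w :* (y :* x) := w :* x :* y) refl _ x y)
        (trans (*-congʳ (inverse-* 0<x)) (*-identityˡ y)))))
      (*-monoˡ-≤ _ (<⇒≤ (inverse-pos 0<x)) yx≤z)

    geometric-≤ : ∀ {ρ} (ρ<1 : ρ < 1#) → 0# ≤ ρ → ∀ n → ∑ n (ρ ^_) ≤ inverse (0<y-x ρ<1)
    geometric-≤ {ρ} ρ<1 0≤ρ n = ≤-trans
      (*≤⇒≤inverse* (0<y-x ρ<1) (≤-trans (≤-reflexive (geometric n))
        (≤-diff (ρ ^ n) (^-nonneg n 0≤ρ)
          (solve 1 (λ p → con (+ 1) := con (+ 1) :- p :+ p) refl (ρ ^ n)))))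
      (≤-reflexive (*-identityʳ _))

    exp[-κ]^n-vanishes : ∀ {κ} → 0# < κ → Vanishing (exp (- κ) ^_)
    exp[-κ]^n-vanishes {κ} 0<κ ε 0<ε =
      let T , h       = exp[-x]-vanishes ε 0<ε
          N , T/κ<N   = archimedean (T * inverse 0<κ)
      in N , λ n N≤n → ≤-<-trans
        (≤-reflexive (trans (sym (exp-fromℕ (- κ) n)) (exp-cong (sym (-‿distribʳ-* _ _)))))
        (h (fromℕ n * κ) (≤-trans
          (≤-reflexive (sym (trans (*-assoc _ _ _) (trans (*-congˡ (inverse-* 0<κ)) (*-identityʳ T)))))
          (*-monoʳ-≤ κ (<⇒≤ 0<κ) (≤-trans (<⇒≤ T/κ<N) (fromℕ-mono N≤n)))))

-- Rough numbers: integers without small divisors.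

module RoughNumbers where

  -- Throughout, the index `n` stands for the integer 2 + n, so that every natural number indexes a
  -- candidate prime.
  rough? : ∀ n x → Dec ((2 ℕ.+ n) Rough x)
  rough? zero    x = yes 2-rough
  rough? (suc n) x with (2 ℕ.+ n) ∣? x
  ... | yes j∣x = no λ r → r (hasNonTrivialDivisor ℕₚ.≤-refl j∣x)
  ... | no  j∤x with rough? n x
  ...   | yes r = yes (∤⇒rough-suc j∤x r)
  ...   | no ¬r = no λ { r → ¬r λ { (hasNonTrivialDivisor d<j d∣x) →
                         r (hasNonTrivialDivisor (ℕₚ.m≤n⇒m≤1+n d<j) d∣x) } }

  rough-pred : ∀ {m x} → suc m Rough x → m Rough x
  rough-pred r (hasNonTrivialDivisor d<m d∣x) = r (hasNonTrivialDivisor (ℕₚ.m≤n⇒m≤1+n d<m) d∣x)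

  rough-suc⇒∤ : ∀ {n x} → (3 ℕ.+ n) Rough x → (2 ℕ.+ n) ∤ x
  rough-suc⇒∤ r j∣x = r (hasNonTrivialDivisor ℕₚ.≤-refl j∣x)

  -- If j = 2 + n divided the j-rough number `x`, every divisor of j would divide `x` too, which
  -- forces j to be prime. So a composite j sieves out nothing.
  ¬prime⇒rough-suc : ∀ {n x} → ¬ Prime (2 ℕ.+ n) → (2 ℕ.+ n) Rough x → (3 ℕ.+ n) Rough x
  ¬prime⇒rough-suc ¬p r = ∤⇒rough-suc (λ j∣x → ¬p (rough∧∣⇒prime r j∣x)) r

  rough-* : ∀ {p x} → Prime p → p Rough x → p Rough (p ℕ.* x)
  rough-* {p} {x} pr r (hasNonTrivialDivisor {divisor = d} d<p d∣px) =
    r (hasNonTrivialDivisor d<p (coprime-divisor d⊥p d∣px))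
    where
    d⊥p : Coprime d p
    d⊥p {e} (e∣d , e∣p) with prime⇒irreducible pr e∣p
    ... | inj₁ e≡1    = e≡1
    ... | inj₂ ≡.refl = ⊥-elim (ℕₚ.<⇒≱ d<p (∣ℕ.∣⇒≤ {{ℕ.nonTrivial⇒nonZero d}} e∣d))

  prime-^-coprime : ∀ {p x} a → Prime p → p ∤ x → Coprime (p ℕ.^ a) x
  prime-^-coprime         zero    pr p∤x (d∣1 , _) = ∣ℕ.∣1⇒≡1 d∣1
  prime-^-coprime {p} {x} (suc a) pr p∤x {d} (d∣ppᵃ , d∣x) =
    prime-^-coprime a pr p∤x (coprime-divisor d⊥p d∣ppᵃ , d∣x)
    where
    d⊥p : Coprime d p
    d⊥p (e∣d , e∣p) with prime⇒irreducible pr e∣p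
    ... | inj₁ e≡1    = e≡1
    ... | inj₂ ≡.refl = ⊥-elim (p∤x (∣-trans e∣d d∣x))

  ^-distribʳ-* : ∀ k m n → (m ℕ.* n) ℕ.^ k ≡ m ℕ.^ k ℕ.* n ℕ.^ k
  ^-distribʳ-* zero    m n = ≡.refl
  ^-distribʳ-* (suc k) m n = ≡.trans (≡.cong (m ℕ.* n ℕ.*_) (^-distribʳ-* k m n))
    (ℕₚ.[m*n]*[o*p]≡[m*o]*[n*p] m n (m ℕ.^ k) (n ℕ.^ k))

  n<2^n : ∀ n → n ℕ.< 2 ℕ.^ n
  n<2^n zero    = s≤s z≤n
  n<2^n (suc n) = ℕₚ.≤-trans (ℕₚ.+-mono-≤ (ℕₚ.m^n>0 2 n) (n<2^n n))
    (ℕₚ.≤-reflexive (≡.cong (2 ℕ.^ n ℕ.+_) (≡.sym (ℕₚ.+-identityʳ _))))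

  n<[2+j]^n : ∀ j n → n ℕ.< (2 ℕ.+ j) ℕ.^ n
  n<[2+j]^n j n = ℕₚ.<-≤-trans (n<2^n n) (ℕₚ.^-monoˡ-≤ n (ℕₚ.m≤m+n 2 j))

  abstract
    prime₂? : ∀ n → Dec (Prime (2 ℕ.+ n))
    prime₂? n = prime? (2 ℕ.+ n)

open RoughNumbers

-- Dilation operators, the sieve, and exact finite Euler products.

module Sieve {c ℓ₁ ℓ₂} (ℝ : RealNumbers c ℓ₁ ℓ₂) where
  open RealNumbers ℝ hiding (zero)
  open FieldProperties ℝ
  open Sums ℝ
  open Solver using (solve; _:=_; _:+_; _:*_; _:-_; :-_; con)

  𝟙 : ∀ {a} {A : Set a} → Dec A → Carrier
  𝟙 (yes _) = 1#
  𝟙 (no _)  = 0#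

  -- At n = 0 this is 1 everywhere; once n ≥ N only the integer 1 survives among 1, ..., N. Sieving
  -- from one extreme to the other yields the Euler products below.
  χ : ℕ → ℕ → Carrier
  χ n x = 𝟙 (rough? n x)

  -- Vanishing also at 0 makes the operators below need no positivity hypotheses.
  Supported : ℕ → (ℕ → Carrier) → Set _
  Supported N φ = ∀ m → m ≡ 0 ⊎ N ℕ.< m → φ m ≈ 0#

  ∑₁ : ℕ → (ℕ → Carrier) → Carrier
  ∑₁ N f = ∑ N (λ n → f (suc n))

  abstract
    𝟙-cong : ∀ {a b} {A : Set a} {B : Set b} (A? : Dec A) (B? : Dec B) →
             (A → B) → (B → A) → 𝟙 A? ≈ 𝟙 B?
    𝟙-cong (yes a) (yes b) f g = refl
    𝟙-cong (yes a) (no ¬b) f g = ⊥-elim (¬b (f a))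
    𝟙-cong (no ¬a) (yes b) f g = ⊥-elim (¬a (g b))
    𝟙-cong (no ¬a) (no ¬b) f g = refl

    𝟙-yes : ∀ {a} {A : Set a} (A? : Dec A) → A → 𝟙 A? ≈ 1#
    𝟙-yes (yes _) a = refl
    𝟙-yes (no ¬a) a = ⊥-elim (¬a a)

    𝟙-no : ∀ {a} {A : Set a} (A? : Dec A) → ¬ A → 𝟙 A? ≈ 0#
    𝟙-no (yes a) ¬a = ⊥-elim (¬a a)
    𝟙-no (no _)  ¬a = refl

    supported-∘* : ∀ {N φ} k → Supported N φ → Supported N (λ m → φ (suc k ℕ.* m))
    supported-∘* k φ-supp m (inj₁ ≡.refl) = φ-supp _ (inj₁ (ℕₚ.*-zeroʳ k))
    supported-∘* k φ-supp m (inj₂ N<m)    = φ-supp _ (inj₂ (ℕₚ.<-≤-trans N<m (ℕₚ.m≤m+n m _)))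

    supported-∘^* : ∀ {N φ} n a → Supported N φ → Supported N (λ m → φ (suc n ℕ.^ a ℕ.* m))
    supported-∘^* {φ = φ} n a φ-supp m p with suc n ℕ.^ a | ℕₚ.m^n>0 (suc n) a
    ... | suc q | _ = supported-∘* {φ = φ} q φ-supp m p

    -- In a block of j + 1 consecutive integers that starts right after a multiple of j + 1, only
    -- the last one is a multiple. Cutting an interval into such blocks gives the sum over
    -- multiples.
    last-in-block : ∀ j M (G : ℕ → Carrier) →
      ∑ (suc j) (λ a → 𝟙 (suc j ∣? suc (M ℕ.* suc j ℕ.+ a)) * G (suc (M ℕ.* suc j ℕ.+ a)))
        ≈ G (suc j ℕ.* suc M)
    last-in-block j M G = trans
      (+-cong
        (trans (∑-cong< j λ a a<j → trans (*-congʳ (𝟙-no (suc j ∣? _) (∤ a a<j))) (zeroˡ _))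
          (∑-zero j λ _ → refl))
        (trans (*-congʳ (𝟙-yes (suc j ∣? _) j∣)) (*-identityˡ _)))
      (trans (+-identityˡ _) (reflexive (≡.cong G eq)))
      where
      eq : suc (M ℕ.* suc j ℕ.+ j) ≡ suc j ℕ.* suc M
      eq = ≡.trans (≡.sym (ℕₚ.+-suc (M ℕ.* suc j) j))
             (≡.trans (ℕₚ.+-comm (M ℕ.* suc j) (suc j)) (ℕₚ.*-comm (suc M) (suc j)))
      j∣ : suc j ∣ suc (M ℕ.* suc j ℕ.+ j)
      j∣ = ≡.subst (suc j ∣_) (≡.sym eq) (∣ℕ.m∣m*n (suc M))
      ∤ : ∀ a → a ℕ.< j → suc j ∤ suc (M ℕ.* suc j ℕ.+ a)
      ∤ a a<j d = ℕₚ.<⇒≱ a<j (ℕₚ.≤-pred (∣ℕ.∣⇒≤ (∣ℕ.∣m+n∣m⇒∣n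
        (≡.subst (suc j ∣_) (≡.sym (ℕₚ.+-suc (M ℕ.* suc j) a)) d) (∣ℕ.n∣m*n M))))

    ∑-multiples : ∀ j M (G : ℕ → Carrier) →
      ∑₁ (M ℕ.* suc j) (λ n → 𝟙 (suc j ∣? n) * G n) ≈ ∑₁ M (λ n → G (suc j ℕ.* n))
    ∑-multiples j zero    G = refl
    ∑-multiples j (suc M) G = trans
      (reflexive (≡.cong (λ p → ∑₁ p (λ n → 𝟙 (suc j ∣? n) * G n)) (ℕₚ.+-comm (suc j) (M ℕ.* suc j))))
      (trans (∑-split (M ℕ.* suc j) (suc j) _)
        (+-cong (∑-multiples j M G) (last-in-block j M G)))

    ∑-multiples-supported : ∀ j N {G} → Supported N G →
      ∑₁ N (λ n → 𝟙 (suc j ∣? n) * G n) ≈ ∑₁ N (λ n → G (suc j ℕ.* n))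
    ∑-multiples-supported j N {G} G-supp = trans
      (sym (∑-extend {f = λ n → 𝟙 (suc j ∣? suc n) * G (suc n)} (ℕₚ.m≤m*n N (suc j)) λ a N≤a →
        trans (*-congˡ (G-supp (suc a) (inj₂ (s≤s N≤a)))) (zeroʳ _)))
      (∑-multiples j N G)

    χ-¬prime : ∀ {n} → ¬ Prime (2 ℕ.+ n) → ∀ x → χ n x ≈ χ (suc n) x
    χ-¬prime {n} ¬p x = 𝟙-cong (rough? n x) (rough? (suc n) x) (¬prime⇒rough-suc ¬p) rough-pred

    χ-prime-* : ∀ {n} → Prime (2 ℕ.+ n) → ∀ x → χ n ((2 ℕ.+ n) ℕ.* x) ≈ χ n x
    χ-prime-* {n} p x = 𝟙-cong (rough? n _) (rough? n x)
      (λ r → rough∧∣⇒rough r (∣ℕ.n∣m*n (2 ℕ.+ n))) (rough-* p)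

    χ-split : ∀ n x → χ n x ≈ χ (suc n) x + 𝟙 ((2 ℕ.+ n) ∣? x) * χ n x
    χ-split n x with (2 ℕ.+ n) ∣? x
    ... | yes _ = sym (trans (+-identityˡ _) (*-identityˡ _))
    ... | no j∤x with rough? n x
    ...   | yes _ = sym (trans (+-congˡ (zeroˡ _)) (+-identityʳ _))
    ...   | no  _ = sym (trans (+-congˡ (zeroˡ _)) (+-identityʳ _))

    -- Legendre's recursion: for a prime p, the multiples of p among the p-rough numbers are exactly
    -- p times the p-rough numbers.
    sieve-step : ∀ {n} → Prime (2 ℕ.+ n) → ∀ N {H} → Supported N H →
      ∑₁ N (λ x → χ n x * H x) ≈
      ∑₁ N (λ x → χ (suc n) x * H x) + ∑₁ N (λ x → χ n x * H ((2 ℕ.+ n) ℕ.* x))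
    sieve-step {n} p N {H} H-supp = trans
      (∑-cong N λ a → trans (*-congʳ (χ-split n (suc a))) (trans (distribʳ _ _ _)
        (+-congˡ (*-assoc _ _ _))))
      (trans (∑-+ N _ _) (+-congˡ (trans
        (∑-multiples-supported (suc n) N {λ x → χ n x * H x}
          (λ m m∉ → trans (*-congˡ (H-supp m m∉)) (zeroʳ _)))
        (∑-cong N λ a → *-congʳ (χ-prime-* p (suc a))))))

    -- Sorts the p-rough numbers by their exact exponent a < A at p; the last sum keeps the
    -- multiples of p^A.
    sieve-steps : ∀ {n} → Prime (2 ℕ.+ n) → ∀ N A {H} → Supported N H →
      ∑₁ N (λ x → χ n x * H x) ≈
      ∑ A (λ a → ∑₁ N (λ x → χ (suc n) x * H ((2 ℕ.+ n) ℕ.^ a ℕ.* x)))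
        + ∑₁ N (λ x → χ n x * H ((2 ℕ.+ n) ℕ.^ A ℕ.* x))
    sieve-steps {n} p N zero    {H} H-supp = sym (trans (+-identityˡ _)
      (∑-cong N λ a → *-congˡ (reflexive (≡.cong H (ℕₚ.*-identityˡ (suc a))))))
    sieve-steps {n} p N (suc A) {H} H-supp = trans (sieve-steps p N A H-supp)
      (trans (+-congˡ (trans
        (sieve-step p N {λ x → H ((2 ℕ.+ n) ℕ.^ A ℕ.* x)} (supported-∘^* {φ = H} (suc n) A H-supp))
        (+-congˡ (∑-cong N λ a → *-congˡ (reflexive (≡.cong H (eq (suc a))))))))
        (sym (+-assoc _ _ _)))
      where
      eq : ∀ x → (2 ℕ.+ n) ℕ.^ A ℕ.* ((2 ℕ.+ n) ℕ.* x) ≡ (2 ℕ.+ n) ℕ.^ suc A ℕ.* x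
      eq x = ≡.trans (≡.sym (ℕₚ.*-assoc ((2 ℕ.+ n) ℕ.^ A) (2 ℕ.+ n) x))
        (≡.cong (ℕ._* x) (ℕₚ.*-comm ((2 ℕ.+ n) ℕ.^ A) (2 ℕ.+ n)))

    -- Since (2 + j)^a > a > N, cutting the exponents off at any L ≥ N loses nothing.
    beyond : ∀ {N φ} → Supported N φ → ∀ j {a} m → N ℕ.< a → φ ((2 ℕ.+ j) ℕ.^ a ℕ.* m) ≈ 0#
    beyond {φ = φ} φ-supp j {a} zero N<a = φ-supp _ (inj₁ (ℕₚ.*-zeroʳ ((2 ℕ.+ j) ℕ.^ a)))
    beyond {φ = φ} φ-supp j {a} (suc m) N<a = φ-supp _ (inj₂ (ℕₚ.<-≤-trans
      (ℕₚ.<-trans N<a (n<[2+j]^n j a)) (ℕₚ.m≤m*n _ (suc m))))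

    sieve-end : ∀ {N n} → N ℕ.≤ n → ∀ {H} → Supported N H → ∑₁ N (λ x → χ n x * H x) ≈ H 1
    sieve-end {zero}      N≤n H-supp = sym (H-supp 1 (inj₂ (s≤s z≤n)))
    sieve-end {suc N} {n} N≤n {H} H-supp = trans (∑-head N _)
      (trans (+-cong (trans (*-congʳ (𝟙-yes (rough? n 1) (rough-1 _))) (*-identityˡ _))
        (trans (∑-cong< N λ a a<N → trans (*-congʳ (𝟙-no (rough? n _) λ r → r
          (hasNonTrivialDivisor (s≤s (s≤s (ℕₚ.≤-trans (ℕₚ.<-trans a<N ℕₚ.≤-refl) N≤n))) ∣-refl)))
          (zeroˡ _)) (∑-zero N λ _ → refl)))
        (+-identityʳ _))

  op : ℕ → (ℕ → ℕ → Carrier) → ℕ → (ℕ → Carrier) → ℕ → Carrier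
  op L u n φ m = ∑ (suc L) (λ a → u n a * φ ((2 ℕ.+ n) ℕ.^ a ℕ.* m))

  euler : ℕ → (ℕ → ℕ → Carrier) → ℕ → (ℕ → Carrier) → ℕ → Carrier
  euler L u zero    φ = φ
  euler L u (suc n) φ = op L u n (euler L u n φ)

  shr : ℕ → (ℕ → Carrier) → ℕ → Carrier
  shr zero    u a       = u a
  shr (suc k) u zero    = 0#
  shr (suc k) u (suc a) = shr k u a

  -- The coefficients of (1 - ω x^k) u(x).
  Mul : ℕ → Carrier → (ℕ → Carrier) → ℕ → Carrier
  Mul k ω u a = u a - ω * shr k u a

  abstract
    op-cong : ∀ L u n {φ ψ} → (∀ m → φ m ≈ ψ m) → ∀ m → op L u n φ m ≈ op L u n ψ m
    op-cong L u n φ≈ψ m = ∑-cong (suc L) λ a → *-congˡ (φ≈ψ _)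

    op-+ : ∀ L u n φ ψ m → op L u n (λ x → φ x + ψ x) m ≈ op L u n φ m + op L u n ψ m
    op-+ L u n φ ψ m = trans (∑-cong (suc L) λ a → distribˡ _ _ _) (∑-+ (suc L) _ _)

    op-*ˡ : ∀ L u n k φ m → op L u n (λ x → k * φ x) m ≈ k * op L u n φ m
    op-*ˡ L u n k φ m = trans
      (∑-cong (suc L) λ a → solve 3 (λ u k f → u :* (k :* f) := k :* (u :* f)) refl _ k _)
      (∑-*ˡ (suc L) k _)

    op-∘* : ∀ L u n k φ m → op L u n (λ x → φ (k ℕ.* x)) m ≈ op L u n φ (k ℕ.* m)
    op-∘* L u n k φ m = ∑-cong (suc L) λ a → *-congˡ (reflexive (≡.cong φ (eq ((2 ℕ.+ n) ℕ.^ a))))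
      where
      eq : ∀ q → k ℕ.* (q ℕ.* m) ≡ q ℕ.* (k ℕ.* m)
      eq q = ≡.trans (≡.sym (ℕₚ.*-assoc k q m))
        (≡.trans (≡.cong (ℕ._* m) (ℕₚ.*-comm k q)) (ℕₚ.*-assoc q k m))

    op-supported : ∀ L u n {N φ} → Supported N φ → Supported N (op L u n φ)
    op-supported L u n {φ = φ} φ-supp m m∉ = trans
      (∑-cong (suc L) λ a → trans (*-congˡ (supported-∘^* {φ = φ} (suc n) a φ-supp m m∉)) (zeroʳ _))
      (∑-zero (suc L) λ _ → refl)

    euler-cong : ∀ L u n {φ ψ} → (∀ m → φ m ≈ ψ m) → ∀ m → euler L u n φ m ≈ euler L u n ψ m
    euler-cong L u zero    φ≈ψ = φ≈ψ
    euler-cong L u (suc n) {φ} {ψ} φ≈ψ = op-cong L u n {euler L u n φ} {euler L u n ψ} (euler-cong L u n φ≈ψ)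

    euler-+ : ∀ L u n φ ψ m → euler L u n (λ x → φ x + ψ x) m ≈ euler L u n φ m + euler L u n ψ m
    euler-+ L u zero    φ ψ m = refl
    euler-+ L u (suc n) φ ψ m = trans (op-cong L u n (euler-+ L u n φ ψ) m)
      (op-+ L u n (euler L u n φ) (euler L u n ψ) m)

    euler-*ˡ : ∀ L u n k φ m → euler L u n (λ x → k * φ x) m ≈ k * euler L u n φ m
    euler-*ˡ L u zero    k φ m = refl
    euler-*ˡ L u (suc n) k φ m = trans (op-cong L u n (euler-*ˡ L u n k φ) m) (op-*ˡ L u n k (euler L u n φ) m)

    euler-sub : ∀ L u n φ ψ m → euler L u n (λ x → φ x - ψ x) m ≈ euler L u n φ m - euler L u n ψ m
    euler-sub L u n φ ψ m = trans
      (euler-cong L u n (λ x → +-congˡ (sym (neg (ψ x)))) m)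
      (trans (euler-+ L u n φ (λ x → - 1# * ψ x) m)
        (+-congˡ (trans (euler-*ˡ L u n (- 1#) ψ m) (neg _))))
      where
      neg : ∀ x → - 1# * x ≈ - x
      neg = solve 1 (λ x → :- con (+ 1) :* x := :- x) refl

    euler-∘* : ∀ L u n k φ m → euler L u n (λ x → φ (k ℕ.* x)) m ≈ euler L u n φ (k ℕ.* m)
    euler-∘* L u zero    k φ m = refl
    euler-∘* L u (suc n) k φ m = trans (op-cong L u n (euler-∘* L u n k φ) m)
      (op-∘* L u n k (euler L u n φ) m)

    euler-supported : ∀ L u n {N φ} → Supported N φ → Supported N (euler L u n φ)
    euler-supported L u zero    φ-supp = φ-supp
    euler-supported L u (suc n) φ-supp = op-supported L u n (euler-supported L u n φ-supp)

    ∑-shr : ∀ k L u (ψ : ℕ → Carrier) → (∀ b → L ℕ.< b → ψ b ≈ 0#) →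
            ∑ (suc L) (λ a → shr k u a * ψ a) ≈ ∑ (suc L) (λ a → u a * ψ (k ℕ.+ a))
    ∑-shr zero    L u ψ ψ≈0 = refl
    ∑-shr (suc k) L u ψ ψ≈0 = trans (∑-head L _) (trans
      (trans (+-congʳ (zeroˡ _)) (trans (+-identityˡ _)
        (sym (∑-extend {f = λ a → shr k u a * ψ (suc a)} (ℕₚ.n≤1+n L)
          λ a L≤a → trans (*-congˡ (ψ≈0 (suc a) (s≤s L≤a))) (zeroʳ _)))))
      (∑-shr k L u (ψ ∘ suc) λ b L<b → ψ≈0 (suc b) (ℕₚ.m≤n⇒m≤1+n L<b)))

    -- Multiplying the series by 1 - ω x^k multiplies its operator by 1 - ω E_j^k. The shift by k is
    -- compatible with the truncation at L because all terms with exponent above L ≥ N vanish.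
    op-Mul : ∀ {N L} → N ℕ.≤ L → ∀ u k (ω : ℕ → Carrier) n {φ} → Supported N φ → ∀ m →
      op L (λ n → Mul k (ω n) (u n)) n φ m ≈
      op L u n φ m - ω n * op L u n φ ((2 ℕ.+ n) ℕ.^ k ℕ.* m)
    op-Mul {N} {L} N≤L u k ω n {φ} φ-supp m = trans
      (∑-cong (suc L) λ a → solve 4 (λ u w s f → (u :- w :* s) :* f := u :* f :- w :* (s :* f))
        refl _ (ω n) _ _)
      (trans (∑-sub (suc L) _ _) (+-congˡ (-‿cong (trans (∑-*ˡ (suc L) (ω n) _) (*-congˡ (trans
        (∑-shr k L (u n) (λ a → φ (j ℕ.^ a ℕ.* m)) (λ b L<b → beyond φ-supp n m (ℕₚ.≤-<-trans N≤L L<b)))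
        (∑-cong (suc L) λ a → *-congˡ (reflexive (≡.cong φ (eq a))))))))))
      where
      j : ℕ
      j = 2 ℕ.+ n
      eq : ∀ a → (2 ℕ.+ n) ℕ.^ (k ℕ.+ a) ℕ.* m ≡ (2 ℕ.+ n) ℕ.^ a ℕ.* ((2 ℕ.+ n) ℕ.^ k ℕ.* m)
      eq a = ≡.trans (≡.cong (ℕ._* m) (≡.trans (ℕₚ.^-distribˡ-+-* (2 ℕ.+ n) k a)
        (ℕₚ.*-comm ((2 ℕ.+ n) ℕ.^ k) ((2 ℕ.+ n) ℕ.^ a)))) (ℕₚ.*-assoc ((2 ℕ.+ n) ℕ.^ a) _ m)

  𝟙prime : ℕ → Carrier
  𝟙prime n = 𝟙 (prime₂? n)

  -- The operator of ζ((k + 1)s) without its Euler factors at the primes below 2 + n. Storing the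
  -- exponent as k + 1 keeps it positive.
  ζ : ℕ → ℕ → ℕ → (ℕ → Carrier) → ℕ → Carrier
  ζ N k n φ m = ∑₁ N (λ x → χ n x * φ (x ℕ.^ suc k ℕ.* m))

  abstract
    ∘^*-supported : ∀ {N φ} → Supported N φ → ∀ k m → Supported N (λ x → φ (x ℕ.^ suc k ℕ.* m))
    ∘^*-supported φ-supp k m zero    x∉ = φ-supp _ (inj₁ ≡.refl)
    ∘^*-supported φ-supp k zero    (suc x) x∉ = φ-supp _ (inj₁ (ℕₚ.*-zeroʳ (suc x ℕ.^ suc k)))
    ∘^*-supported φ-supp k (suc m) (suc x) (inj₂ N<x) = φ-supp _ (inj₂ (ℕₚ.<-≤-trans N<x
      (ℕₚ.≤-trans (ℕₚ.m≤m*n (suc x) (suc x ℕ.^ k) {{ℕₚ.m^n≢0 (suc x) k}}) (ℕₚ.m≤m*n _ (suc m)))))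

    ζ-supported : ∀ {N φ} k n → Supported N φ → Supported N (ζ N k n φ)
    ζ-supported {N} {φ} k n φ-supp m m∉ = trans
      (∑-cong N λ a → trans (*-congˡ (supported-∘^* {φ = φ} a (suc k) φ-supp m m∉)) (zeroʳ _))
      (∑-zero N λ _ → refl)

    -- At a prime j the factor 1 - E_j^(k+1) is the inverse of the Euler factor at j, by Legendre's
    -- recursion. At a composite j the coefficient `𝟙prime n` is 0 and roughness does not change.
    ζ-step : ∀ {N φ} k n → Supported N φ → ∀ m →
      ζ N k n φ m - 𝟙prime n * ζ N k n φ ((2 ℕ.+ n) ℕ.^ suc k ℕ.* m) ≈ ζ N k (suc n) φ m
    ζ-step {N} {φ} k n φ-supp m with prime₂? n
    ... | no ¬p = trans (solve 2 (λ x y → x :- con (+ 0) :* y := x) refl _ _)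
      (∑-cong N λ a → *-congʳ (χ-¬prime ¬p (suc a)))
    ... | yes p = trans (+-congʳ (trans
        (sieve-step p N {λ x → φ (x ℕ.^ suc k ℕ.* m)} (∘^*-supported φ-supp k m))
        (+-congˡ (∑-cong N λ a → *-congˡ (reflexive (≡.cong φ (eq (suc a))))))))
      (solve 2 (λ x y → x :+ y :- con (+ 1) :* y := x) refl _ _)
      where
      eq : ∀ x → ((2 ℕ.+ n) ℕ.* x) ℕ.^ suc k ℕ.* m ≡ x ℕ.^ suc k ℕ.* ((2 ℕ.+ n) ℕ.^ suc k ℕ.* m)
      eq x = ≡.trans (≡.cong (ℕ._* m) (≡.trans (^-distribʳ-* (suc k) (2 ℕ.+ n) x)
        (ℕₚ.*-comm ((2 ℕ.+ n) ℕ.^ suc k) (x ℕ.^ suc k)))) (ℕₚ.*-assoc (x ℕ.^ suc k) _ m)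

    ζ-end : ∀ {N φ} k n → N ℕ.≤ n → Supported N φ → ∀ m → ζ N k n φ m ≈ φ m
    ζ-end {N} {φ} k n N≤n φ-supp m = trans (sieve-end N≤n (∘^*-supported φ-supp k m))
      (reflexive (≡.cong φ (≡.trans (≡.cong (ℕ._* m) (ℕₚ.^-zeroˡ (suc k))) (ℕₚ.*-identityˡ m))))

    -- The extra factors on the left strip `ζ` of its Euler factors one index at a time. Each of
    -- them can be moved inward to `ζ` because the local operators are linear and commute with
    -- dilations.
    euler-Mul-ζ : ∀ {N L} → N ℕ.≤ L → ∀ u k {φ} → Supported N φ → ∀ n m →
      euler L (λ n → Mul (suc k) (𝟙prime n) (u n)) n (ζ N k 0 φ) m ≈ euler L u n (ζ N k n φ) m
    euler-Mul-ζ         N≤L u k φ-supp zero    m = refl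
    euler-Mul-ζ {N} {L} N≤L u k {φ} φ-supp (suc n) m = trans
      (op-cong L u′ n (euler-Mul-ζ N≤L u k φ-supp n) m) (trans
      (op-Mul N≤L u (suc k) 𝟙prime n {ψ} (euler-supported L u n (ζ-supported {φ = φ} k n φ-supp)) m) (trans
      (+-congˡ (-‿cong (*-congˡ (sym (op-∘* L u n (j ℕ.^ suc k) ψ m))))) (trans
      (+-congˡ (-‿cong (sym (op-*ˡ L u n (𝟙prime n) (λ x → ψ (j ℕ.^ suc k ℕ.* x)) m)))) (trans
      (sym (op-sub ψ (λ x → 𝟙prime n * ψ (j ℕ.^ suc k ℕ.* x)))) (op-cong L u n step m)))))
      where
      j : ℕ
      j = 2 ℕ.+ n
      u′ : ℕ → ℕ → Carrier
      u′ n = Mul (suc k) (𝟙prime n) (u n)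
      ψ : ℕ → Carrier
      ψ = euler L u n (ζ N k n φ)
      op-sub : ∀ f g → op L u n (λ x → f x - g x) m ≈ op L u n f m - op L u n g m
      op-sub f g = trans
        (∑-cong (suc L) λ a → solve 3 (λ u f g → u :* (f :- g) := u :* f :- u :* g) refl _ _ _)
        (∑-sub (suc L) _ _)
      step : ∀ x → ψ x - 𝟙prime n * ψ (j ℕ.^ suc k ℕ.* x) ≈ euler L u n (ζ N k (suc n) φ) x
      step x = trans
        (+-congˡ (-‿cong (trans (*-congˡ (sym (euler-∘* L u n (j ℕ.^ suc k) _ x)))
          (sym (euler-*ˡ L u n (𝟙prime n) _ x)))))
        (trans (sym (euler-sub L u n _ _ x)) (euler-cong L u n (ζ-step k n φ-supp) x))

    euler-Mul-ζ-end : ∀ {N L n} → N ℕ.≤ L → N ℕ.≤ n → ∀ u k {φ} → Supported N φ → ∀ m →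
      euler L (λ n → Mul (suc k) (𝟙prime n) (u n)) n (ζ N k 0 φ) m ≈ euler L u n φ m
    euler-Mul-ζ-end {L = L} {n} N≤L N≤n u k φ-supp m =
      trans (euler-Mul-ζ N≤L u k φ-supp n m) (euler-cong L u n (ζ-end k n N≤n φ-supp) m)

  δ : ℕ → Carrier
  δ zero    = 1#
  δ (suc _) = 0#

  -- The series 1 at composite j makes the operator there the identity, so the product may run over
  -- all j ≥ 2.
  atPrimes : (ℕ → Carrier) → ℕ → ℕ → Carrier
  atPrimes t n with prime₂? n
  ... | yes _ = t
  ... | no  _ = δ

  module _ (f t : ℕ → Carrier) (f1≈1 : f 1 ≈ 1#)
           (f-^* : ∀ {n} a x → Prime (2 ℕ.+ n) → (3 ℕ.+ n) Rough (suc x) →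
                   f ((2 ℕ.+ n) ℕ.^ a ℕ.* suc x) ≈ t a * f (suc x)) where

    -- Primes are removed in increasing order, so the only products met are p^a times an integer
    -- whose prime factors all exceed p; this is the form in which multiplicativity of `f` is
    -- assumed.
    roughSum : ℕ → ℕ → (ℕ → Carrier) → ℕ → Carrier
    roughSum N n φ m = ∑₁ N (λ x → χ n x * (f x * φ (x ℕ.* m)))

    abstract
      roughSum-supported : ∀ {N φ} → Supported N φ → ∀ m → Supported N (λ x → f x * φ (x ℕ.* m))
      roughSum-supported {φ = φ} φ-supp m x x∉ = trans (*-congˡ (trans
        (reflexive (≡.cong φ (≡.cong (ℕ._* m) (≡.sym (ℕₚ.*-identityʳ x)))))
        (∘^*-supported {φ = φ} φ-supp 0 m x x∉))) (zeroʳ _)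

      f-^*-χ : ∀ n → Prime (2 ℕ.+ n) → ∀ a x y →
        χ (suc n) (suc x) * (f ((2 ℕ.+ n) ℕ.^ a ℕ.* suc x) * y) ≈ t a * (χ (suc n) (suc x) * (f (suc x) * y))
      f-^*-χ n p a x y with rough? (suc n) (suc x)
      ... | yes r = trans (*-congˡ (*-congʳ (f-^* a x p r)))
        (solve 3 (λ t f y → con (+ 1) :* (t :* f :* y) := t :* (con (+ 1) :* (f :* y))) refl _ _ y)
      ... | no _ = solve 4 (λ f t g y → con (+ 0) :* (f :* y) := t :* (con (+ 0) :* (g :* y))) refl _ _ _ y

      -- For a prime, L + 1 sieving steps leave a remainder over multiples of p^(L+1) > N, where `φ`
      -- vanishes; the other terms are the operator of `t` at p.
      roughSum-step : ∀ {N L φ} → N ℕ.≤ L → ∀ n → Supported N φ → ∀ m →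
        roughSum N n φ m ≈ op L (atPrimes t) n (roughSum N (suc n) φ) m
      roughSum-step {N} {L} {φ} N≤L n φ-supp m with prime₂? n
      ... | no ¬p = trans (∑-cong N λ a → trans (*-congʳ (χ-¬prime ¬p (suc a)))
          (*-congˡ (*-congˡ (reflexive (≡.cong (λ q → φ (suc a ℕ.* q)) (≡.sym (ℕₚ.*-identityˡ m)))))))
        (sym (trans (∑-head L _) (trans (+-cong (*-identityˡ _)
          (trans (∑-cong L λ a → zeroˡ _) (∑-zero L λ _ → refl))) (+-identityʳ _))))
      ... | yes p = trans (sieve-steps p N (suc L) (roughSum-supported φ-supp m)) (trans
        (+-congˡ (trans (∑-cong N λ a → trans (*-congˡ
            (trans (*-congˡ (trans (reflexive (≡.cong φ (ℕₚ.*-assoc ((2 ℕ.+ n) ℕ.^ suc L) (suc a) m)))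
              (beyond φ-supp n (suc a ℕ.* m) (s≤s N≤L)))) (zeroʳ _))) (zeroʳ _))
          (∑-zero N λ _ → refl)))
        (trans (+-identityʳ _) (∑-cong (suc L) λ a → trans
          (∑-cong N λ x → trans (f-^*-χ n p a x _)
            (*-congˡ (*-congˡ (*-congˡ (reflexive (≡.cong φ (eq ((2 ℕ.+ n) ℕ.^ a) (suc x))))))))
          (∑-*ˡ N _ _))))
        where
        eq : ∀ q x → q ℕ.* x ℕ.* m ≡ x ℕ.* (q ℕ.* m)
        eq q x = ≡.trans (≡.cong (ℕ._* m) (ℕₚ.*-comm q x)) (ℕₚ.*-assoc x q m)

      roughSum-op : ∀ L u k N n φ m →
        op L u k (roughSum N n φ) m ≈ roughSum N n (op L u k φ) m
      roughSum-op L u k N n φ m = trans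
        (∑-cong (suc L) λ a → sym (∑-*ˡ N _ _))
        (trans (∑-swap (suc L) N _) (∑-cong N λ x → trans
          (∑-cong (suc L) λ a → trans
            (solve 4 (λ u χ f y → u :* (χ :* (f :* y)) := χ :* f :* (u :* y)) refl _ _ _ _)
            (*-congˡ (*-congˡ (reflexive (≡.cong φ (eq (suc x) ((2 ℕ.+ k) ℕ.^ a)))))))
          (trans (∑-*ˡ (suc L) _ _) (*-assoc _ _ _))))
        where
        eq : ∀ x q → x ℕ.* (q ℕ.* m) ≡ q ℕ.* (x ℕ.* m)
        eq x q = ≡.trans (≡.sym (ℕₚ.*-assoc x q m))
          (≡.trans (≡.cong (ℕ._* m) (ℕₚ.*-comm x q)) (ℕₚ.*-assoc q x m))

      roughSum-euler : ∀ {N L φ} → N ℕ.≤ L → ∀ n → Supported N φ → ∀ m →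
        roughSum N 0 φ m ≈ roughSum N n (euler L (atPrimes t) n φ) m
      roughSum-euler N≤L zero    φ-supp m = refl
      roughSum-euler {N} {L} {φ} N≤L (suc n) φ-supp m = trans (roughSum-euler N≤L n φ-supp m) (trans
        (roughSum-step N≤L n (euler-supported L (atPrimes t) n φ-supp) m)
        (roughSum-op L (atPrimes t) n N (suc n) (euler L (atPrimes t) n φ) m))

      -- After all indices up to n ≥ N have been sieved, x = 1 is the only term left, and the
      -- accumulated operators have moved onto `φ`.
      ∑-multiplicative : ∀ {N L n φ} → N ℕ.≤ L → N ℕ.≤ n → Supported N φ →
        ∑₁ N (λ x → f x * φ x) ≈ euler L (atPrimes t) n φ 1
      ∑-multiplicative {N} {L} {n} {φ} N≤L N≤n φ-supp = trans
        (∑-cong N λ a → sym (trans (*-congʳ (𝟙-yes (rough? 0 (suc a)) 2-rough)) (trans (*-identityˡ _)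
          (*-congˡ (reflexive (≡.cong φ (ℕₚ.*-identityʳ (suc a))))))))
        (trans (roughSum-euler N≤L n φ-supp 1)
        (trans (sieve-end N≤n (roughSum-supported {φ = euler L (atPrimes t) n φ}
          (euler-supported L (atPrimes t) n φ-supp) 1))
        (trans (*-congʳ f1≈1) (*-identityˡ _))))

-- Weak compositions, the exponent vectors of factorisations of a prime power.

module Compositions where

  incHead : ∀ {k} → Vec ℕ (suc k) → Vec ℕ (suc k)
  incHead (x ∷ xs) = suc x ∷ xs

  -- Split by whether the first part is 0 or can be lowered by one, so that the lengths satisfy
  -- Pascal's recurrence.
  compositions : ∀ k (s : ℕ) → List (Vec ℕ k)
  compositions zero    zero    = [] ∷ []
  compositions zero    (suc s) = []
  compositions (suc k) zero    = List.map (0 ∷_) (compositions k zero)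
  compositions (suc k) (suc s) =
    List.map (0 ∷_) (compositions k (suc s)) ++ List.map incHead (compositions (suc k) s)

  private
    ∷-injective : ∀ {k} {xs ys : Vec ℕ k} → 0 Vec.∷ xs ≡ 0 ∷ ys → xs ≡ ys
    ∷-injective ≡.refl = ≡.refl

    incHead-injective : ∀ {k} {xs ys : Vec ℕ (suc k)} → incHead xs ≡ incHead ys → xs ≡ ys
    incHead-injective {xs = _ ∷ _} {_ ∷ _} ≡.refl = ≡.refl

  compositions-unique : ∀ k s → Unique (compositions k s)
  compositions-unique zero    zero    = [] ∷ []
  compositions-unique zero    (suc s) = []
  compositions-unique (suc k) zero    = Uniqueₚ.map⁺ ∷-injective (compositions-unique k zero)
  compositions-unique (suc k) (suc s) = Uniqueₚ.++⁺
    (Uniqueₚ.map⁺ ∷-injective (compositions-unique k (suc s)))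
    (Uniqueₚ.map⁺ incHead-injective (compositions-unique (suc k) s))
    λ (v∈l , v∈r) → disjoint (∈ₚ.∈-map⁻ _ v∈l) (∈ₚ.∈-map⁻ _ v∈r)
    where
    disjoint : ∀ {v : Vec ℕ (suc k)} → (∃[ x ] x ∈ compositions k (suc s) × v ≡ 0 ∷ x) →
               (∃[ y ] y ∈ compositions (suc k) s × v ≡ incHead y) → ⊥
    disjoint (_ , _ , ≡.refl) (_ ∷ _ , _ , ())

  ∈-compositions⁺ : ∀ {k s} (v : Vec ℕ k) → Vec.sum v ≡ s → v ∈ compositions k s
  ∈-compositions⁺ {zero}          []           ≡.refl = here ≡.refl
  ∈-compositions⁺ {suc k} {zero}  (zero ∷ v)   eq = ∈ₚ.∈-map⁺ _ (∈-compositions⁺ v eq)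
  ∈-compositions⁺ {suc k} {suc s} (zero ∷ v)   eq =
    ∈ₚ.∈-++⁺ˡ (∈ₚ.∈-map⁺ _ (∈-compositions⁺ v eq))
  ∈-compositions⁺ {suc k} {suc s} (suc x ∷ v)  eq =
    ∈ₚ.∈-++⁺ʳ (List.map (0 ∷_) (compositions k (suc s)))
      (∈ₚ.∈-map⁺ incHead (∈-compositions⁺ (x ∷ v) (ℕₚ.suc-injective eq)))

  ∈-compositions⁻ : ∀ {k} s {v : Vec ℕ k} → v ∈ compositions k s → Vec.sum v ≡ s
  ∈-compositions⁻ {zero}  zero    {[]} _ = ≡.refl
  ∈-compositions⁻ {suc k} zero    v∈ with ∈ₚ.∈-map⁻ _ v∈
  ... | x , x∈ , ≡.refl = ∈-compositions⁻ zero x∈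
  ∈-compositions⁻ {suc k} (suc s) v∈ with ∈ₚ.∈-++⁻ (List.map (0 ∷_) (compositions k (suc s))) v∈
  ... | inj₁ v∈l with ∈ₚ.∈-map⁻ _ v∈l
  ...   | x , x∈ , ≡.refl = ∈-compositions⁻ (suc s) x∈
  ∈-compositions⁻ {suc k} (suc s) v∈ | inj₂ v∈r with ∈ₚ.∈-map⁻ _ v∈r
  ...   | x ∷ xs , x∈ , ≡.refl = ≡.cong suc (∈-compositions⁻ s x∈)

  length-compositions-0 : ∀ k → length (compositions k 0) ≡ 1
  length-compositions-0 zero    = ≡.refl
  length-compositions-0 (suc k) = ≡.trans (Listₚ.length-map _ (compositions k 0)) (length-compositions-0 k)

  length-compositions-suc : ∀ k s → length (compositions (suc k) (suc s)) ≡
    length (compositions k (suc s)) ℕ.+ length (compositions (suc k) s)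
  length-compositions-suc k s = ≡.trans
    (Listₚ.length-++ (List.map (0 ∷_) (compositions k (suc s))))
    (≡.cong₂ ℕ._+_ (Listₚ.length-map _ (compositions k (suc s)))
      (Listₚ.length-map incHead (compositions (suc k) s)))

  length-compositions-1 : ∀ k → length (compositions k 1) ≡ k
  length-compositions-1 zero    = ≡.refl
  length-compositions-1 (suc k) = ≡.trans (length-compositions-suc k 0)
    (≡.trans (≡.cong₂ ℕ._+_ (length-compositions-1 k) (length-compositions-0 (suc k))) (ℕₚ.+-comm k 1))

  length-compositions-2 : ∀ k → 2 ℕ.* length (compositions k 2) ≡ k ℕ.^ 2 ℕ.+ k
  length-compositions-2 zero    = ≡.refl
  length-compositions-2 (suc k) = ≡.trans
    (≡.cong (2 ℕ.*_) (≡.trans (length-compositions-suc k 1)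
      (≡.cong (length (compositions k 2) ℕ.+_) (length-compositions-1 (suc k)))))
    (≡.trans (ℕₚ.*-distribˡ-+ 2 (length (compositions k 2)) (suc k))
      (≡.trans (≡.cong (ℕ._+ 2 ℕ.* suc k) (length-compositions-2 k))
        (solve 1 (λ k → k :* (k :* con 1) :+ k :+ con 2 :* (con 1 :+ k)
          := (con 1 :+ k) :* ((con 1 :+ k) :* con 1) :+ (con 1 :+ k)) ≡.refl k)))
    where open ℕ-Solver

open Compositions

-- Counting classes by a complete invariant.

module Deduplication where

  map-filter : ∀ {a b p q} {A : Set a} {B : Set b} {P : A → Set p} {Q : B → Set q}
    (P? : ∀ x → Dec (P x)) (Q? : ∀ y → Dec (Q y)) (f : A → B) {xs} →
    All (λ x → P x ⇔ Q (f x)) xs →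
    List.map f (filter P? xs) ≡ filter Q? (List.map f xs)
  map-filter P? Q? f []                 = ≡.refl
  map-filter P? Q? f (_∷_ {x} P⇔Q P⇔Qs) with P? x | Q? (f x)
  ... | yes _ | yes _ = ≡.cong (f x ∷_) (map-filter P? Q? f P⇔Qs)
  ... | no _  | no _  = map-filter P? Q? f P⇔Qs
  ... | yes p | no ¬q = ⊥-elim (¬q (Equivalence.to P⇔Q p))
  ... | no ¬p | yes q = ⊥-elim (¬p (Equivalence.from P⇔Q q))

  -- When `f` is a complete invariant of `R` on the elements at hand, classes can be counted as
  -- distinct values of `f`.
  map-deduplicate : ∀ {a b r p} {A : Set a} {B : Set b} {R : Rel A r} {P : A → Set p}
    (R? : Decidable R) (_≟_ : DecidableEquality B) (f : A → B) {xs} →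
    (∀ {x y} → P x → P y → R x y ⇔ (f x ≡ f y)) → All P xs →
    List.map f (deduplicate R? xs) ≡ deduplicate _≟_ (List.map f xs)
  map-deduplicate R? _≟_ f R⇔≡ []                         = ≡.refl
  map-deduplicate R? _≟_ f {x ∷ xs} R⇔≡ (px ∷ pxs) = ≡.cong (f x ∷_) (≡.trans
    (map-filter (¬? ∘ R? x) (¬? ∘ (f x ≟_)) f
      (All.map (λ py → mk⇔ (λ ¬r → ¬r ∘ Equivalence.from (R⇔≡ px py))
                           (λ ¬e → ¬e ∘ Equivalence.to (R⇔≡ px py)))
        (Allₚ.deduplicate⁺ R? pxs)))
    (≡.cong (filter (¬? ∘ (f x ≟_))) (map-deduplicate R? _≟_ f R⇔≡ pxs)))

open Deduplication

-- The values of `𝔱 k` at 1 and 2, and a crude bound in general.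

module GaussianDivisors where

  norm : ℤ[i] → ℕ
  norm (a + b i) = ℤ.∣ a ℤ.* a ℤ.+ b ℤ.* b ∣

  norm-* : ∀ z z′ → norm (z *ᵍ z′) ≡ norm z ℕ.* norm z′
  norm-* (a + b i) (c + d i) = ≡.trans
    (≡.cong ℤ.∣_∣ (solve 4 (λ a b c d →
      (a :* c :- b :* d) :* (a :* c :- b :* d) :+ (a :* d :+ b :* c) :* (a :* d :+ b :* c)
      := (a :* a :+ b :* b) :* (c :* c :+ d :* d)) ≡.refl a b c d))
    (ℤₚ.abs-* (a ℤ.* a ℤ.+ b ℤ.* b) (c ℤ.* c ℤ.+ d ℤ.* d))
    where open +-*-Solver

  associated⇒norm≡ : ∀ z z′ → Associated z z′ → norm z ≡ norm z′
  associated⇒norm≡ z z′ = go units (from-yes (all? (λ u → norm u ℕₚ.≟ 1) units))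
    where
    go : ∀ us → All (λ u → norm u ≡ 1) us → Any (λ u → z ≡ u *ᵍ z′) us → norm z ≡ norm z′
    go (u ∷ us) (n≡1 ∷ _) (here z≡uz′) = ≡.trans (≡.cong norm z≡uz′) (≡.trans (norm-* u z′)
      (≡.trans (≡.cong (ℕ._* norm z′) n≡1) (ℕₚ.*-identityˡ _)))
    go (u ∷ us) (_ ∷ ns)  (there any)  = go us ns any

  -- The exponent of 1 + i in a divisor of 2, read off its norm; 3 is a junk value.
  exponent : ℕ → ℕ
  exponent 1 = 0
  exponent 2 = 1
  exponent 4 = 2
  exponent _ = 3

  v : ℤ[i] → ℕ
  v z = exponent (norm z)

  -- (1 + i)^e for e ≤ 2, with a junk value beyond.
  power : ℕ → ℤ[i]
  power 1 = + 1 + + 1 i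
  power 2 = + 0 + + 2 i
  power _ = 1ᵍ

  abstract
    exponent-* : ∀ {m} → m ℕ.< 5 → ∀ {n} → n ℕ.< 5 → ∀ {s} → s ℕ.< 3 → m ℕ.* n ≡ 2 ℕ.^ s →
      exponent m ℕ.+ exponent n ≡ s × n ≡ 2 ℕ.^ exponent n
    exponent-* = from-yes (ℕₚ.allUpTo? (λ m → ℕₚ.allUpTo? (λ n → ℕₚ.allUpTo? (λ s →
      (m ℕ.* n ℕₚ.≟ 2 ℕ.^ s) →-dec
        ((exponent m ℕ.+ exponent n ℕₚ.≟ s) ×-dec (n ℕₚ.≟ 2 ℕ.^ exponent n))) 3) 5) 5)

    power-* : ∀ {a} → a ℕ.< 3 → ∀ {b} → b ℕ.< 3 → a ℕ.+ b ℕ.≤ 2 → power a *ᵍ power b ≡ power (a ℕ.+ b)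
    power-* = from-yes (ℕₚ.allUpTo? (λ a → ℕₚ.allUpTo? (λ b →
      (a ℕ.+ b ℕₚ.≤? 2) →-dec ((power a *ᵍ power b) ≟ᵍ power (a ℕ.+ b))) 3) 3)

    v-power : ∀ {a} → a ℕ.< 3 → v (power a) ≡ a
    v-power = from-yes (ℕₚ.allUpTo? (λ a → v (power a) ℕₚ.≟ a) 3)

  factor<5 : ∀ m n {s} → s ℕ.< 3 → m ℕ.* n ≡ 2 ℕ.^ s → m ℕ.< 5 × n ℕ.< 5
  factor<5 m n {s} s<3 eq = s≤s (ℕₚ.≤-trans (∣ℕ.∣⇒≤ {{nz}} (divides n (≡.trans (≡.sym eq) (ℕₚ.*-comm m n)))) 2^s≤4)
                          , s≤s (ℕₚ.≤-trans (∣ℕ.∣⇒≤ {{nz}} (divides m (≡.sym eq))) 2^s≤4)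
    where
    nz : NonZero (2 ℕ.^ s)
    nz = ℕₚ.m^n≢0 2 s
    2^s≤4 : 2 ℕ.^ s ℕ.≤ 4
    2^s≤4 = ℕₚ.^-monoʳ-≤ 2 (ℕₚ.≤-pred s<3)

  -- The norms of the entries multiply to 1, 2 or 4, so each is a power of 2 and the exponents add
  -- up. These exponents are the valuations at 1 + i, a prime of norm 2.
  sum-v : ∀ {k s} → s ℕ.< 3 → (ds : Vec ℤ[i] k) → norm (productᵍ ds) ≡ 2 ℕ.^ s →
          Vec.sum (Vec.map v ds) ≡ s
  sum-v {s = 0} s<3 [] eq = ≡.refl
  sum-v {s = 1} s<3 [] ()
  sum-v {s = 2} s<3 [] ()
  sum-v {s = suc (suc (suc s))} (s≤s (s≤s (s≤s ()))) [] eq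
  sum-v {s = s} s<3 (d ∷ ds) eq =
    ≡.trans (≡.cong (v d ℕ.+_) (sum-v s′<3 ds (proj₂ e))) (proj₁ e)
    where
    eq′ : norm d ℕ.* norm (productᵍ ds) ≡ 2 ℕ.^ s
    eq′ = ≡.trans (≡.sym (norm-* d (productᵍ ds))) eq
    b : norm d ℕ.< 5 × norm (productᵍ ds) ℕ.< 5
    b = factor<5 (norm d) (norm (productᵍ ds)) s<3 eq′
    e : v d ℕ.+ exponent (norm (productᵍ ds)) ≡ s ×
        norm (productᵍ ds) ≡ 2 ℕ.^ exponent (norm (productᵍ ds))
    e = exponent-* (proj₁ b) (proj₂ b) s<3 eq′
    s′<3 : exponent (norm (productᵍ ds)) ℕ.< 3
    s′<3 = ℕₚ.≤-<-trans (ℕₚ.≤-trans (ℕₚ.m≤n+m _ (v d)) (ℕₚ.≤-reflexive (proj₁ e))) s<3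

  product-powers : ∀ {k} (es : Vec ℕ k) → Vec.sum es ℕ.< 3 →
                   productᵍ (Vec.map power es) ≡ power (Vec.sum es)
  product-powers []       _   = ≡.refl
  product-powers (e ∷ es) s<3 = ≡.trans
    (≡.cong (power e *ᵍ_) (product-powers es (ℕₚ.≤-<-trans (ℕₚ.m≤n+m _ e) s<3)))
    (power-* (ℕₚ.≤-<-trans (ℕₚ.m≤m+n e _) s<3) (ℕₚ.≤-<-trans (ℕₚ.m≤n+m _ e) s<3) (ℕₚ.≤-pred s<3))

  v-powers : ∀ {k} (es : Vec ℕ k) → Vec.sum es ℕ.< 3 → Vec.map v (Vec.map power es) ≡ es
  v-powers []       _   = ≡.refl
  v-powers (e ∷ es) s<3 = ≡.cong₂ _∷_ (v-power (ℕₚ.≤-<-trans (ℕₚ.m≤m+n e _) s<3))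
    (v-powers es (ℕₚ.≤-<-trans (ℕₚ.m≤n+m _ e) s<3))

  ∈-tuples⁺ : ∀ {A : Set} {k} {xs : List A} {ds : Vec A k} → VecAll.All (_∈ xs) ds → ds ∈ tuples k xs
  ∈-tuples⁺ VecAll.[]         = here ≡.refl
  ∈-tuples⁺ (d∈ VecAll.∷ ds∈) = ∈ₚ.∈-cartesianProductWith⁺ _∷_ d∈ (∈-tuples⁺ ds∈)

  ∈-tuples⁻ : ∀ {A : Set} k {xs : List A} {ds : Vec A k} → ds ∈ tuples k xs → VecAll.All (_∈ xs) ds
  ∈-tuples⁻ zero    {ds = []} _ = VecAll.[]
  ∈-tuples⁻ (suc k) {xs} ds∈ with ∈ₚ.∈-cartesianProductWith⁻ _∷_ xs (tuples k xs) ds∈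
  ... | d , ds , d∈ , ds∈′ , ≡.refl = d∈ VecAll.∷ ∈-tuples⁻ k ds∈′

  module _ (a s : ℕ) (s<3 : s ℕ.< 3)
    (norm-a : norm (fromℕᵍ a) ≡ 2 ℕ.^ s)
    (power∼a : Associated (power s) (fromℕᵍ a))
    (power∈box : ∀ {e} → e ℕ.< suc s → power e ∈ box a)
    (associated⇔ : All (λ z → All (λ z′ → v z ℕ.< 3 → v z ≡ v z′ → Associated z z′) (box a)) (box a))
    where

    private
      tuplesOf : ∀ k → List (Vec ℤ[i] k)
      tuplesOf k = filter (λ ds → associated? (productᵍ ds) (fromℕᵍ a)) (tuples k (box a))

      Good : ∀ {k} → Vec ℤ[i] k → Set
      Good ds = VecAll.All (λ z → z ∈ box a × v z ℕ.< 3) ds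

      pointwise⇔ : ∀ {k} {ds ds′ : Vec ℤ[i] k} → Good ds → Good ds′ →
                   Pointwise Associated ds ds′ ⇔ (Vec.map v ds ≡ Vec.map v ds′)
      pointwise⇔ g g′ = mk⇔ (to g g′) (from g g′)
        where
        to : ∀ {k} {ds ds′ : Vec ℤ[i] k} → Good ds → Good ds′ →
             Pointwise Associated ds ds′ → Vec.map v ds ≡ Vec.map v ds′
        to g g′ [] = ≡.refl
        to (_ VecAll.∷ g) (_ VecAll.∷ g′) (_∷_ {x = z} {y = z′} z∼z′ ds∼) =
          ≡.cong₂ _∷_ (≡.cong exponent (associated⇒norm≡ z z′ z∼z′)) (to g g′ ds∼)
        from : ∀ {k} {ds ds′ : Vec ℤ[i] k} → Good ds → Good ds′ →
               Vec.map v ds ≡ Vec.map v ds′ → Pointwise Associated ds ds′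
        from {ds′ = []} VecAll.[] _ eq = []
        from {ds = z ∷ ds} {z′ ∷ ds′} ((z∈ , vz) VecAll.∷ g) ((z′∈ , _) VecAll.∷ g′) eq =
          All.lookup (All.lookup associated⇔ z∈) z′∈ vz (Vecₚ.∷-injectiveˡ eq)
            ∷ from g g′ (Vecₚ.∷-injectiveʳ eq)

      v<3 : ∀ {k} (ds : Vec ℤ[i] k) → Vec.sum (Vec.map v ds) ℕ.< 3 → VecAll.All (λ z → v z ℕ.< 3) ds
      v<3 []       _   = VecAll.[]
      v<3 (d ∷ ds) s<3 = ℕₚ.≤-<-trans (ℕₚ.m≤m+n (v d) _) s<3
        VecAll.∷ v<3 ds (ℕₚ.≤-<-trans (ℕₚ.m≤n+m _ (v d)) s<3)

      sum-v≡s : ∀ {k} {ds : Vec ℤ[i] k} → ds ∈ tuplesOf k → Vec.sum (Vec.map v ds) ≡ s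
      sum-v≡s {k} {ds} ds∈ = sum-v s<3 ds (≡.trans (associated⇒norm≡ (productᵍ ds) (fromℕᵍ a)
        (proj₂ (∈ₚ.∈-filter⁻ (λ ds → associated? (productᵍ ds) (fromℕᵍ a)) {xs = tuples k (box a)} ds∈)))
        norm-a)

      good : ∀ {k} {ds : Vec ℤ[i] k} → ds ∈ tuplesOf k → Good ds
      good {k} {ds} ds∈ = VecAll.zip
        ( ∈-tuples⁻ k (proj₁ (∈ₚ.∈-filter⁻ (λ ds → associated? (productᵍ ds) (fromℕᵍ a))
            {xs = tuples k (box a)} ds∈))
        , v<3 ds (≡.subst (ℕ._< 3) (≡.sym (sum-v≡s ds∈)) s<3))

      powers∈box : ∀ {k} (es : Vec ℕ k) → Vec.sum es ℕ.≤ s → VecAll.All (_∈ box a) (Vec.map power es)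
      powers∈box []       _   = VecAll.[]
      powers∈box (e ∷ es) e≤s = power∈box (s≤s (ℕₚ.≤-trans (ℕₚ.m≤m+n e _) e≤s))
        VecAll.∷ powers∈box es (ℕₚ.≤-trans (ℕₚ.m≤n+m _ e) e≤s)

      powers∈ : ∀ {k} (es : Vec ℕ k) → Vec.sum es ≡ s → es ∈ List.map (Vec.map v) (tuplesOf k)
      powers∈ es eq = ≡.subst (_∈ _) (v-powers es s<3′) (∈ₚ.∈-map⁺ (Vec.map v)
        (∈ₚ.∈-filter⁺ (λ ds → associated? (productᵍ ds) (fromℕᵍ a))
          (∈-tuples⁺ (powers∈box es (ℕₚ.≤-reflexive eq)))
          (≡.subst (λ z → Associated z (fromℕᵍ a))
            (≡.sym (≡.trans (product-powers es s<3′) (≡.cong power eq))) power∼a)))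
        where
        s<3′ : Vec.sum es ℕ.< 3
        s<3′ = ≡.subst (ℕ._< 3) (≡.sym eq) s<3

    -- The integer `a` is associated to (1 + i)^s. On tuples with product associated to `a`, the
    -- exponents of 1 + i form a complete invariant, whose values are exactly the vectors with sum
    -- `s`. Two lists without repetitions and with the same elements have equal length.
    𝔱≡length : ∀ k → 𝔱 k a ≡ length (compositions k s)
    𝔱≡length k = ≡.trans (≡.sym (Listₚ.length-map (Vec.map v)
      (deduplicate (Pointwise.decidable associated?) (tuplesOf k)))) (≡.trans
      (≡.cong length (map-deduplicate (Pointwise.decidable associated?) _≟_ (Vec.map v)
        pointwise⇔ (All.tabulate {xs = tuplesOf k} good)))
      (↭-length (∼bag⇒↭ (unique∧set⇒bag (UniqueDecₚ.deduplicate-! _≟_ _) (compositions-unique k s)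
        (mk⇔ to from)))))
      where
      _≟_ : DecidableEquality (Vec ℕ k)
      _≟_ = Vecₚ.≡-dec ℕₚ._≟_
      to : ∀ {es} → es ∈ deduplicate _≟_ (List.map (Vec.map v) (tuplesOf k)) → es ∈ compositions k s
      to es∈ with ∈ₚ.∈-map⁻ (Vec.map v) (∈ₚ.∈-deduplicate⁻ _≟_ _ es∈)
      ... | ds , ds∈ , ≡.refl = ∈-compositions⁺ (Vec.map v ds) (sum-v≡s ds∈)
      from : ∀ {es} → es ∈ compositions k s → es ∈ deduplicate _≟_ (List.map (Vec.map v) (tuplesOf k))
      from {es} es∈ = ∈ₚ.∈-deduplicate⁺ _≟_ (powers∈ es (∈-compositions⁻ s es∈))

  abstract
    𝔱-1 : ∀ k → 𝔱 k 1 ≡ 1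
    𝔱-1 k = ≡.trans (𝔱≡length 1 0 (s≤s z≤n) ≡.refl (here ≡.refl)
      (from-yes (ℕₚ.allUpTo? (λ e → any? (power e ≟ᵍ_) (box 1)) 1))
      (from-yes (all? (λ z → all? (λ z′ → (v z ℕₚ.<? 3) →-dec ((v z ℕₚ.≟ v z′) →-dec associated? z z′))
        (box 1)) (box 1))) k)
      (length-compositions-0 k)

    2*𝔱-2 : ∀ k → 2 ℕ.* 𝔱 k 2 ≡ k ℕ.^ 2 ℕ.+ k
    -- 2 is associated to (1 + i)², hence s = 2; what remains is a finite check over `box 2`.
    2*𝔱-2 k = ≡.trans (≡.cong (2 ℕ.*_) (𝔱≡length 2 2 ℕₚ.≤-refl ≡.refl
      (from-yes (associated? (power 2) (fromℕᵍ 2)))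
      (from-yes (ℕₚ.allUpTo? (λ e → any? (power e ≟ᵍ_) (box 2)) 3))
      (from-yes (all? (λ z → all? (λ z′ → (v z ℕₚ.<? 3) →-dec ((v z ℕₚ.≟ v z′) →-dec associated? z z′))
        (box 2)) (box 2))) k))
      (length-compositions-2 k)

  length-cartesianProductWith : ∀ {A B C : Set} (f : A → B → C) xs ys →
    length (cartesianProductWith f xs ys) ≡ length xs ℕ.* length ys
  length-cartesianProductWith f []       ys = ≡.refl
  length-cartesianProductWith f (x ∷ xs) ys = ≡.trans (Listₚ.length-++ (List.map (f x) ys))
    (≡.cong₂ ℕ._+_ (Listₚ.length-map (f x) ys) (length-cartesianProductWith f xs ys))

  length-tuples : ∀ {A : Set} k (xs : List A) → length (tuples k xs) ≡ length xs ℕ.^ k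
  length-tuples zero    xs = ≡.refl
  length-tuples (suc k) xs = ≡.trans (length-cartesianProductWith _∷_ xs (tuples k xs))
    (≡.cong (length xs ℕ.*_) (length-tuples k xs))

  -- Counts all candidate tuples before any selection. Polynomial growth in `a` is enough, because
  -- it will only be compared with an exponential.
  𝔱-bound : ∀ k a → 𝔱 k a ℕ.≤ (suc (2 ℕ.* a) ℕ.* suc (2 ℕ.* a)) ℕ.^ k
  𝔱-bound k a = ℕₚ.≤-trans (Listₚ.length-deduplicate (Pointwise.decidable associated?)
      (filter (λ ds → associated? (productᵍ ds) (fromℕᵍ a)) (tuples k (box a))))
    (ℕₚ.≤-trans (Listₚ.length-filter (λ ds → associated? (productᵍ ds) (fromℕᵍ a)) (tuples k (box a)))
    (ℕₚ.≤-trans (ℕₚ.≤-reflexive (length-tuples k (box a)))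
    (ℕₚ.^-monoˡ-≤ k length-box)))
    where
    range : List ℤ
    range = List.map (λ j → + j ℤ.- + a) (upTo (suc (2 ℕ.* a)))
    length-range : length range ≡ suc (2 ℕ.* a)
    length-range = ≡.trans (Listₚ.length-map _ (upTo (suc (2 ℕ.* a)))) (Listₚ.length-upTo _)
    length-box : length (box a) ℕ.≤ suc (2 ℕ.* a) ℕ.* suc (2 ℕ.* a)
    length-box = ℕₚ.≤-trans
      (Listₚ.length-filter (λ z → ¬? (z ≟ᵍ 0ᵍ)) (cartesianProductWith _+_i range range))
      (ℕₚ.≤-reflexive (≡.trans (length-cartesianProductWith _+_i range range)
        (≡.cong₂ ℕ._*_ length-range length-range)))

-- The functions m^(-σ) and the tails of the series of m^(-3σ).

module Powers {c ℓ₁ ℓ₂} (ℝ : RealNumbers c ℓ₁ ℓ₂) where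
  open RealNumbers ℝ hiding (zero)
  open FieldProperties ℝ
  open Sums ℝ
  open Limits ℝ
  open Exponential ℝ
  open Solver using (solve; _:=_; _:+_; _:*_; _:-_; :-_; con)

  ln : ℕ → Carrier
  ln zero    = 0#
  ln (suc n) = log (fromℕ (suc n)) (0<fromℕ[1+n] n)

  -- m^(-σ), with the value 0 at m = 0 so that it is completely multiplicative on all of ℕ.
  ν : Carrier → ℕ → Carrier
  ν σ zero    = 0#
  ν σ (suc n) = exp (- (σ * ln (suc n)))

  abstract
    exp-ln : ∀ n → exp (ln (suc n)) ≈ fromℕ (suc n)
    exp-ln n = exp-log _ _

    ln-* : ∀ m n → ln (suc m ℕ.* suc n) ≈ ln (suc m) + ln (suc n)
    ln-* m n = exp-injective (trans (exp-ln (n ℕ.+ m ℕ.* suc n)) (trans (fromℕ-* (suc m) (suc n))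
      (sym (trans (exp-+ _ _) (*-cong (exp-ln m) (exp-ln n))))))

    ln-mono : ∀ {m n} → m ℕ.≤ n → ln (suc m) ≤ ln (suc n)
    ln-mono {m} {n} m≤n = exp-cancel-≤ (≤-trans (≤-reflexive (exp-ln m))
      (≤-trans (fromℕ-mono (s≤s m≤n)) (≤-reflexive (sym (exp-ln n)))))

    ln-1 : ln 1 ≈ 0#
    ln-1 = exp-injective (trans (exp-ln 0) (trans (+-identityʳ 1#) (sym exp-0)))

    0≤ln : ∀ n → 0# ≤ ln n
    0≤ln zero    = ≤-refl
    0≤ln (suc n) = ≤-trans (≤-reflexive (sym ln-1)) (ln-mono {0} {n} z≤n)

    ln-unbounded : ∀ T → ∃[ N ] ∀ n → N ℕ.≤ n → T ≤ ln (suc n)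
    ln-unbounded T with archimedean (exp T)
    ... | N , eT<N = N , λ n N≤n → exp-cancel-≤ (≤-trans (<⇒≤ eT<N)
      (≤-trans (fromℕ-mono (ℕₚ.≤-trans N≤n (ℕₚ.n≤1+n n))) (≤-reflexive (sym (exp-ln n)))))

    ν-nonneg : ∀ σ m → 0# ≤ ν σ m
    ν-nonneg σ zero    = ≤-refl
    ν-nonneg σ (suc m) = exp-nonneg _

    ν-* : ∀ σ m n → ν σ (m ℕ.* n) ≈ ν σ m * ν σ n
    ν-* σ zero    n       = sym (zeroˡ _)
    ν-* σ (suc m) zero    = trans (reflexive (≡.cong (ν σ) (ℕₚ.*-zeroʳ m))) (sym (zeroʳ _))
    ν-* σ (suc m) (suc n) = trans (exp-cong (trans (-‿cong (*-congˡ (ln-* m n)))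
      (solve 3 (λ s x y → :- (s :* (x :+ y)) := :- (s :* x) :+ :- (s :* y)) refl σ _ _))) (exp-+ _ _)

    ν-1 : ∀ σ → ν σ 1 ≈ 1#
    ν-1 σ = trans (exp-cong (trans (-‿cong (trans (*-congˡ ln-1) (zeroʳ σ))) -0#≈0#)) exp-0

    ν-^ : ∀ σ m a → ν σ (m ℕ.^ a) ≈ ν σ m ^ a
    ν-^ σ m zero    = ν-1 σ
    ν-^ σ m (suc a) = trans (ν-* σ m (m ℕ.^ a)) (*-congˡ (ν-^ σ m a))

    ν-^* : ∀ σ j a m → ν σ (j ℕ.^ a ℕ.* m) ≈ ν σ j ^ a * ν σ m
    ν-^* σ j a m = trans (ν-* σ (j ℕ.^ a) m) (*-congʳ (ν-^ σ j a))

    ν-antitoneˡ : ∀ {σ τ} → σ ≤ τ → ∀ m → ν τ m ≤ ν σ m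
    ν-antitoneˡ σ≤τ zero    = ≤-refl
    ν-antitoneˡ σ≤τ (suc m) = exp-mono-≤ (neg-mono-≤ (*-monoʳ-≤ _ (0≤ln (suc m)) σ≤τ))

    ν-antitoneʳ : ∀ {σ m n} → 0# ≤ σ → m ℕ.≤ n → ν σ (suc n) ≤ ν σ (suc m)
    ν-antitoneʳ {σ} 0≤σ m≤n = exp-mono-≤ (neg-mono-≤ (*-monoˡ-≤ σ 0≤σ (ln-mono m≤n)))

  cube : Carrier → Carrier
  cube x = x * (x * x)

  -- θ = 3σ - 1: the tail of Σ m^(-3σ) beyond n decays like n^(-θ).
  excess : Carrier → Carrier
  excess σ = σ + σ + σ - 1#

  ζ-tail : Carrier → ℕ → Carrier
  ζ-tail θ n = exp (- (θ * ln (suc n)))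

  abstract
    cube-nonneg : ∀ {x} → 0# ≤ x → 0# ≤ cube x
    cube-nonneg 0≤x = *-nonneg 0≤x (*-nonneg 0≤x 0≤x)

    -- ln (n+2) - ln (n+1) ≥ 1/(n+2)
    ln-step : ∀ n → exp (- ln (2 ℕ.+ n)) ≤ ln (2 ℕ.+ n) - ln (suc n)
    ln-step n = ≤-diff (exp (y - x) - (1# + (y - x))) (0≤y-x (1+x≤exp[x] (y - x)))
      (trans (solve 3 (λ x y e → x :- y := e :+ ((con (+ 1) :- e) :- (con (+ 1) :+ (y :- x))))
          refl x y _)
        (+-congˡ (+-congʳ (sym e≈))))
      where
      x y : Carrier
      x = ln (2 ℕ.+ n)
      y = ln (suc n)
      e≈ : exp (y - x) ≈ 1# - exp (- x)
      e≈ = trans (exp-+ y (- x)) (trans (*-congʳ (exp-ln n)) (trans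
        (solve 2 (λ f e → f :* e := (con (+ 1) :+ f) :* e :- e) refl _ _)
        (+-congʳ (trans (*-congʳ (sym (exp-ln (suc n)))) (exp-+-neg x)))))

    0<ln-2 : 0# < ln 2
    0<ln-2 = <-≤-trans (exp-pos _) (≤-trans (ln-step 0)
      (≤-reflexive (trans (+-congˡ (trans (-‿cong ln-1) -0#≈0#)) (+-identityʳ _))))

    cube-ν : ∀ σ n → cube (ν σ (suc n)) ≈ exp (- (excess σ * ln (suc n))) * exp (- ln (suc n))
    cube-ν σ n = trans (trans (*-congˡ (sym (exp-+ _ _))) (sym (exp-+ _ _)))
      (trans (exp-cong (solve 2 (λ s l → :- (s :* l) :+ (:- (s :* l) :+ :- (s :* l)) :=
        :- ((s :+ s :+ s :- con (+ 1)) :* l) :+ :- l) refl σ _)) (exp-+ _ _))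

    -- A telescoping form of the comparison with an integral. With h = ln(n+2) - ln(n+1) ≥ 1/(n+2),
    -- the right side is (n+2)^(-θ) (exp(θh) - 1), which is at least (n+2)^(-θ) θ h.
    ζ-step : ∀ σ → 0# < excess σ → ∀ n →
      excess σ * cube (ν σ (2 ℕ.+ n)) ≤ ζ-tail (excess σ) n - ζ-tail (excess σ) (suc n)
    ζ-step σ 0<θ n = ≤-trans (≤-reflexive (trans (*-congˡ (cube-ν σ (suc n)))
        (solve 3 (λ t a b → t :* (a :* b) := a :* (t :* b)) refl θ _ _)))
      (≤-trans (*-monoˡ-≤ _ (exp-nonneg _) (≤-trans (*-monoˡ-≤ θ (<⇒≤ 0<θ) (ln-step n))
        (≤-diff (exp (θ * h) - (1# + θ * h)) (0≤y-x (1+x≤exp[x] (θ * h)))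
          (solve 2 (λ e t → e :- con (+ 1) := t :+ (e :- (con (+ 1) :+ t))) refl _ _))))
      (≤-reflexive (trans (solve 2 (λ a e → a :* (e :- con (+ 1)) := a :* e :- a) refl _ _)
        (+-congʳ (trans (sym (exp-+ _ _)) (exp-cong
          (solve 3 (λ t x y → :- (t :* x) :+ t :* (x :- y) := :- (t :* y)) refl θ _ _)))))))
      where
      θ h : Carrier
      θ = excess σ
      h = ln (2 ℕ.+ n) - ln (suc n)

    ζ-partial : ∀ σ → 0# < excess σ → ∀ n k →
      excess σ * ∑ k (λ a → cube (ν σ (2 ℕ.+ (n ℕ.+ a)))) ≤ ζ-tail (excess σ) n - ζ-tail (excess σ) (n ℕ.+ k)
    ζ-partial σ 0<θ n zero    = ≤-reflexive (trans (zeroʳ _) (sym (trans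
      (+-congˡ (-‿cong (reflexive (≡.cong (ζ-tail (excess σ)) (ℕₚ.+-identityʳ n))))) (-‿inverseʳ _))))
    ζ-partial σ 0<θ n (suc k) = ≤-trans (≤-reflexive (distribˡ _ _ _))
      (≤-trans (+-mono-≤ (ζ-partial σ 0<θ n k) (ζ-step σ 0<θ (n ℕ.+ k)))
        (≤-reflexive (trans (solve 3 (λ a b c → a :- b :+ (b :- c) := a :- c) refl _ _ _)
          (+-congˡ (-‿cong (reflexive (≡.cong (ζ-tail (excess σ)) (≡.sym (ℕₚ.+-suc n k)))))))))

  ζ-remainder : ∀ σ → 0# < excess σ → ℕ → Carrier
  ζ-remainder σ 0<θ n = inverse 0<θ * ζ-tail (excess σ) n

  abstract
    ζ-bound : ∀ σ (0<θ : 0# < excess σ) n k →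
      ∑ k (λ a → cube (ν σ (2 ℕ.+ (n ℕ.+ a)))) ≤ ζ-remainder σ 0<θ n
    ζ-bound σ 0<θ n k = *≤⇒≤inverse* 0<θ (≤-trans (≤-reflexive (*-comm _ _))
      (≤-trans (ζ-partial σ 0<θ n k) (≤-diff _ (exp-nonneg _)
        (solve 2 (λ a b → a := a :- b :+ b) refl _ (ζ-tail (excess σ) (n ℕ.+ k))))))

    ζ-remainder-nonneg : ∀ σ (0<θ : 0# < excess σ) n → 0# ≤ ζ-remainder σ 0<θ n
    ζ-remainder-nonneg σ 0<θ n = *-nonneg (<⇒≤ (inverse-pos 0<θ)) (exp-nonneg _)

    ζ-remainder-vanishes : ∀ σ (0<θ : 0# < excess σ) → Vanishing (ζ-remainder σ 0<θ)
    ζ-remainder-vanishes σ 0<θ = vanishing-*ˡ _ (<⇒≤ (inverse-pos 0<θ)) (λ n → exp-nonneg _) lem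
      where
      lem : Vanishing (ζ-tail (excess σ))
      lem ε 0<ε =
        let T , h = exp[-x]-vanishes ε 0<ε
            N , T≤ = ln-unbounded (inverse 0<θ * T)
        in N , λ n N≤n → h (excess σ * ln (suc n)) (≤-trans
          (≤-reflexive (trans (sym (*-identityˡ T)) (trans (*-congʳ (trans (sym (inverse-* 0<θ)) (*-comm _ _)))
            (*-assoc _ _ T))))
          (*-monoˡ-≤ _ (<⇒≤ 0<θ) (T≤ n N≤n)))

-- Convergence and positivity of Euler products of operators.

module EulerProducts {c ℓ₁ ℓ₂} (ℝ : RealNumbers c ℓ₁ ℓ₂) where
  open RealNumbers ℝ hiding (zero)
  open FieldProperties ℝ
  open Sums ℝ
  open Limits ℝ
  open Exponential ℝ
  open Sieve ℝ
  open Powers ℝ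
  open Solver using (solve; _:=_; _:+_; _:*_; _:-_; :-_; con)

  -- The local factors are 1 + O(p^(-3σ)), uniformly in p and geometrically in the exponent.
  record CubeFull (u : ℕ → ℕ → Carrier) : Set (c Level.⊔ ℓ₁ Level.⊔ ℓ₂) where
    field
      W κ : Carrier
      0≤W : 0# ≤ W
      0<κ : 0# < κ
      u-0 : ∀ n → u n 0 ≈ 1#
      u-bound : ∀ σ → ⅓ ≤ σ → ∀ n a →
        ∣ u n (suc a) ∣ * ν σ (2 ℕ.+ n) ^ suc a ≤ W * cube (ν σ (2 ℕ.+ n)) * exp (- κ) ^ suc a

  module Bounds {u : ℕ → ℕ → Carrier} (cubeFull : CubeFull u)
                (σ : Carrier) (⅓≤σ : ⅓ ≤ σ) (0<θ : 0# < excess σ) where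
    open CubeFull cubeFull

    -- `G` is the sum of the geometric series in `ρ`, so that `S * z n` bounds the distance of the
    -- n-th local operator from the identity.
    ρ G S : Carrier
    ρ = exp (- κ)
    G = inverse (0<y-x (exp[-x]<1 0<κ))
    S = W * G

    z : ℕ → Carrier
    z n = cube (ν σ (2 ℕ.+ n))

    -- A bound in the sup norm with weight m^(-σ). Since the weight is an eigenfunction of every
    -- dilation, local operators act boundedly in this norm.
    Dominated : Carrier → (ℕ → Carrier) → Set _
    Dominated K φ = ∀ m → ∣ φ m ∣ ≤ K * ν σ m

    growth : ℕ → Carrier
    growth zero    = 1#
    growth (suc n) = (1# + S * z n) * growth n

    R : ℕ → Carrier
    R = ζ-remainder σ 0<θ

    growthBound : Carrier
    growthBound = exp (S * R 0)

    abstract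
      0≤ρ : 0# ≤ ρ
      0≤ρ = exp-nonneg _

      0≤G : 0# ≤ G
      0≤G = <⇒≤ (inverse-pos _)

      0≤S : 0# ≤ S
      0≤S = *-nonneg 0≤W 0≤G

      0≤z : ∀ n → 0# ≤ z n
      0≤z n = cube-nonneg (ν-nonneg σ (2 ℕ.+ n))

      0≤Sz : ∀ n → 0# ≤ S * z n
      0≤Sz n = *-nonneg 0≤S (0≤z n)

      0≤K : ∀ {K φ} → Dominated K φ → 0# ≤ K
      0≤K {K} {φ} dom = ≤-trans (0≤∣x∣ (φ 1)) (≤-trans (dom 1)
        (≤-reflexive (trans (*-congˡ (ν-1 σ)) (*-identityʳ K))))

      term-bound : ∀ {K φ} → Dominated K φ → ∀ n a m →
        ∣ u n (suc a) * φ ((2 ℕ.+ n) ℕ.^ suc a ℕ.* m) ∣ ≤ (K * (W * z n) * ν σ m) * ρ ^ suc a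
      term-bound {K} {φ} dom n a m = ≤-trans (∣x*y∣≤∣x∣*∣y∣ _ _) (≤-trans
        (*-monoˡ-≤ _ (0≤∣x∣ _) (≤-trans (dom _) (≤-reflexive (*-congˡ (ν-^* σ (2 ℕ.+ n) (suc a) m)))))
        (≤-trans (≤-reflexive (solve 4 (λ u K p v → u :* (K :* (p :* v)) := K :* v :* (u :* p)) refl _ K _ _))
        (≤-trans (*-monoˡ-≤ _ (*-nonneg (0≤K {φ = φ} dom) (ν-nonneg σ m)) (u-bound σ ⅓≤σ n a))
        (≤-reflexive (solve 4 (λ K v w r → K :* v :* (w :* r) := K :* w :* v :* r) refl K _ _ _)))))

      -- Used twice: b = 0 measures the distance of the operator from the identity, and b = L the
      -- effect of raising the truncation.
      tail-bound : ∀ {K φ} → Dominated K φ → ∀ n b d m →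
        ∣ ∑ d (λ a → u n (suc (b ℕ.+ a)) * φ ((2 ℕ.+ n) ℕ.^ suc (b ℕ.+ a) ℕ.* m)) ∣ ≤
        K * (S * z n) * ρ ^ b * ν σ m
      tail-bound {K} {φ} dom n b d m = ≤-trans (∑-∣∣ d _) (≤-trans
        (∑-mono d λ a → ≤-trans (term-bound {φ = φ} dom n (b ℕ.+ a) m) (≤-trans
          (*-monoˡ-≤ _ 0≤C (≤-trans
            (*-monoʳ-≤ _ (^-nonneg (b ℕ.+ a) 0≤ρ) (exp[-x]≤1 (<⇒≤ 0<κ)))
            (≤-reflexive (trans (*-identityˡ _) (^-homo-* ρ b a)))))
          (≤-reflexive (sym (*-assoc _ _ _)))))
        (≤-trans (≤-reflexive (∑-*ˡ d _ _)) (≤-trans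
          (*-monoˡ-≤ _ (*-nonneg 0≤C (^-nonneg b 0≤ρ)) (geometric-≤ (exp[-x]<1 0<κ) 0≤ρ d))
          (≤-reflexive (solve 6 (λ K W z v r G →
            K :* (W :* z) :* v :* r :* G := K :* (W :* G :* z) :* r :* v) refl K W (z n) _ _ G)))))
        where
        0≤C : 0# ≤ K * (W * z n) * ν σ m
        0≤C = *-nonneg (*-nonneg (0≤K {φ = φ} dom) (*-nonneg 0≤W (0≤z n))) (ν-nonneg σ m)

      op-near-id : ∀ {K φ} → Dominated K φ → ∀ L n m →
        ∣ op L u n φ m - φ m ∣ ≤ K * (S * z n) * ν σ m
      op-near-id {K} {φ} dom L n m = ≤-trans (∣∣-mono (trans (+-congʳ (trans (∑-head L _)
          (+-congʳ (trans (*-congʳ (u-0 n)) (trans (*-identityˡ _)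
            (reflexive (≡.cong φ (ℕₚ.*-identityˡ m))))))))
          (solve 2 (λ x y → x :+ y :- x := y) refl _ _)))
        (≤-trans (tail-bound {φ = φ} dom n 0 L m) (≤-reflexive (*-congʳ (*-identityʳ _))))

      op-dominated : ∀ {K φ} → Dominated K φ → ∀ L n → Dominated ((1# + S * z n) * K) (op L u n φ)
      op-dominated {K} {φ} dom L n m = ≤-trans
        (∣∣-mono (solve 2 (λ x y → x := (x :- y) :+ y) refl _ (φ m)))
        (≤-trans (∣x+y∣≤∣x∣+∣y∣ _ _) (≤-trans (+-mono-≤ (op-near-id {φ = φ} dom L n m) (dom m))
          (≤-reflexive (solve 3 (λ K s v → K :* s :* v :+ K :* v := (con (+ 1) :+ s) :* K :* v)
            refl K _ _))))

      op-extend : ∀ {K φ} → Dominated K φ → ∀ L d n m →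
        ∣ op (L ℕ.+ d) u n φ m - op L u n φ m ∣ ≤ K * (S * z n) * ρ ^ L * ν σ m
      op-extend {K} {φ} dom L d n m = ≤-trans
        (∣∣-mono (trans (+-congʳ (∑-split (suc L) d _)) (solve 2 (λ x y → x :+ y :- x := y) refl _ _)))
        (tail-bound {φ = φ} dom n L d m)

      1≤growth : ∀ n → 1# ≤ growth n
      1≤growth zero    = ≤-refl
      1≤growth (suc n) = ≤-trans (1≤growth n) (≤-diff (S * z n * growth n)
        (*-nonneg (0≤Sz n) (≤-trans 0≤1 (1≤growth n)))
        (solve 2 (λ s g → (con (+ 1) :+ s) :* g := g :+ s :* g) refl _ _))

      0≤growth : ∀ n → 0# ≤ growth n
      0≤growth n = ≤-trans 0≤1 (1≤growth n)

      growth-exp : ∀ n → growth n ≤ exp (S * ∑ n z)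
      growth-exp zero    = ≤-reflexive (sym (trans (exp-cong (zeroʳ S)) exp-0))
      growth-exp (suc n) = ≤-trans
        (*-mono-≤ (+-nonneg 0≤1 (0≤Sz n)) (exp-nonneg _) (1+x≤exp[x] (S * z n)) (growth-exp n))
        (≤-reflexive (trans (sym (exp-+ _ _)) (exp-cong (trans (+-comm _ _) (sym (distribˡ S _ _))))))

      growth-bounded : ∀ n → growth n ≤ growthBound
      growth-bounded n = ≤-trans (growth-exp n) (exp-mono-≤ (*-monoˡ-≤ S 0≤S (ζ-bound σ 0<θ 0 n)))

      euler-dominated : ∀ {K φ} → Dominated K φ → ∀ L n → Dominated (growth n * K) (euler L u n φ)
      euler-dominated dom L zero    m = ≤-trans (dom m) (≤-reflexive (*-congʳ (sym (*-identityˡ _))))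
      euler-dominated {K} {φ} dom L (suc n) m = ≤-trans
        (op-dominated {φ = euler L u n φ} (euler-dominated {φ = φ} dom L n) L n m)
        (≤-reflexive (*-congʳ (sym (*-assoc _ _ _))))

      euler-bounded : ∀ {K φ} → Dominated K φ → ∀ L n → ∣ euler L u n φ 1 ∣ ≤ growthBound * K
      euler-bounded {K} {φ} dom L n = ≤-trans (euler-dominated {φ = φ} dom L n 1)
        (≤-trans (≤-reflexive (trans (*-congˡ (ν-1 σ)) (*-identityʳ _)))
          (*-monoʳ-≤ K (0≤K {φ = φ} dom) (growth-bounded n)))

      euler-extend-n : ∀ {K φ} → Dominated K φ → ∀ L n d m →
        ∣ euler L u (n ℕ.+ d) φ m - euler L u n φ m ∣ ≤
        growthBound * K * (S * ∑ d (λ a → z (n ℕ.+ a))) * ν σ m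
      euler-extend-n {K} {φ} dom L n zero m rewrite ℕₚ.+-identityʳ n = ≤-reflexive (trans
        (trans (∣∣-cong (-‿inverseʳ _)) ∣0∣≈0)
        (solve 3 (λ b s v → con (+ 0) := b :* (s :* con (+ 0)) :* v) refl _ S _))
      euler-extend-n {K} {φ} dom L n (suc d) m rewrite ℕₚ.+-suc n d = ≤-trans
        (∣∣-mono (solve 3 (λ x y w → x :- w := (x :- y) :+ (y :- w)) refl _ (euler L u (n ℕ.+ d) φ m) _))
        (≤-trans (∣x+y∣≤∣x∣+∣y∣ _ _) (≤-trans (+-mono-≤
          (≤-trans (op-near-id {φ = euler L u (n ℕ.+ d) φ} (euler-dominated {φ = φ} dom L (n ℕ.+ d)) L (n ℕ.+ d) m)
            (*-monoʳ-≤ _ (ν-nonneg σ m) (*-monoʳ-≤ _ (0≤Sz (n ℕ.+ d))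
              (*-monoʳ-≤ K (0≤K {φ = φ} dom) (growth-bounded (n ℕ.+ d))))))
          (euler-extend-n {φ = φ} dom L n d m))
        (≤-reflexive (solve 5 (λ b S z s v → b :* (S :* z) :* v :+ b :* (S :* s) :* v
          := b :* (S :* (s :+ z)) :* v) refl _ S _ _ _))))

      -- The truncation is raised first in the outermost factor and then, by induction, in the inner
      -- ones, whose change the outer factor enlarges by at most 1 + S z.
      euler-extend-L : ∀ {K φ} → Dominated K φ → ∀ L d n m →
        ∣ euler (L ℕ.+ d) u n φ m - euler L u n φ m ∣ ≤ (growth n * K * ρ ^ L * (S * ∑ n z)) * ν σ m
      euler-extend-L {K} {φ} dom L d zero m = ≤-reflexive (trans
        (trans (∣∣-cong (-‿inverseʳ _)) ∣0∣≈0)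
        (solve 3 (λ b s v → con (+ 0) := b :* (s :* con (+ 0)) :* v) refl _ S _))
      euler-extend-L {K} {φ} dom L d (suc n) m = ≤-trans
        (∣∣-mono (trans
          (solve 3 (λ x y w → x :- w := (x :- y) :+ (y :- w)) refl _ (op L u n ψ′ m) _)
          (+-congˡ (sym op-sub))))
        (≤-trans (∣x+y∣≤∣x∣+∣y∣ _ _) (≤-trans (+-mono-≤
          (op-extend {φ = ψ′} (euler-dominated {φ = φ} dom (L ℕ.+ d) n) L d n m)
          (op-dominated {φ = λ x → ψ′ x - ψ x} (euler-extend-L {φ = φ} dom L d n) L n m))
        -- The claimed bound exceeds the two estimates by this second-order term, because its factor
        -- 1 + S z also multiplies the new summand z.
        (≤-diff (S * z n * g * K * ρ ^ L * (S * z n) * ν σ m)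
          (*-nonneg (*-nonneg (*-nonneg (*-nonneg (*-nonneg (0≤Sz n) (0≤growth n)) (0≤K {φ = φ} dom))
            (^-nonneg L 0≤ρ)) (0≤Sz n)) (ν-nonneg σ m))
          (solve 7 (λ g K r S z s v →
            (con (+ 1) :+ S :* z) :* g :* K :* r :* (S :* (s :+ z)) :* v
            := g :* K :* (S :* z) :* r :* v :+ (con (+ 1) :+ S :* z) :* (g :* K :* r :* (S :* s)) :* v
               :+ S :* z :* g :* K :* r :* (S :* z) :* v) refl g K (ρ ^ L) S (z n) (∑ n z) (ν σ m)))))
        where
        g : Carrier
        g = growth n
        ψ ψ′ : ℕ → Carrier
        ψ  = euler L u n φ
        ψ′ = euler (L ℕ.+ d) u n φ
        op-sub : op L u n (λ x → ψ′ x - ψ x) m ≈ op L u n ψ′ m - op L u n ψ m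
        op-sub = trans
          (∑-cong (suc L) λ a → solve 3 (λ u f g → u :* (f :- g) := u :* f :- u :* g) refl _ _ _)
          (∑-sub (suc L) _ _)

    rate : Carrier → ℕ → Carrier
    rate K n = growthBound * K * S * (R n + R 0 * ρ ^ n)

    abstract
      0≤growthBound : 0# ≤ growthBound
      0≤growthBound = exp-nonneg _

      0≤R : ∀ n → 0# ≤ R n
      0≤R = ζ-remainder-nonneg σ 0<θ

      rate-vanishes : ∀ {K} → 0# ≤ K → Vanishing (rate K)
      rate-vanishes {K} 0≤K = vanishing-*ˡ _ (*-nonneg (*-nonneg 0≤growthBound 0≤K) 0≤S)
        (λ n → +-nonneg (0≤R n) (*-nonneg (0≤R 0) (^-nonneg n 0≤ρ)))
        (vanishing-+ (ζ-remainder-vanishes σ 0<θ)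
          (vanishing-*ˡ _ (0≤R 0) (λ n → ^-nonneg n 0≤ρ) (exp[-κ]^n-vanishes 0<κ)))

      euler-cauchy : ∀ {K φ} → Dominated K φ → ∀ m n → n ℕ.≤ m →
        ∣ euler m u m φ 1 - euler n u n φ 1 ∣ ≤ rate K n
      euler-cauchy {K} {φ} dom m n n≤m = ≡.subst
        (λ m → ∣ euler m u m φ 1 - euler n u n φ 1 ∣ ≤ rate K n) (ℕₚ.m+[n∸m]≡n n≤m) (go (m ℕ.∸ n))
        where
        0≤K′ : 0# ≤ K
        0≤K′ = 0≤K {φ = φ} dom
        go : ∀ d → ∣ euler (n ℕ.+ d) u (n ℕ.+ d) φ 1 - euler n u n φ 1 ∣ ≤ rate K n
        go d = ≤-trans
          -- The intermediate value has the larger truncation but only the first n factors.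
          (∣∣-mono (solve 3 (λ x y w → x :- w := (x :- y) :+ (y :- w)) refl _ (euler (n ℕ.+ d) u n φ 1) _))
          (≤-trans (∣x+y∣≤∣x∣+∣y∣ _ _) (≤-trans (+-mono-≤
            (≤-trans (euler-extend-n {φ = φ} dom (n ℕ.+ d) n d 1)
              (≤-trans (≤-reflexive (trans (*-congˡ (ν-1 σ)) (*-identityʳ _)))
              (*-monoˡ-≤ _ (*-nonneg 0≤growthBound 0≤K′) (*-monoˡ-≤ S 0≤S (ζ-bound σ 0<θ n d)))))
            (≤-trans (euler-extend-L {φ = φ} dom n d n 1)
              (≤-trans (≤-reflexive (trans (*-congˡ (ν-1 σ)) (*-identityʳ _)))
              (*-mono-≤ (*-nonneg (*-nonneg (0≤growth n) 0≤K′) (^-nonneg n 0≤ρ)) (*-nonneg 0≤S (0≤R 0))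
                (*-monoʳ-≤ _ (^-nonneg n 0≤ρ) (*-monoʳ-≤ K 0≤K′ (growth-bounded n)))
                (*-monoˡ-≤ S 0≤S (ζ-bound σ 0<θ 0 n))))))
          (≤-reflexive (solve 6 (λ b K S r q p → b :* K :* (S :* r) :+ b :* K :* p :* (S :* q)
            := b :* K :* S :* (r :+ q :* p)) refl _ K S _ _ _))))

      euler-converges : ∀ {K φ} → Dominated K φ → ∃[ x ] ConvergesTo (λ n → euler n u n φ 1) x
      euler-converges {K} {φ} dom = converges (λ n → euler n u n φ 1) (rate K)
        (rate-vanishes (0≤K {φ = φ} dom)) (euler-cauchy {φ = φ} dom)

    γ : ℕ → ℕ → Carrier
    γ L n = ∑ (suc L) (λ a → u n a * ν σ (2 ℕ.+ n) ^ a)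

    product : ℕ → ℕ → Carrier
    product L zero    = 1#
    product L (suc n) = γ L n * product L n

    abstract
      -- On the common eigenfunction `ν σ` of all dilations the operators act as scalars, so here
      -- the operator product is an honest product of numbers.
      euler-ν : ∀ L n m → euler L u n (ν σ) m ≈ product L n * ν σ m
      euler-ν L zero    m = sym (*-identityˡ _)
      euler-ν L (suc n) m = trans (op-cong L u n {euler L u n (ν σ)} (euler-ν L n) m) (trans
        (∑-cong (suc L) λ a → trans (*-congˡ (*-congˡ (ν-^* σ (2 ℕ.+ n) a m)))
          (solve 4 (λ u p q v → u :* (p :* (q :* v)) := u :* q :* (p :* v)) refl _ _ _ _))
        (trans (∑-*ʳ (suc L) _ _) (sym (*-assoc _ _ _))))

      ν-dominated : Dominated 1# (ν σ)
      ν-dominated m = ≤-reflexive (trans (0≤x⇒∣x∣≈x (ν-nonneg σ m)) (sym (*-identityˡ _)))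

      1-Sz≤γ : ∀ L n → 1# - S * z n ≤ γ L n
      1-Sz≤γ L n = ≤-trans
        (≤-trans (≤-reflexive (trans (+-congˡ (-‿cong (sym (trans (*-congˡ (ν-1 σ))
            (trans (*-identityʳ _) (*-identityˡ _)))))) (+-comm _ _)))
          (+-mono-≤ (∣x∣≤y⇒ (op-near-id {φ = ν σ} ν-dominated L n 1)) (≤-reflexive (sym (ν-1 σ)))))
        (≤-reflexive (trans (solve 2 (λ x y → x :- y :+ y := x) refl _ _)
          (∑-cong (suc L) λ a → *-congˡ (trans (ν-^* σ (2 ℕ.+ n) a 1)
            (trans (*-congˡ (ν-1 σ)) (*-identityʳ _))))))

      -- (1 - x₁)⋯(1 - x_d) ≥ 1 - (x₁ + ⋯ + x_d)
      product-tail : ∀ {L n η} → 0# ≤ η → η ≤ product L n →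
        (∀ d → 0# ≤ 1# - S * ∑ d (λ a → z (n ℕ.+ a))) →
        ∀ d → η * (1# - S * ∑ d (λ a → z (n ℕ.+ a))) ≤ product L (n ℕ.+ d)
      product-tail {L} {n} {η} 0≤η η≤p small zero rewrite ℕₚ.+-identityʳ n =
        ≤-trans (≤-reflexive (solve 2 (λ η S → η :* (con (+ 1) :- S :* con (+ 0)) := η) refl η S)) η≤p
      product-tail {L} {n} {η} 0≤η η≤p small (suc d) rewrite ℕₚ.+-suc n d = ≤-trans
        (≤-diff (η * (S * z (n ℕ.+ d) * (S * s))) (*-nonneg 0≤η (*-nonneg (0≤Sz (n ℕ.+ d))
            (*-nonneg 0≤S (∑-nonneg d λ a → 0≤z (n ℕ.+ a)))))
          (solve 4 (λ η S s z → (con (+ 1) :- S :* z) :* (η :* (con (+ 1) :- S :* s))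
            := η :* (con (+ 1) :- S :* (s :+ z)) :+ η :* (S :* z :* (S :* s))) refl η S s _))
        (*-mono-≤ 0≤1-Sz (≤-trans (*-nonneg 0≤η (small d)) ih) (1-Sz≤γ L (n ℕ.+ d)) ih)
        where
        s : Carrier
        s = ∑ d (λ a → z (n ℕ.+ a))
        ih : η * (1# - S * ∑ d (λ a → z (n ℕ.+ a))) ≤ product L (n ℕ.+ d)
        ih = product-tail {L} {n} {η} 0≤η η≤p small d
        0≤1-Sz : 0# ≤ 1# - S * z (n ℕ.+ d)
        0≤1-Sz = ≤-trans (small (suc d)) (≤-diff (S * s)
          (*-nonneg 0≤S (∑-nonneg d λ a → 0≤z (n ℕ.+ a)))
          (solve 3 (λ S s z → con (+ 1) :- S :* z := con (+ 1) :- S :* (s :+ z) :+ S :* s) refl S s _))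

      product-initial : (∀ n → ∃[ η ] (0# < η × ∃[ L₀ ] ∀ L → L₀ ℕ.≤ L → η ≤ γ L n)) →
        ∀ n → ∃[ η ] (0# < η × ∃[ L₀ ] ∀ L → L₀ ℕ.≤ L → η ≤ product L n)
      product-initial h zero    = 1# , 0<1 , 0 , λ L _ → ≤-refl
      product-initial h (suc n) with h n | product-initial h n
      ... | η , 0<η , L₀ , f | η′ , 0<η′ , L₀′ , g = η * η′ , *-pos 0<η 0<η′ , L₀ ℕ.+ L₀′ , λ L L₀≤L →
        *-mono-≤ (<⇒≤ 0<η) (≤-trans (<⇒≤ 0<η′) (g L (ℕₚ.m+n≤o⇒n≤o L₀ L₀≤L)))
          (f L (ℕₚ.m+n≤o⇒m≤o L₀ L₀≤L)) (g L (ℕₚ.m+n≤o⇒n≤o L₀ L₀≤L))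

      -- From an index n₀ on, S Σ z < 1/2, so the remaining factors contribute at least 1/2. The
      -- first n₀ factors may be too far from 1 for such an estimate, and there the hypothesis
      -- supplies a lower bound for each of them.
      eulerProduct-pos : (∀ n → ∃[ η ] (0# < η × ∃[ L₀ ] ∀ L → L₀ ℕ.≤ L → η ≤ γ L n)) →
        ∀ {x} → ConvergesTo (λ n → euler n u n (ν σ) 1) x → 0# < x
      eulerProduct-pos h {x} lim =
        let n₀ , SR<½ = vanishing-*ˡ S 0≤S 0≤R (ζ-remainder-vanishes σ 0<θ) ½ 0<½
            η , 0<η , L₀ , η≤p = product-initial h n₀
            small : ∀ d → ½ ≤ 1# - S * ∑ d (λ a → z (n₀ ℕ.+ a))
            small d = ≤-trans (≤-reflexive (trans (solve 1 (λ h → h := h :+ h :- h) refl ½) (+-congʳ ½+½≈1)))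
              (+-mono-≤ ≤-refl (neg-mono-≤ (≤-trans (*-monoˡ-≤ S 0≤S (ζ-bound σ 0<θ n₀ d))
                (<⇒≤ (SR<½ n₀ ℕₚ.≤-refl)))))
            tail : ∀ L d → L₀ ℕ.≤ L → η * ½ ≤ product L (n₀ ℕ.+ d)
            tail L d L₀≤L = ≤-trans (*-monoˡ-≤ η (<⇒≤ 0<η) (small d))
              (product-tail {L} {n₀} {η} (<⇒≤ 0<η) (η≤p L L₀≤L) (λ d → ≤-trans (<⇒≤ 0<½) (small d)) d)
        in <-≤-trans (*-pos 0<η 0<½) (lim-≥ (n₀ ℕ.+ L₀) lim λ n n₀+L₀≤n → ≤-trans
          (≡.subst (λ m → η * ½ ≤ product n m) (ℕₚ.m+[n∸m]≡n (ℕₚ.m+n≤o⇒m≤o n₀ n₀+L₀≤n))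
            (tail n (n ℕ.∸ n₀) (ℕₚ.m+n≤o⇒n≤o n₀ n₀+L₀≤n)))
          (≤-reflexive (sym (trans (euler-ν n n 1) (trans (*-congˡ (ν-1 σ)) (*-identityʳ _))))))

-- The local factor t(x) (1 - x) (1 - x²)^l: vanishing coefficients, growth and positivity.

module LocalFactors {c ℓ₁ ℓ₂} (ℝ : RealNumbers c ℓ₁ ℓ₂) where
  open RealNumbers ℝ hiding (zero)
  open FieldProperties ℝ
  open Sums ℝ
  open Limits ℝ
  open Exponential ℝ
  open Sieve ℝ
  open Powers ℝ
  open EulerProducts ℝ
  open Solver using (solve; _:=_; _:+_; _:*_; _:-_; :-_; con)

  -- κ₀ = (ln 2)/6, so that 2^(-1/3) = ρ₀²
  κ₀ : Carrier
  κ₀ = ½ * (⅓ * ln 2)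

  ρ₀ E₀ : Carrier
  ρ₀ = exp (- κ₀)
  E₀ = exp κ₀

  abstract
    0<κ₀ : 0# < κ₀
    0<κ₀ = *-pos 0<½ (*-pos 0<⅓ 0<ln-2)

    0≤ρ₀ : 0# ≤ ρ₀
    0≤ρ₀ = exp-nonneg _

    ρ₀<1 : ρ₀ < 1#
    ρ₀<1 = exp[-x]<1 0<κ₀

    0≤E₀ : 0# ≤ E₀
    0≤E₀ = exp-nonneg _

    1≤E₀ : 1# ≤ E₀
    1≤E₀ = ≤-trans (≤-diff κ₀ (<⇒≤ 0<κ₀) refl) (1+x≤exp[x] κ₀)

    E₀*ρ₀ : E₀ * ρ₀ ≈ 1#
    E₀*ρ₀ = exp-+-neg κ₀

    1≤E₀^ : ∀ a → 1# ≤ E₀ ^ a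
    1≤E₀^ zero    = ≤-refl
    1≤E₀^ (suc a) = ≤-trans (≤-reflexive (sym (*-identityˡ 1#))) (*-mono-≤ 0≤1
      (≤-trans 0≤1 (1≤E₀^ a)) 1≤E₀ (1≤E₀^ a))

    E₀^-suc : ∀ a → E₀ ^ a ≤ E₀ ^ suc a
    E₀^-suc a = ≤-trans (≤-reflexive (sym (*-identityˡ _)))
      (*-monoʳ-≤ _ (≤-trans 0≤1 (1≤E₀^ a)) 1≤E₀)

    ν≤ρ₀² : ∀ {σ} → ⅓ ≤ σ → ∀ n → ν σ (2 ℕ.+ n) ≤ ρ₀ * ρ₀
    ν≤ρ₀² {σ} ⅓≤σ n = ≤-trans (ν-antitoneʳ {σ} {1} {suc n} (≤-trans (<⇒≤ 0<⅓) ⅓≤σ) (s≤s z≤n))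
      (≤-trans (ν-antitoneˡ ⅓≤σ 2) (≤-reflexive (trans
        (exp-cong (trans (-‿cong (sym (half+half (⅓ * ln 2)))) (sym (-‿+-comm _ _)))) (exp-+ _ _))))

    E₀^*ρ₀² : ∀ a → E₀ ^ a * (ρ₀ * ρ₀) ^ a ≈ ρ₀ ^ a
    E₀^*ρ₀² zero    = *-identityˡ 1#
    E₀^*ρ₀² (suc a) = trans
      (solve 4 (λ e r x y → e :* x :* (r :* r :* y) := (e :* r) :* (r :* (x :* y))) refl E₀ ρ₀ _ _)
      (trans (*-congʳ E₀*ρ₀) (trans (*-identityˡ _) (*-congˡ (E₀^*ρ₀² a))))

    E₀^*x^≤ρ₀^ : ∀ {x} → 0# ≤ x → x ≤ ρ₀ * ρ₀ → ∀ a → E₀ ^ a * x ^ a ≤ ρ₀ ^ a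
    E₀^*x^≤ρ₀^ 0≤x x≤ρ₀² a = ≤-trans
      (*-monoˡ-≤ _ (≤-trans 0≤1 (1≤E₀^ a)) (^-mono-≤ a 0≤x x≤ρ₀²)) (≤-reflexive (E₀^*ρ₀² a))

    𝟙-idem : ∀ {a} {A : Set a} (A? : Dec A) → 𝟙 A? * 𝟙 A? ≈ 𝟙 A?
    𝟙-idem (yes _) = *-identityˡ 1#
    𝟙-idem (no _)  = zeroˡ 0#

    0≤𝟙 : ∀ {a} {A : Set a} (A? : Dec A) → 0# ≤ 𝟙 A?
    0≤𝟙 (yes _) = 0≤1
    0≤𝟙 (no _)  = ≤-refl

    𝟙≤1 : ∀ {a} {A : Set a} (A? : Dec A) → 𝟙 A? ≤ 1#
    𝟙≤1 (yes _) = ≤-refl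
    𝟙≤1 (no _)  = 0≤1

    0≤ω : ∀ n → 0# ≤ 𝟙prime n
    0≤ω n = 0≤𝟙 (prime₂? n)

    ω≤1 : ∀ n → 𝟙prime n ≤ 1#
    ω≤1 n = 𝟙≤1 (prime₂? n)

  -- E₀ = 2^(1/6) exceeds 1, yet at x ≤ 2^(-1/3) coefficients of this size still give a geometric
  -- series, with ratio E₀ ρ₀² = ρ₀ < 1.
  Growth : (ℕ → ℕ → Carrier) → Set _
  Growth u = ∃[ V ] (0# ≤ V × (∀ n a → ∣ u n a ∣ ≤ V * E₀ ^ a))

  Mulω : ℕ → (ℕ → ℕ → Carrier) → ℕ → ℕ → Carrier
  Mulω k u n = Mul k (𝟙prime n) (u n)

  abstract
    shr-growth : ∀ {V} k (u : ℕ → Carrier) → 0# ≤ V → (∀ a → ∣ u a ∣ ≤ V * E₀ ^ a) →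
                 ∀ a → ∣ shr k u a ∣ ≤ V * E₀ ^ a
    shr-growth zero    u 0≤V h a       = h a
    shr-growth (suc k) u 0≤V h zero    = ≤-trans (≤-reflexive ∣0∣≈0)
      (*-nonneg 0≤V 0≤1)
    shr-growth (suc k) u 0≤V h (suc a) = ≤-trans (shr-growth k u 0≤V h a)
      (*-monoˡ-≤ _ 0≤V (E₀^-suc a))

    Mul-growth : ∀ k u → Growth u → Growth (Mulω k u)
    Mul-growth k u (V , 0≤V , h) = V + V , +-nonneg 0≤V 0≤V , λ n a → ≤-trans (∣x-y∣≤∣x∣+∣y∣ _ _)
      (≤-trans (+-mono-≤ (h n a) (≤-trans (∣x*y∣≤∣x∣*∣y∣ _ _) (≤-trans
        (*-mono-≤ (0≤∣x∣ _) (*-nonneg 0≤V (≤-trans 0≤1 (1≤E₀^ a)))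
          (≤-trans (≤-reflexive (0≤x⇒∣x∣≈x (0≤ω n))) (ω≤1 n)) (shr-growth k (u n) 0≤V (h n) a))
        (≤-reflexive (*-identityˡ _)))))
      (≤-reflexive (sym (distribʳ _ _ _))))

    growth⇒cubeFull : ∀ u → Growth u → (∀ n → u n 0 ≈ 1#) → (∀ n → u n 1 ≈ 0#) → (∀ n → u n 2 ≈ 0#) →
                      CubeFull u
    growth⇒cubeFull u (V , 0≤V , h) u0 u1 u2 = record
      -- For exponent a + 3 the bound is V E₀³ x³ (E₀ x)^a ≤ V E₀³ x³ ρ₀^a, and E₀³ = E₀⁶ ρ₀³ turns
      -- ρ₀^a into ρ₀^(a+3). Exponents 1 and 2 contribute nothing, which is how the cube of x
      -- arises.
      { W = V * E⁶ ; κ = κ₀ ; 0≤W = *-nonneg 0≤V (^-nonneg 6 0≤E₀) ; 0<κ = 0<κ₀ ; u-0 = u0 ; u-bound = bound }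
      where
      E⁶ : Carrier
      E⁶ = E₀ ^ 6
      zero-bound : ∀ {x y W σ n} a → x ≈ 0# → 0# ≤ W →
        ∣ x ∣ * y ≤ W * cube (ν σ (2 ℕ.+ n)) * ρ₀ ^ a
      zero-bound {σ = σ} {n} a x≈0 0≤W = ≤-trans
        (≤-reflexive (trans (*-congʳ (trans (∣∣-cong x≈0) ∣0∣≈0)) (zeroˡ _)))
        (*-nonneg (*-nonneg 0≤W (cube-nonneg (ν-nonneg σ (2 ℕ.+ n)))) (^-nonneg a 0≤ρ₀))
      E⁶ρ³ : E⁶ * (ρ₀ * (ρ₀ * ρ₀)) ≈ E₀ * (E₀ * E₀)
      E⁶ρ³ = trans (solve 2 (λ e r →
          e :* (e :* (e :* (e :* (e :* (e :* con (+ 1)))))) :* (r :* (r :* r))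
          := (e :* (e :* e)) :* ((e :* r) :* ((e :* r) :* (e :* r)))) refl E₀ ρ₀)
        (trans (*-congˡ (trans (*-cong E₀*ρ₀ (trans (*-cong E₀*ρ₀ E₀*ρ₀) (*-identityˡ 1#)))
          (*-identityˡ 1#))) (*-identityʳ _))
      bound : ∀ σ → ⅓ ≤ σ → ∀ n a → ∣ u n (suc a) ∣ * ν σ (2 ℕ.+ n) ^ suc a ≤
              V * E⁶ * cube (ν σ (2 ℕ.+ n)) * ρ₀ ^ suc a
      bound σ ⅓≤σ n zero          = zero-bound {σ = σ} {n} 1 (u1 n) (*-nonneg 0≤V (^-nonneg 6 0≤E₀))
      bound σ ⅓≤σ n (suc zero)    = zero-bound {σ = σ} {n} 2 (u2 n) (*-nonneg 0≤V (^-nonneg 6 0≤E₀))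
      bound σ ⅓≤σ n (suc (suc a)) = ≤-trans
        (*-monoʳ-≤ _ (^-nonneg (3 ℕ.+ a) 0≤x) (h n (3 ℕ.+ a)))
        (≤-trans (≤-reflexive (solve 5 (λ V e x p q →
            V :* (e :* (e :* (e :* p))) :* (x :* (x :* (x :* q)))
            := V :* (e :* (e :* e)) :* (x :* (x :* x)) :* (p :* q)) refl V E₀ x _ _))
        (≤-trans (*-monoˡ-≤ _ (*-nonneg (*-nonneg 0≤V (*-nonneg 0≤E₀ (*-nonneg 0≤E₀ 0≤E₀)))
            (cube-nonneg 0≤x)) (E₀^*x^≤ρ₀^ 0≤x (ν≤ρ₀² ⅓≤σ n) a))
        (≤-reflexive (trans (*-congʳ (*-congʳ (*-congˡ (sym E⁶ρ³))))
          (solve 5 (λ V e x r p → V :* (e :* (r :* (r :* r))) :* x :* p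
            := V :* e :* x :* (r :* (r :* (r :* p)))) refl V E⁶ _ ρ₀ _)))))
        where
        x : Carrier
        x = ν σ (2 ℕ.+ n)
        0≤x : 0# ≤ x
        0≤x = ν-nonneg σ (2 ℕ.+ n)

  PosSeries : (ℕ → Carrier) → Carrier → Set _
  PosSeries u x = ∃[ T ] (0# < T × ConvergesTo (λ L → ∑ L (λ a → u a * x ^ a)) T)

  abstract
    shr-series : ∀ k {u x T} → ConvergesTo (λ L → ∑ L (λ a → u a * x ^ a)) T →
      ConvergesTo (λ L → ∑ L (λ a → shr k u a * x ^ a)) (x ^ k * T)
    shr-series zero    lim = lim-cong (λ _ → refl) (sym (*-identityˡ _)) lim
    shr-series (suc k) {u} {x} lim = lim-unsuc (lim-cong
      (λ L → sym (trans (∑-head L _) (trans (+-cong (zeroˡ _) (trans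
        (∑-cong L λ a → solve 3 (λ s x p → s :* (x :* p) := x :* (s :* p)) refl _ x _)
        (∑-*ˡ L x _))) (+-identityˡ _))))
      (sym (*-assoc _ _ _)) (lim-*ˡ x (shr-series k lim)))

    -- The value is multiplied by 1 - ω x^(k+1), which is positive as ω ≤ 1 and x < 1. Thus
    -- positivity passes from t(x), whose coefficients are nonnegative, to the local factor, whose
    -- coefficients may change sign.
    Mul-series : ∀ k n {u x} → 0# ≤ x → x < 1# → PosSeries u x →
                 PosSeries (Mul (suc k) (𝟙prime n) u) x
    Mul-series k n {u} {x} 0≤x x<1 (T , 0<T , lim) =
        (1# - ω * x ^ suc k) * T
      , *-pos (0<y-x ωx<1) 0<T
      , lim-cong
          (λ L → sym (trans (∑-cong L λ a →
              solve 4 (λ u w s p → (u :- w :* s) :* p := u :* p :- w :* (s :* p)) refl _ ω _ _)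
            (trans (∑-sub L _ _) (+-congˡ (-‿cong (∑-*ˡ L ω _))))))
          (solve 3 (λ t w p → t :- w :* (p :* t) := (con (+ 1) :- w :* p) :* t) refl T ω _)
          (lim-sub lim (lim-*ˡ ω (shr-series (suc k) lim)))
      where
      ω : Carrier
      ω = 𝟙prime n
      ωx<1 : ω * x ^ suc k < 1#
      ωx<1 = ≤-<-trans
        (≤-trans (*-mono-≤ (0≤ω n) 0≤x (ω≤1 n) (≤-trans
            (*-monoˡ-≤ x 0≤x (^-≤1 k 0≤x (<⇒≤ x<1))) (≤-reflexive (*-identityʳ x))))
          (≤-reflexive (*-identityˡ x))) x<1

    series-pos : ∀ {V} (u : ℕ → Carrier) {x} → 0# ≤ V → (∀ a → ∣ u a ∣ ≤ V * E₀ ^ a) →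
      (∀ a → 0# ≤ u a) → u 0 ≈ 1# → 0# ≤ x → x ≤ ρ₀ * ρ₀ → PosSeries u x
    series-pos {V} u {x} 0≤V h 0≤u u0≈1 0≤x x≤ρ₀² = T
      , <-≤-trans 0<1 (lim-≥ 1 lim 1≤)
      , lim
      where
      G : Carrier
      G = inverse (0<y-x ρ₀<1)
      0≤G : 0# ≤ G
      0≤G = <⇒≤ (inverse-pos _)
      term : ∀ a → ∣ u a * x ^ a ∣ ≤ V * ρ₀ ^ a
      term a = ≤-trans (∣x*y∣≤∣x∣*∣y∣ _ _) (≤-trans
        (*-mono-≤ (0≤∣x∣ _) (^-nonneg a 0≤x) (h a) (≤-reflexive (0≤x⇒∣x∣≈x (^-nonneg a 0≤x))))
        (≤-trans (≤-reflexive (*-assoc _ _ _)) (*-monoˡ-≤ V 0≤V (E₀^*x^≤ρ₀^ 0≤x x≤ρ₀² a))))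
      tail : ∀ n d → ∣ ∑ (n ℕ.+ d) (λ a → u a * x ^ a) - ∑ n (λ a → u a * x ^ a) ∣ ≤ V * G * ρ₀ ^ n
      tail n d = ≤-trans
        (∣∣-mono (trans (+-congʳ (∑-split n d _)) (solve 2 (λ x y → x :+ y :- x := y) refl _ _)))
        (≤-trans (∑-∣∣ d _) (≤-trans
          (∑-mono d λ a → ≤-trans (term (n ℕ.+ a)) (≤-reflexive (trans (*-congˡ (^-homo-* ρ₀ n a))
            (sym (*-assoc _ _ _)))))
          (≤-trans (≤-reflexive (∑-*ˡ d _ _)) (≤-trans
            (*-monoˡ-≤ _ (*-nonneg 0≤V (^-nonneg n 0≤ρ₀)) (geometric-≤ ρ₀<1 0≤ρ₀ d))
            (≤-reflexive (solve 3 (λ V r G → V :* r :* G := V :* G :* r) refl V _ G))))))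
      conv : ∃[ T ] ConvergesTo (λ L → ∑ L (λ a → u a * x ^ a)) T
      conv = converges _ (λ n → V * G * ρ₀ ^ n)
        (vanishing-*ˡ _ (*-nonneg 0≤V 0≤G) (λ n → ^-nonneg n 0≤ρ₀) (exp[-κ]^n-vanishes 0<κ₀))
        λ m n n≤m → ≡.subst (λ m → ∣ ∑ m (λ a → u a * x ^ a) - ∑ n (λ a → u a * x ^ a) ∣ ≤ V * G * ρ₀ ^ n)
          (ℕₚ.m+[n∸m]≡n n≤m) (tail n (m ℕ.∸ n))
      T : Carrier
      T = proj₁ conv
      lim : ConvergesTo (λ L → ∑ L (λ a → u a * x ^ a)) T
      lim = proj₂ conv
      1≤ : ∀ L → 1 ℕ.≤ L → 1# ≤ ∑ L (λ a → u a * x ^ a)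
      1≤ L 1≤L = ≤-trans (≤-reflexive (sym (trans (*-identityʳ (u 0)) u0≈1)))
        (≤∑ L (λ a → *-nonneg (0≤u a) (^-nonneg a 0≤x)) 0 1≤L)

  -- The coefficients of t(x) (1 - x) (1 - x²)^l at the primes, and of 1 at the composite numbers.
  squarePart : (ℕ → Carrier) → ℕ → ℕ → ℕ → Carrier
  squarePart t zero    = atPrimes t
  squarePart t (suc l) = Mulω 2 (squarePart t l)

  localFactor : (ℕ → Carrier) → ℕ → ℕ → ℕ → Carrier
  localFactor t l = Mulω 1 (squarePart t l)

  module _ (t : ℕ → Carrier) (0≤t : ∀ a → 0# ≤ t a) (t0≈1 : t 0 ≈ 1#) (t1≈1 : t 1 ≈ 1#)
           (l : ℕ) (t2≈1+l : t 2 ≈ fromℕ (suc l))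
           (V : Carrier) (0≤V : 0# ≤ V) (t-growth : ∀ a → ∣ t a ∣ ≤ V * E₀ ^ a) where

    abstract
      atPrimes-0 : ∀ n → atPrimes t n 0 ≈ 1#
      atPrimes-0 n with prime₂? n
      ... | yes _ = t0≈1
      ... | no  _ = refl

      atPrimes-1 : ∀ n → atPrimes t n 1 ≈ 𝟙prime n
      atPrimes-1 n with prime₂? n
      ... | yes _ = t1≈1
      ... | no  _ = refl

      atPrimes-2 : ∀ n → atPrimes t n 2 ≈ 𝟙prime n * fromℕ (suc l)
      atPrimes-2 n with prime₂? n
      ... | yes _ = trans t2≈1+l (sym (*-identityˡ _))
      ... | no  _ = sym (zeroˡ _)

      0≤atPrimes : ∀ n a → 0# ≤ atPrimes t n a
      0≤atPrimes n a with prime₂? n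
      ... | yes _ = 0≤t a
      0≤atPrimes n zero    | no _ = 0≤1
      0≤atPrimes n (suc a) | no _ = ≤-refl

      atPrimes-bound : ∀ n a → ∣ atPrimes t n a ∣ ≤ (V + 1#) * E₀ ^ a
      atPrimes-bound n a with prime₂? n
      ... | yes _ = ≤-trans (t-growth a) (*-monoʳ-≤ _ (≤-trans 0≤1 (1≤E₀^ a)) (≤-diff 1# 0≤1 refl))
      ... | no  _ = ≤-trans (δ-bound a) (≤-trans (1≤E₀^ a) (≤-trans (≤-reflexive (sym (*-identityˡ _)))
          (*-monoʳ-≤ _ (≤-trans 0≤1 (1≤E₀^ a)) (≤-diff V 0≤V (+-comm _ _)))))
        where
        δ-bound : ∀ a → ∣ δ a ∣ ≤ 1#
        δ-bound zero    = ≤-reflexive (0≤x⇒∣x∣≈x 0≤1)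
        δ-bound (suc a) = ≤-trans (≤-reflexive ∣0∣≈0) 0≤1

      atPrimes-growth : Growth (atPrimes t)
      atPrimes-growth = V + 1# , +-nonneg 0≤V 0≤1 , atPrimes-bound

      squarePart-0 : ∀ m n → squarePart t m n 0 ≈ 1#
      squarePart-0 zero    n = atPrimes-0 n
      squarePart-0 (suc m) n = trans (solve 2 (λ u w → u :- w :* con (+ 0) := u) refl _ (𝟙prime n))
        (squarePart-0 m n)

      squarePart-1 : ∀ m n → squarePart t m n 1 ≈ 𝟙prime n
      squarePart-1 zero    n = atPrimes-1 n
      squarePart-1 (suc m) n = trans (solve 2 (λ u w → u :- w :* con (+ 0) := u) refl _ (𝟙prime n))
        (squarePart-1 m n)

      -- Each factor 1 - x² lowers the coefficient of x² by one at a prime. After l of them it is 1,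
      -- the same as the coefficient of x, and the last factor 1 - x cancels both.
      squarePart-2 : ∀ m n → squarePart t m n 2 ≈ 𝟙prime n * (fromℕ (suc l) - fromℕ m)
      squarePart-2 zero    n = trans (atPrimes-2 n)
        (*-congˡ (solve 1 (λ x → x := x :- con (+ 0)) refl _))
      squarePart-2 (suc m) n = trans (+-cong (squarePart-2 m n) (-‿cong (*-congˡ (squarePart-0 m n))))
        (solve 3 (λ w x m → w :* (x :- m) :- w :* con (+ 1) := w :* (x :- (con (+ 1) :+ m))) refl _ _ _)

      squarePart-growth : ∀ m → Growth (squarePart t m)
      squarePart-growth zero    = atPrimes-growth
      squarePart-growth (suc m) = Mul-growth 2 (squarePart t m) (squarePart-growth m)

      localFactor-cubeFull : CubeFull (localFactor t l)
      localFactor-cubeFull = growth⇒cubeFull (localFactor t l)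
        (Mul-growth 1 (squarePart t l) (squarePart-growth l))
        (λ n → trans (solve 2 (λ u w → u :- w :* con (+ 0) := u) refl _ (𝟙prime n)) (squarePart-0 l n))
        (λ n → trans (+-cong (squarePart-1 l n) (-‿cong (*-congˡ (squarePart-0 l n))))
          (solve 1 (λ w → w :- w :* con (+ 1) := con (+ 0)) refl _))
        (λ n → trans (+-cong (squarePart-2 l n) (-‿cong (trans (*-congˡ (squarePart-1 l n))
            (𝟙-idem (prime₂? n)))))
          (solve 2 (λ w l → w :* (con (+ 1) :+ l :- l) :- w := con (+ 0)) refl _ (fromℕ l)))

      squarePart-series : ∀ {x} → 0# ≤ x → x ≤ ρ₀ * ρ₀ → x < 1# → ∀ m n → PosSeries (squarePart t m n) x
      squarePart-series 0≤x x≤ρ₀² x<1 zero    n = series-pos (atPrimes t n) (+-nonneg 0≤V 0≤1)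
        (atPrimes-bound n) (0≤atPrimes n) (atPrimes-0 n) 0≤x x≤ρ₀²
      squarePart-series 0≤x x≤ρ₀² x<1 (suc m) n = Mul-series 1 n 0≤x x<1 (squarePart-series 0≤x x≤ρ₀² x<1 m n)

      localFactor-pos : ∀ {σ} → ⅓ ≤ σ → ∀ n → ∃[ η ] (0# < η × ∃[ L₀ ] ∀ L → L₀ ℕ.≤ L →
        η ≤ ∑ (suc L) (λ a → localFactor t l n a * ν σ (2 ℕ.+ n) ^ a))
      localFactor-pos {σ} ⅓≤σ n =
        let x<1 = ≤-<-trans (ν≤ρ₀² ⅓≤σ n) (≤-<-trans
              (≤-trans (*-monoˡ-≤ ρ₀ 0≤ρ₀ (<⇒≤ ρ₀<1)) (≤-reflexive (*-identityʳ ρ₀))) ρ₀<1)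
            T , 0<T , lim = Mul-series 0 n (ν-nonneg σ (2 ℕ.+ n)) x<1
              (squarePart-series (ν-nonneg σ (2 ℕ.+ n)) (ν≤ρ₀² ⅓≤σ n) x<1 l n)
            L₀ , T/2≤ = lim-eventually-≥ lim (<-diff (½ * T) (half-pos 0<T) (sym (half+half T)))
        in ½ * T , half-pos 0<T , L₀ , λ L L₀≤L → T/2≤ (suc L) (ℕₚ.m≤n⇒m≤1+n L₀≤L)

  𝔱-coefficient : ℕ → ℕ → Carrier
  𝔱-coefficient k zero    = 1#
  𝔱-coefficient k (suc a) = fromℕ (𝔱 k (suc a))

  abstract
    fromℕ-^ : ∀ m n → fromℕ (m ℕ.^ n) ≈ fromℕ m ^ n
    fromℕ-^ m zero    = +-identityʳ 1#
    fromℕ-^ m (suc n) = trans (fromℕ-* m (m ℕ.^ n)) (*-congˡ (fromℕ-^ m n))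

    𝔱-growth : ∀ k → ∃[ V ] (0# ≤ V × (∀ a → ∣ 𝔱-coefficient k a ∣ ≤ V * E₀ ^ a))
    𝔱-growth k =
      -- Half of κ₀ is used because the base is 2a + 1: exp(κ₀ (2a + 1)/2) = exp(κ₀/2) E₀^a. The
      -- final `C + 1#` also covers the coefficient 1 at a = 0.
      let K , 0≤K , h = x^n≤K*exp[κ*x] (2 ℕ.* k) (½ * κ₀) (half-pos 0<κ₀)
          C = K * exp (½ * κ₀)
          0≤C = *-nonneg 0≤K (exp-nonneg _)
          bound : ∀ a → fromℕ (𝔱 k a) ≤ C * E₀ ^ a
          bound a = ≤-trans (fromℕ-mono (GaussianDivisors.𝔱-bound k a)) (≤-trans
            (≤-reflexive (trans (reflexive (≡.cong fromℕ (square (suc (2 ℕ.* a)))))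
              (fromℕ-^ (suc (2 ℕ.* a)) (2 ℕ.* k))))
            (≤-trans (h _ (fromℕ-nonneg (suc (2 ℕ.* a)))) (≤-reflexive (trans
              (*-congˡ (trans (exp-cong (trans (*-congˡ (fromℕ-double a))
                (trans (solve 2 (λ h a → h :* (con (+ 1) :+ (a :+ a)) := h :+ a :* (h :+ h)) refl _ _)
                  (+-congˡ (*-congˡ (half+half κ₀))))))
                (trans (exp-+ _ _) (*-congˡ (exp-fromℕ κ₀ a)))))
              (sym (*-assoc _ _ _))))))
      in C + 1# , +-nonneg 0≤C 0≤1 , λ
        { zero    → ≤-trans (≤-reflexive (0≤x⇒∣x∣≈x 0≤1)) (≤-diff C 0≤C
                      (solve 1 (λ c → (c :+ con (+ 1)) :* con (+ 1) := con (+ 1) :+ c) refl C))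
        ; (suc a) → ≤-trans (≤-reflexive (0≤x⇒∣x∣≈x (fromℕ-nonneg (𝔱 k (suc a))))) (≤-trans (bound (suc a))
                      (*-monoʳ-≤ _ (≤-trans 0≤1 (1≤E₀^ (suc a))) (≤-diff 1# 0≤1 refl))) }
      where
      square : ∀ s → (s ℕ.* s) ℕ.^ k ≡ s ℕ.^ (2 ℕ.* k)
      square s = ≡.trans (≡.cong (λ q → (s ℕ.* q) ℕ.^ k) (≡.sym (ℕₚ.*-identityʳ s))) (ℕₚ.^-*-assoc s 2 k)
      fromℕ-double : ∀ a → fromℕ (suc (2 ℕ.* a)) ≈ 1# + (fromℕ a + fromℕ a)
      fromℕ-double a = +-congˡ (trans (fromℕ-+ a (a ℕ.+ 0)) (+-congˡ (reflexive (≡.cong fromℕ (ℕₚ.+-identityʳ a)))))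

    0≤𝔱-coefficient : ∀ k a → 0# ≤ 𝔱-coefficient k a
    0≤𝔱-coefficient k zero    = 0≤1
    0≤𝔱-coefficient k (suc a) = fromℕ-nonneg (𝔱 k (suc a))

    𝔱-coefficient-1 : ∀ k → 𝔱-coefficient k 1 ≈ 1#
    𝔱-coefficient-1 k = trans (reflexive (≡.cong fromℕ (GaussianDivisors.𝔱-1 k))) (+-identityʳ 1#)

-- The divisor count and the summatory function in terms of operators.

module Counting {c ℓ₁ ℓ₂} (ℝ : RealNumbers c ℓ₁ ℓ₂) where
  open RealNumbers ℝ hiding (zero)
  open FieldProperties ℝ
  open Sums ℝ
  open Sieve ℝ
  open LocalFactors ℝ
  open Solver using (solve; _:=_; _:+_; _:*_; _:-_; :-_; con)

  sumOver : ∀ {a} {A : Set a} → List A → (A → Carrier) → Carrier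
  sumOver []       f = 0#
  sumOver (x ∷ xs) f = f x + sumOver xs f

  abstract
    sumOver-cong : ∀ {a} {A : Set a} (xs : List A) {f g : A → Carrier} →
                   (∀ x → f x ≈ g x) → sumOver xs f ≈ sumOver xs g
    sumOver-cong []       f≈g = refl
    sumOver-cong (x ∷ xs) f≈g = +-cong (f≈g x) (sumOver-cong xs f≈g)

    sumOver-++ : ∀ {a} {A : Set a} (xs ys : List A) f →
                 sumOver (xs ++ ys) f ≈ sumOver xs f + sumOver ys f
    sumOver-++ []       ys f = sym (+-identityˡ _)
    sumOver-++ (x ∷ xs) ys f = trans (+-congˡ (sumOver-++ xs ys f)) (sym (+-assoc _ _ _))

    sumOver-map : ∀ {a b} {A : Set a} {B : Set b} (g : A → B) xs f →
                  sumOver (List.map g xs) f ≈ sumOver xs (f ∘ g)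
    sumOver-map g []       f = refl
    sumOver-map g (x ∷ xs) f = +-congˡ (sumOver-map g xs f)

    sumOver-product : ∀ {a b d} {A : Set a} {B : Set b} {D : Set d} (h : A → B → D) xs ys f →
      sumOver (cartesianProductWith h xs ys) f ≈ sumOver xs (λ x → sumOver ys (λ y → f (h x y)))
    sumOver-product h []       ys f = refl
    sumOver-product h (x ∷ xs) ys f = trans (sumOver-++ (List.map (h x) ys) _ f)
      (+-cong (sumOver-map (h x) ys f) (sumOver-product h xs ys f))

    sumOver-applyUpTo : ∀ {a} {A : Set a} (g : ℕ → A) n f → sumOver (applyUpTo g n) f ≈ ∑ n (f ∘ g)
    sumOver-applyUpTo g zero    f = refl
    sumOver-applyUpTo g (suc n) f =
      trans (+-congˡ (sumOver-applyUpTo (g ∘ suc) n f)) (sym (∑-head n (f ∘ g)))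

    sumOver-[1⋯] : ∀ N f → sumOver [1⋯ N ] f ≈ ∑₁ N f
    sumOver-[1⋯] N f = trans (sumOver-map suc (upTo N) f) (sumOver-applyUpTo id N (f ∘ suc))

    fromℕ-sum : ∀ xs → fromℕ (sum xs) ≈ sumOver xs fromℕ
    fromℕ-sum []       = refl
    fromℕ-sum (x ∷ xs) = trans (fromℕ-+ x (sum xs)) (+-congˡ (fromℕ-sum xs))

    fromℕ-length-filter : ∀ {a p} {A : Set a} {P : A → Set p} (P? : ∀ x → Dec (P x)) xs →
      fromℕ (length (filter P? xs)) ≈ sumOver xs (λ x → 𝟙 (P? x))
    fromℕ-length-filter P? []       = refl
    fromℕ-length-filter P? (x ∷ xs) with P? x
    ... | yes _ = +-congˡ (fromℕ-length-filter P? xs)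
    ... | no  _ = trans (fromℕ-length-filter P? xs) (sym (+-identityˡ _))

    fromℕ-summatory : ∀ f N → fromℕ (summatory f N) ≈ ∑₁ N (fromℕ ∘ f)
    fromℕ-summatory f N = trans (fromℕ-sum (List.map f [1⋯ N ]))
      (trans (sumOver-map f [1⋯ N ] fromℕ) (sumOver-[1⋯] N (fromℕ ∘ f)))

  unit : ℕ → ℕ → Carrier
  unit N m = 𝟙 ((1 ℕₚ.≤? m) ×-dec (m ℕₚ.≤? N))

  ζ₂^ : ℕ → ℕ → (ℕ → Carrier) → ℕ → Carrier
  ζ₂^ N zero    φ = φ
  ζ₂^ N (suc l) φ = ζ N 1 0 (ζ₂^ N l φ)

  squares : ∀ {l} → Vec ℕ l → ℕ
  squares ds = Vec.foldr′ ℕ._*_ 1 (Vec.map (ℕ._^ 2) ds)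

  abstract
    unit-supported : ∀ N → Supported N (unit N)
    unit-supported N m (inj₁ ≡.refl) = 𝟙-no ((1 ℕₚ.≤? 0) ×-dec (0 ℕₚ.≤? N)) λ { (() , _) }
    unit-supported N m (inj₂ N<m)    = 𝟙-no ((1 ℕₚ.≤? m) ×-dec (m ℕₚ.≤? N)) λ (_ , m≤N) → ℕₚ.<⇒≱ N<m m≤N

    ζ₂^-supported : ∀ {N φ} l → Supported N φ → Supported N (ζ₂^ N l φ)
    ζ₂^-supported         zero    φ-supp = φ-supp
    ζ₂^-supported {N} {φ} (suc l) φ-supp = ζ-supported {φ = ζ₂^ N l φ} 1 0 (ζ₂^-supported {φ = φ} l φ-supp)

    ≤/⇒*≤ : ∀ r N m .{{_ : NonZero m}} → r ℕ.≤ N ℕ./ m → r ℕ.* m ℕ.≤ N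
    ≤/⇒*≤ r N m r≤ = ℕₚ.≤-trans (ℕₚ.*-monoˡ-≤ m r≤) (ℕ/.m/n*n≤m N m)

    *≤⇒≤/ : ∀ r N m .{{_ : NonZero m}} → r ℕ.* m ℕ.≤ N → r ℕ.≤ N ℕ./ m
    *≤⇒≤/ r N m rm≤N = ℕₚ.≤-trans (ℕₚ.≤-reflexive (≡.sym (ℕ/.m*n/n≡m r m))) (ℕ/./-monoˡ-≤ m rm≤N)

    -- Reconciles the range up to N in `ζ` with the range up to ⌊N/m⌋ in the tuples: once x > N/m,
    -- the argument x^(k+1) q m exceeds N.
    ζ-truncate : ∀ {N φ} k → Supported N φ → ∀ m q → 0 ℕ.< q →
      ζ N k 0 φ (q ℕ.* suc m) ≈ ∑₁ (N ℕ./ suc m) (λ x → φ (x ℕ.^ suc k ℕ.* (q ℕ.* suc m)))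
    ζ-truncate {N} {φ} k φ-supp m q 0<q = trans
      (∑-cong N λ a → trans (*-congʳ (𝟙-yes (rough? 0 (suc a)) 2-rough)) (*-identityˡ _))
      (∑-extend {f = λ a → φ (suc a ℕ.^ suc k ℕ.* (q ℕ.* suc m))} (ℕ/.m/n≤m N (suc m))
        λ a N/m≤a → φ-supp _ (inj₂ (ℕₚ.<-≤-trans (ℕₚ.≰⇒> λ h → ℕₚ.<⇒≱ (s≤s N/m≤a) (*≤⇒≤/ (suc a) N (suc m) h))
          (ℕₚ.*-mono-≤ (ℕₚ.m≤m*n (suc a) (suc a ℕ.^ k) {{ℕₚ.m^n≢0 (suc a) k}})
            (ℕₚ.m≤n*m (suc m) q {{ℕ.>-nonZero 0<q}})))))

    𝟙-≡ : ∀ {r s M} → r ≡ s → 𝟙 (r ℕₚ.≤? M) ≈ 𝟙 (s ℕₚ.≤? M)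
    𝟙-≡ ≡.refl = refl

    -- `q` collects the product of the coordinates already fixed, so that the induction on `l` can
    -- peel off one square at a time.
    sumOver-tuples : ∀ N m l q → 0 ℕ.< q →
      sumOver (tuples l [1⋯ N ℕ./ suc m ]) (λ ds → 𝟙 (q ℕ.* squares ds ℕₚ.≤? N ℕ./ suc m)) ≈
      ζ₂^ N l (unit N) (q ℕ.* suc m)
    sumOver-tuples N m zero q 0<q = trans (+-identityʳ _) (𝟙-cong (q ℕ.* 1 ℕₚ.≤? N ℕ./ suc m)
      ((1 ℕₚ.≤? q ℕ.* suc m) ×-dec (q ℕ.* suc m ℕₚ.≤? N))
      (λ h → ℕₚ.≤-trans 0<q (ℕₚ.m≤m*n q (suc m))
           , ≤/⇒*≤ q N (suc m) (≡.subst (ℕ._≤ N ℕ./ suc m) (ℕₚ.*-identityʳ q) h))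
      (λ (_ , h) → ≡.subst (ℕ._≤ N ℕ./ suc m) (≡.sym (ℕₚ.*-identityʳ q)) (*≤⇒≤/ q N (suc m) h)))
    sumOver-tuples N m (suc l) q 0<q = trans
      (sumOver-product _∷_ [1⋯ M ] (tuples l [1⋯ M ]) _)
      (trans (sumOver-[1⋯] M _)
      (trans (∑-cong M λ a → trans
          (sumOver-cong (tuples l [1⋯ M ]) λ ds → 𝟙-≡ (≡.sym (ℕₚ.*-assoc q (suc a ℕ.^ 2) (squares ds))))
          (trans (sumOver-tuples N m l (q ℕ.* suc a ℕ.^ 2)
              (ℕₚ.<-≤-trans 0<q (ℕₚ.m≤m*n q (suc a ℕ.^ 2) {{ℕₚ.m^n≢0 (suc a) 2}})))
            (reflexive (≡.cong (ζ₂^ N l (unit N)) (eq (suc a ℕ.^ 2))))))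
        (sym (ζ-truncate {φ = ζ₂^ N l (unit N)} 1 (ζ₂^-supported {φ = unit N} l (unit-supported N)) m q 0<q))))
      where
      M : ℕ
      M = N ℕ./ suc m
      eq : ∀ p → q ℕ.* p ℕ.* suc m ≡ p ℕ.* (q ℕ.* suc m)
      eq p = ≡.trans (≡.cong (ℕ._* suc m) (ℕₚ.*-comm q p)) (ℕₚ.*-assoc p q (suc m))

  count : ℕ → ℕ → ℕ → Carrier
  count l N zero    = 0#
  count l N (suc m) = fromℕ (divisorCount l (N ℕ./ suc m))

  abstract
    -- Counting d₀ d₁² ⋯ d_l² ≤ N/m means applying the operator of ζ(s) ζ(2s)^l to the indicator of
    -- [1, N] and evaluating at m; the outer `ζ` is the sum over d₀.
    count≈ζ : ∀ l N m → count l N m ≈ ζ N 0 0 (ζ₂^ N l (unit N)) m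
    count≈ζ l N zero    = sym (ζ-supported {φ = ζ₂^ N l (unit N)} 0 0
      (ζ₂^-supported {φ = unit N} l (unit-supported N)) 0 (inj₁ ≡.refl))
    count≈ζ l N (suc m) = trans
      (fromℕ-length-filter (λ ds → weight ds ℕₚ.≤? M) (tuples (suc l) [1⋯ M ]))
      (trans (sumOver-product _∷_ [1⋯ M ] (tuples l [1⋯ M ]) _)
      (trans (sumOver-[1⋯] M _)
      (trans (∑-cong M λ a → trans (sumOver-tuples N m l (suc a) (s≤s z≤n))
        (reflexive (≡.cong (ζ₂^ N l (unit N)) (eq (suc a)))))
      (trans (sym (ζ-truncate {φ = ζ₂^ N l (unit N)} 0
          (ζ₂^-supported {φ = unit N} l (unit-supported N)) m 1 (s≤s z≤n)))
        (reflexive (≡.cong (ζ N 0 0 (ζ₂^ N l (unit N))) (ℕₚ.*-identityˡ (suc m))))))))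
      where
      M : ℕ
      M = N ℕ./ suc m
      eq : ∀ x → x ℕ.* suc m ≡ x ℕ.^ 1 ℕ.* (1 ℕ.* suc m)
      eq x = ≡.cong₂ ℕ._*_ (≡.sym (ℕₚ.*-identityʳ x)) (≡.sym (ℕₚ.*-identityˡ (suc m)))

    squarePart-ζ₂^ : ∀ {N L n} → N ℕ.≤ L → N ℕ.≤ n → ∀ t l {φ} → Supported N φ → ∀ m →
      euler L (squarePart t l) n (ζ₂^ N l φ) m ≈ euler L (atPrimes t) n φ m
    squarePart-ζ₂^             N≤L N≤n t zero        φ-supp m = refl
    squarePart-ζ₂^ {N} {L} {n} N≤L N≤n t (suc l) {φ} φ-supp m = trans
      (euler-Mul-ζ-end N≤L N≤n (squarePart t l) 1 {ζ₂^ N l φ} (ζ₂^-supported {φ = φ} l φ-supp) m)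
      (squarePart-ζ₂^ N≤L N≤n t l φ-supp m)

    -- Start from the Euler product of `τ` applied to the indicator of [1, N], then insert each
    -- ζ(2s) together with a factor 1 - x², and finally ζ(s) together with 1 - x. The inserted zeta
    -- operators turn the indicator into `count`.
    summatory-euler : ∀ {k τ} → IsτE k τ → ∀ l {N L n} → N ℕ.≤ L → N ℕ.≤ n →
      fromℕ (summatory τ N) ≈ euler L (localFactor (𝔱-coefficient k) l) n (count l N) 1
    summatory-euler {k} {τ} isτE l {N} {L} {n} N≤L N≤n = trans (fromℕ-summatory τ N) (trans
      (∑-cong< N λ a a<N → sym (trans (*-congˡ (𝟙-yes ((1 ℕₚ.≤? suc a) ×-dec (suc a ℕₚ.≤? N)) (s≤s z≤n , a<N)))
        (*-identityʳ _)))
      (trans (∑-multiplicative (fromℕ ∘ τ) t f1≈1 f-^* N≤L N≤n (unit-supported N))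
      (trans (sym (squarePart-ζ₂^ N≤L N≤n t l (unit-supported N) 1))
      (trans (sym (euler-Mul-ζ-end N≤L N≤n (squarePart t l) 0 {ζ₂^ N l (unit N)}
          (ζ₂^-supported {φ = unit N} l (unit-supported N)) 1))
        (euler-cong L (localFactor t l) n (λ m → sym (count≈ζ l N m)) 1)))))
      where
      open IsτE isτE
      open IsMultiplicative isMultiplicative
      t : ℕ → Carrier
      t = 𝔱-coefficient k
      f1≈1 : fromℕ (τ 1) ≈ 1#
      f1≈1 = trans (reflexive (≡.cong fromℕ f1≡1)) (+-identityʳ 1#)
      f-^* : ∀ {n} a x → Prime (2 ℕ.+ n) → (3 ℕ.+ n) Rough (suc x) →
             fromℕ (τ ((2 ℕ.+ n) ℕ.^ a ℕ.* suc x)) ≈ t a * fromℕ (τ (suc x))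
      f-^* zero x p r = trans (reflexive (≡.cong (fromℕ ∘ τ) (ℕₚ.*-identityˡ (suc x)))) (sym (*-identityˡ _))
      f-^* {n} (suc a) x p r = trans
        (reflexive (≡.cong fromℕ (≡.trans
          (f-* ((2 ℕ.+ n) ℕ.^ suc a) (suc x) (ℕₚ.m^n>0 (2 ℕ.+ n) (suc a)) (s≤s z≤n)
            (prime-^-coprime (suc a) p (rough-suc⇒∤ r)))
          (≡.cong (ℕ._* τ (suc x)) (primePower (2 ℕ.+ n) (suc a) p (s≤s z≤n))))))
        (fromℕ-* (𝔱 k (suc a)) (τ (suc x)))

-- Translated polynomials, with bounds for values and coefficients.

module Polynomials {c ℓ₁ ℓ₂} (ℝ : RealNumbers c ℓ₁ ℓ₂) where
  open RealNumbers ℝ hiding (zero)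
  open FieldProperties ℝ
  open Limits ℝ
  open Exponential ℝ
  open Sieve ℝ
  open Solver using (solve; _:=_; _:+_; _:*_; _:-_; :-_; con)

  horner : ∀ {n} → Vec Carrier n → Carrier → Carrier
  horner v x = Vec.foldr′ (λ a b → a + x * b) 0# v

  -- a + (x - h) w(x)
  mulAdd : ∀ {n} → Carrier → Carrier → Vec Carrier n → Vec Carrier (suc n)
  mulAdd h a []       = a ∷ []
  mulAdd h a (w ∷ ws) = (a - h * w) ∷ mulAdd h w ws

  -- Expanding v(x - h) in powers of x separates h = ln m, on which the operators act, from the
  -- fixed x.
  translate : ∀ {n} → Carrier → Vec Carrier n → Vec Carrier n
  translate h []      = []
  translate h (a ∷ v) = mulAdd h a (translate h v)

  abstract
    horner-cong : ∀ {n} (v : Vec Carrier n) {x y} → x ≈ y → horner v x ≈ horner v y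
    horner-cong []      x≈y = refl
    horner-cong (a ∷ v) x≈y = +-congˡ (*-cong x≈y (horner-cong v x≈y))

    horner-mulAdd : ∀ {n} h a (v : Vec Carrier n) x → horner (mulAdd h a v) x ≈ a + (x - h) * horner v x
    horner-mulAdd h a []      x = solve 3 (λ a x h → a :+ x :* con (+ 0) := a :+ (x :- h) :* con (+ 0)) refl a x h
    horner-mulAdd h a (w ∷ v) x = trans (+-congˡ (*-congˡ (horner-mulAdd h w v x)))
      (solve 5 (λ a h w x p → a :- h :* w :+ x :* (w :+ (x :- h) :* p)
        := a :+ (x :- h) :* (w :+ x :* p)) refl a h w x _)

    horner-translate : ∀ {n} h (v : Vec Carrier n) x → horner (translate h v) x ≈ horner v (x - h)
    horner-translate h []      x = refl
    horner-translate h (a ∷ v) x = trans (horner-mulAdd h a (translate h v) x)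
      (+-congˡ (*-congˡ (horner-translate h v x)))

    lookup-last-mulAdd : ∀ {n} h a (v : Vec Carrier n) →
      Vec.lookup (mulAdd h a v) (Fin.fromℕ n) ≡ Vec.lookup (a ∷ v) (Fin.fromℕ n)
    lookup-last-mulAdd h a []      = ≡.refl
    lookup-last-mulAdd h a (w ∷ v) = lookup-last-mulAdd h w v

    lookup-last-translate : ∀ {n} h (v : Vec Carrier (suc n)) →
      Vec.lookup (translate h v) (Fin.fromℕ n) ≡ Vec.lookup v (Fin.fromℕ n)
    lookup-last-translate         h (a ∷ [])    = ≡.refl
    lookup-last-translate {suc n} h (a ∷ b ∷ v) = ≡.trans
      (lookup-last-mulAdd h a (translate h (b ∷ v))) (lookup-last-translate h (b ∷ v))

    last≡lookup : ∀ {n} (v : Vec Carrier (suc n)) → Vec.last v ≡ Vec.lookup v (Fin.fromℕ n)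
    last≡lookup {zero}  (a ∷ []) = ≡.refl
    last≡lookup {suc n} (a ∷ v)  = last≡lookup v

    horner-uncons : ∀ {n} (v : Vec Carrier (suc n)) x →
      horner v x ≈ Vec.lookup v Fin.zero + x * horner (Vec.tail v) x
    horner-uncons (a ∷ v) x = refl

    lookup-tail : ∀ {n} (v : Vec Carrier (suc n)) j → Vec.lookup (Vec.tail v) j ≡ Vec.lookup v (Fin.suc j)
    lookup-tail (a ∷ v) j = ≡.refl

    horner-tabulate-cong : ∀ {n} {f g : Fin n → Carrier} → (∀ j → f j ≈ g j) → ∀ x →
      horner (Vec.tabulate f) x ≈ horner (Vec.tabulate g) x
    horner-tabulate-cong {zero}  f≈g x = refl
    horner-tabulate-cong {suc n} f≈g x =
      +-cong (f≈g Fin.zero) (*-congˡ (horner-tabulate-cong (λ j → f≈g (Fin.suc j)) x))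

    lim-horner : ∀ {n} {s : ℕ → Fin n → Carrier} {a : Fin n → Carrier} →
      (∀ j → ConvergesTo (λ m → s m j) (a j)) → ∀ x →
      ConvergesTo (λ m → horner (Vec.tabulate (s m)) x) (horner (Vec.tabulate a) x)
    lim-horner {zero}  s⟶a x = lim-const 0#
    lim-horner {suc n} s⟶a x = lim-+ (s⟶a Fin.zero) (lim-*ˡ x (lim-horner (λ j → s⟶a (Fin.suc j)) x))

    -- By linearity the operators act on each coefficient separately, so finitely many limits, all
    -- independent of `x`, describe the limiting polynomial.
    euler-horner : ∀ L u k {n} (w : ℕ → Carrier) (v : ℕ → Vec Carrier n) x m →
      euler L u k (λ y → w y * horner (v y) x) m ≈
      horner (Vec.tabulate λ j → euler L u k (λ y → w y * Vec.lookup (v y) j) m) x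
    euler-horner L u k {zero}  w v x m = trans
      (euler-cong L u k {ψ = λ y → 0# * w y} (λ y → trans (*-congˡ (empty (v y))) (*-comm _ _)) m)
      (trans (euler-*ˡ L u k 0# w m) (zeroˡ _))
      where
      empty : ∀ (v : Vec Carrier 0) → horner v x ≈ 0#
      empty [] = refl
    euler-horner L u k {suc n} w v x m = trans
      (euler-cong L u k {ψ = λ y → w y * Vec.lookup (v y) Fin.zero + x * (w y * horner (Vec.tail (v y)) x)}
        (λ y → trans (*-congˡ (horner-uncons (v y) x))
          (solve 4 (λ w a x h → w :* (a :+ x :* h) := w :* a :+ x :* (w :* h)) refl _ _ x _)) m)
      (trans (euler-+ L u k _ (λ y → x * (w y * horner (Vec.tail (v y)) x)) m)
      (+-congˡ (trans (euler-*ˡ L u k x (λ y → w y * horner (Vec.tail (v y)) x) m) (*-congˡ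
        (trans (euler-horner L u k w (Vec.tail ∘ v) x m) (horner-tabulate-cong
          (λ j → euler-cong L u k {λ y → w y * Vec.lookup (Vec.tail (v y)) j}
            {λ y → w y * Vec.lookup (v y) (Fin.suc j)}
            (λ y → *-congˡ (reflexive (lookup-tail (v y) j))) m) x))))))

    1≤exp-half : ∀ {κ r} → 0# < κ → 0# ≤ r → 1# ≤ exp (½ * κ * r)
    1≤exp-half 0<κ 0≤r = 1≤exp[κ*x] (<⇒≤ (half-pos 0<κ)) 0≤r

    linear-bound : ∀ {κ} (0<κ : 0# < κ) {a b r C} → 0# ≤ a → 0# ≤ C → 0# ≤ r → b ≤ C * exp (½ * κ * r) →
      a + r * b ≤ (a + inverse (half-pos 0<κ) * C) * exp (κ * r)
    linear-bound {κ} 0<κ {a} {b} {r} {C} 0≤a 0≤C 0≤r b≤ = ≤-trans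
      (+-mono-≤
        (≤-trans (≤-reflexive (sym (*-identityʳ a))) (*-monoˡ-≤ a 0≤a (1≤exp[κ*x] (<⇒≤ 0<κ) 0≤r)))
        (≤-trans (*-monoˡ-≤ r 0≤r b≤) (≤-trans
          (*-monoʳ-≤ _ (*-nonneg 0≤C (exp-nonneg _)) (x≤K*exp[κ*x] (half-pos 0<κ) r))
          (≤-reflexive (trans (solve 3 (λ w e C → w :* e :* (C :* e) := w :* C :* (e :* e)) refl _ _ C)
            (*-congˡ (exp-halves κ r)))))))
      (≤-reflexive (sym (distribʳ _ _ _)))

    -- Every polynomial is below every exponential: each Horner step spends half of the remaining
    -- exponent on its factor x.
    horner-bound : ∀ {n} (v : Vec Carrier n) {κ} → 0# < κ →
      ∃[ C ] (0# ≤ C × (∀ x r → ∣ x ∣ ≤ r → ∣ horner v x ∣ ≤ C * exp (κ * r)))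
    horner-bound []      0<κ = 0# , ≤-refl , λ x r _ → ≤-reflexive (trans ∣0∣≈0 (sym (zeroˡ _)))
    horner-bound (a ∷ v) {κ} 0<κ =
      let C , 0≤C , h = horner-bound v (half-pos 0<κ)
      in ∣ a ∣ + inverse (half-pos 0<κ) * C
       , +-nonneg (0≤∣x∣ a) (*-nonneg (<⇒≤ (inverse-pos _)) 0≤C)
       , λ x r x≤r → ≤-trans (∣x+y∣≤∣x∣+∣y∣ a _) (≤-trans
           (+-mono-≤ ≤-refl (≤-trans (∣x*y∣≤∣x∣*∣y∣ x _) (*-monoʳ-≤ _ (0≤∣x∣ _) x≤r)))
           (linear-bound 0<κ (0≤∣x∣ a) 0≤C (≤-trans (0≤∣x∣ x) x≤r) (h x r x≤r)))

    mulAdd-bound : ∀ {n} {h r a B} (v : Vec Carrier n) → ∣ h ∣ ≤ r → 0# ≤ B → ∣ a ∣ ≤ B →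
      (∀ j → ∣ Vec.lookup v j ∣ ≤ B) → ∀ j → ∣ Vec.lookup (mulAdd h a v) j ∣ ≤ B + r * B
    mulAdd-bound {h = h} {r} {a} {B} []      h≤r 0≤B a≤B v≤B Fin.zero = ≤-trans a≤B
      (≤-diff (r * B) (*-nonneg (≤-trans (0≤∣x∣ h) h≤r) 0≤B) refl)
    mulAdd-bound {h = h} (w ∷ v) h≤r 0≤B a≤B v≤B Fin.zero = ≤-trans (∣x-y∣≤∣x∣+∣y∣ _ _)
      (+-mono-≤ a≤B (≤-trans (∣x*y∣≤∣x∣*∣y∣ h w) (*-mono-≤ (0≤∣x∣ h) 0≤B h≤r (v≤B Fin.zero))))
    mulAdd-bound (w ∷ v) h≤r 0≤B a≤B v≤B (Fin.suc j) =
      mulAdd-bound v h≤r 0≤B (v≤B Fin.zero) (λ j → v≤B (Fin.suc j)) j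

    -- The coefficients of v(x - h) are polynomials in h. At h = ln m they grow more slowly than
    -- m^κ, a loss that a slight decrease of the exponent of m absorbs.
    translate-bound : ∀ {n} (v : Vec Carrier n) {κ} → 0# < κ →
      ∃[ C ] (0# ≤ C × (∀ h r → ∣ h ∣ ≤ r → ∀ j → ∣ Vec.lookup (translate h v) j ∣ ≤ C * exp (κ * r)))
    translate-bound []      0<κ = 0# , ≤-refl , λ h r _ ()
    translate-bound (a ∷ v) {κ} 0<κ =
      let C , 0≤C , bound = translate-bound v (half-pos 0<κ)
          w = inverse (half-pos 0<κ)
          0≤w = <⇒≤ (inverse-pos (half-pos 0<κ))
          D = ∣ a ∣ + C
          0≤D = +-nonneg (0≤∣x∣ a) 0≤C
      in D + w * D , +-nonneg 0≤D (*-nonneg 0≤w 0≤D) , λ h r h≤r j →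
         let 0≤r = ≤-trans (0≤∣x∣ h) h≤r
             e = exp (½ * κ * r)
             1≤e = 1≤exp-half 0<κ 0≤r
             0≤e = exp-nonneg (½ * κ * r)
         in ≤-trans
           (mulAdd-bound (translate h v) h≤r (*-nonneg 0≤D 0≤e)
             (≤-trans (≤-diff C 0≤C refl) (≤-trans (≤-reflexive (sym (*-identityʳ D))) (*-monoˡ-≤ D 0≤D 1≤e)))
             (λ j → ≤-trans (bound h r h≤r j) (*-monoʳ-≤ e 0≤e (≤-diff ∣ a ∣ (0≤∣x∣ a) (+-comm _ _)))) j)
           (≤-trans
             (+-mono-≤ (≤-trans (≤-reflexive (sym (*-identityʳ _))) (*-monoˡ-≤ _ (*-nonneg 0≤D 0≤e) 1≤e))
               (*-monoʳ-≤ _ (*-nonneg 0≤D 0≤e) (x≤K*exp[κ*x] (half-pos 0<κ) r)))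
             (≤-reflexive (trans (solve 3 (λ D e w → D :* e :* e :+ w :* e :* (D :* e)
               := (D :+ w :* D) :* (e :* e)) refl D e w) (*-congˡ (exp-halves κ r)))))

-- The error of the hypothesis at x/m, uniformly in m.

module Assembly {c ℓ₁ ℓ₂} (ℝ : RealNumbers c ℓ₁ ℓ₂) where
  open RealNumbers ℝ hiding (zero)
  open FieldProperties ℝ
  open Sums ℝ
  open Limits ℝ
  open Exponential ℝ
  open Sieve ℝ
  open Powers ℝ
  open EulerProducts ℝ
  open LocalFactors ℝ
  open Counting ℝ
  open Polynomials ℝ
  open Solver using (solve; _:=_; _:+_; _:*_; _:-_; :-_; con)

  -- The exponents used lie in (⅓, ⅓ + gap], which ends halfway between 1/3 and 1/2.
  gap : Carrier
  gap = ½ * (½ - ⅓)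

  abstract
    -- Both numbers are known only as inverses, so their difference is recognised as positive
    -- through 6 (½ - ⅓) = 3 - 2 = 1.
    0<½-⅓ : 0# < ½ - ⅓
    0<½-⅓ = *≈1⇒pos {six} 0<six (trans
      (solve 2 (λ h t → (h :- t) :* ((con (+ 1) :+ con (+ 1)) :* (con (+ 1) :+ con (+ 1) :+ con (+ 1)))
        := (h :+ h) :* (con (+ 1) :+ con (+ 1) :+ con (+ 1)) :- (t :+ t :+ t) :* (con (+ 1) :+ con (+ 1)))
        refl ½ ⅓)
      (trans (+-cong (*-congʳ ½+½≈1) (-‿cong (*-congʳ ⅓+⅓+⅓≈1)))
        (solve 0 (con (+ 1) :* (con (+ 1) :+ con (+ 1) :+ con (+ 1)) :- con (+ 1) :* (con (+ 1) :+ con (+ 1))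
          := con (+ 1)) refl)))
      where
      six : Carrier
      six = (1# + 1#) * (1# + 1# + 1#)
      0<six : 0# < six
      0<six = *-pos (+-pos 0<1 0≤1) (+-pos (+-pos 0<1 0≤1) 0≤1)

    0<gap : 0# < gap
    0<gap = half-pos 0<½-⅓

    ½-[⅓+gap] : ½ - (⅓ + gap) ≈ gap
    ½-[⅓+gap] = trans (solve 3 (λ h t g → h :- (t :+ g) := (h :- t) :- g) refl ½ ⅓ gap)
      (trans (+-congʳ (sym (half+half (½ - ⅓)))) (solve 1 (λ g → g :+ g :- g := g) refl gap))

    excess-⅓+ : ∀ η → excess (⅓ + η) ≈ η + η + η
    excess-⅓+ η = trans (solve 2 (λ t η → (t :+ η) :+ (t :+ η) :+ (t :+ η) :- con (+ 1)
        := (t :+ t :+ t) :- con (+ 1) :+ (η :+ η :+ η)) refl ⅓ η)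
      (trans (+-congʳ (trans (+-congʳ ⅓+⅓+⅓≈1) (-‿inverseʳ 1#))) (+-identityˡ _))

    0<excess : ∀ {η} → 0# < η → 0# < excess (⅓ + η)
    0<excess {η} 0<η = <-respʳ-≈ (sym (excess-⅓+ η)) (+-pos (+-pos 0<η (<⇒≤ 0<η)) (<⇒≤ 0<η))

    ⅓≤⅓+ : ∀ {η} → 0# < η → ⅓ ≤ ⅓ + η
    ⅓≤⅓+ {η} 0<η = ≤-diff η (<⇒≤ 0<η) refl

    ½≈⅓+ : ½ ≈ ⅓ + (½ - ⅓)
    ½≈⅓+ = solve 2 (λ h t → h := t :+ (h :- t)) refl ½ ⅓

    ½≤1 : ½ ≤ 1#
    ½≤1 = ≤-diff ½ (<⇒≤ 0<½) (sym ½+½≈1)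

    lim-unique : ∀ {s x y} → ConvergesTo s x → ConvergesTo s y → x ≈ y
    lim-unique {s} {x} {y} s⟶x s⟶y = trans (solve 2 (λ x y → x := (x :- y) :+ y) refl x y)
      (trans (+-congʳ (≤-antisym (lim-≤ 0 d⟶ λ n _ → ≤-reflexive (-‿inverseʳ (s n)))
        (lim-≥ 0 d⟶ λ n _ → ≤-reflexive (sym (-‿inverseʳ (s n)))))) (+-identityˡ y))
      where
      d⟶ : ConvergesTo (λ n → s n - s n) (x - y)
      d⟶ = lim-sub s⟶x s⟶y

    -- ⌊⌊x⌋/m⌋ = ⌊x/m⌋ with x = exp t. For the upper bound, m (M + 1) > N is an inequality between
    -- integers, so m (M + 1) ≥ N + 1 > x.
    floor-÷ : ∀ t N m → IsFloor (exp t) N → IsFloor (exp (t - ln (suc m))) (N ℕ./ suc m)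
    floor-÷ t N m (N≤x , x<1+N) =
        ≤-trans (≤-reflexive (sym (cancel (fromℕ M)))) (≤-trans
          (*-monoʳ-≤ _ (exp-nonneg _) (≤-trans (≤-reflexive (sym (fromℕ-* M (suc m))))
            (≤-trans (fromℕ-mono (ℕ/.m/n*n≤m N (suc m))) N≤x)))
          (≤-reflexive (sym (exp-+ t _))))
      , <-respˡ-≈ (sym (trans (exp-+ t _) (*-comm _ _))) (<-≤-trans
          (*-monoˡ-< _ (exp-pos _) (<-≤-trans x<1+N (fromℕ-mono (ℕₚ.≰⇒> λ h → ℕₚ.<-irrefl ≡.refl (*≤⇒≤/ (suc M) N (suc m) h)))))
          (≤-reflexive (trans (*-comm _ _) (trans (*-congʳ (fromℕ-* (suc M) (suc m))) (cancel (fromℕ (suc M)))))))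
      where
      M : ℕ
      M = N ℕ./ suc m
      cancel : ∀ x → x * fromℕ (suc m) * exp (- ln (suc m)) ≈ x
      cancel x = trans (*-assoc _ _ _) (trans (*-congˡ (trans (*-congʳ (sym (exp-ln m))) (exp-+-neg _)))
        (*-identityʳ x))

  module _ {d : ℕ} (C₁ : Carrier) (q : Vec Carrier (suc d)) where

    -- The main term at exp s.
    main : Carrier → Carrier
    main s = C₁ * exp s + exp (½ * s) * horner q s

    abstract
      main-split : ∀ t m → main (t - ln (suc m)) ≈
        C₁ * exp t * ν 1# (suc m) + exp (½ * t) * (ν ½ (suc m) * horner (translate (ln (suc m)) q) t)
      main-split t m = +-cong
        (trans (*-congˡ (trans (exp-cong (+-congˡ (-‿cong (sym (*-identityˡ _))))) (exp-+ t _)))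
          (sym (*-assoc _ _ _)))
        (trans (*-cong
            (trans (exp-cong (solve 3 (λ h t l → h :* (t :- l) := h :* t :+ :- (h :* l)) refl ½ t _)) (exp-+ _ _))
            (sym (horner-translate (ln (suc m)) q t)))
          (*-assoc _ _ _))

      -- For m > x the count is 0, so the main term at x/m is the whole error. The polynomial is
      -- absorbed by exp(s/2) exp((½ - σ)(- s)) = exp(σ s), and the linear term by s ≤ σ s for s ≤
      -- 0.
      main-negative : ∀ {σ} → σ < ½ → ∃[ K ] (0# ≤ K × (∀ s → s ≤ 0# → ∣ main s ∣ ≤ K * exp (σ * s)))
      main-negative {σ} σ<½ =
        let C , 0≤C , h = horner-bound q (0<y-x σ<½)
        in ∣ C₁ ∣ + C , +-nonneg (0≤∣x∣ C₁) 0≤C , λ s s≤0 →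
          let 0≤-s = ≤-trans (≤-reflexive (sym -0#≈0#)) (neg-mono-≤ s≤0)
          in ≤-trans (∣x+y∣≤∣x∣+∣y∣ _ _) (≤-trans
            (+-mono-≤
              (≤-trans (∣x*y∣≤∣x∣*∣y∣ C₁ _) (*-monoˡ-≤ _ (0≤∣x∣ C₁)
                (≤-trans (≤-reflexive (0≤x⇒∣x∣≈x (exp-nonneg s))) (exp-mono-≤
                  (≤-diff ((1# - σ) * - s) (*-nonneg (0≤y-x (≤-trans (<⇒≤ σ<½) ½≤1)) 0≤-s)
                    (solve 2 (λ σ s → σ :* s := s :+ (con (+ 1) :- σ) :* :- s) refl σ s))))))
              (≤-trans (∣x*y∣≤∣x∣*∣y∣ _ _) (≤-trans
                (*-mono-≤ (0≤∣x∣ _) (*-nonneg 0≤C (exp-nonneg _)) (≤-reflexive (0≤x⇒∣x∣≈x (exp-nonneg _)))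
                  (h s (- s) (∣∣-least (≤-trans s≤0 0≤-s) ≤-refl)))
                (≤-reflexive (trans (solve 3 (λ a C b → a :* (C :* b) := C :* (a :* b)) refl _ C _)
                  (*-congˡ (trans (sym (exp-+ _ _)) (exp-cong
                    (solve 3 (λ h s σ → h :* s :+ (h :- σ) :* :- s := σ :* s) refl ½ s σ)))))))))
            (≤-reflexive (sym (distribʳ _ _ _))))

      main-bounded : ∀ B → ∃[ K ] (0# ≤ K × (∀ s → 0# ≤ s → exp s ≤ B → ∣ main s ∣ ≤ K))
      main-bounded B =
        let C , 0≤C , h = horner-bound q 0<1
            B′ = ∣ B ∣
        in ∣ C₁ ∣ * B′ + B′ * (C * exp (1# * B′))
         , +-nonneg (*-nonneg (0≤∣x∣ C₁) (0≤∣x∣ B)) (*-nonneg (0≤∣x∣ B) (*-nonneg 0≤C (exp-nonneg _)))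
         , λ s 0≤s es≤B →
           let es≤B′ = ≤-trans es≤B (x≤∣x∣ B) in
           ≤-trans (∣x+y∣≤∣x∣+∣y∣ _ _) (+-mono-≤
             (≤-trans (∣x*y∣≤∣x∣*∣y∣ C₁ _) (*-monoˡ-≤ _ (0≤∣x∣ C₁)
               (≤-trans (≤-reflexive (0≤x⇒∣x∣≈x (exp-nonneg s))) es≤B′)))
             (≤-trans (∣x*y∣≤∣x∣*∣y∣ _ _) (*-mono-≤ (0≤∣x∣ _) (*-nonneg 0≤C (exp-nonneg _))
               (≤-trans (≤-reflexive (0≤x⇒∣x∣≈x (exp-nonneg _))) (≤-trans (exp-mono-≤
                 (≤-trans (*-monoʳ-≤ s 0≤s ½≤1) (≤-reflexive (*-identityˡ s)))) es≤B′))
               (h s B′ (≤-trans (≤-reflexive (0≤x⇒∣x∣≈x 0≤s)) (≤-trans (x≤exp[x] s) es≤B′))))))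

    module _ (F : ℕ → ℕ) (F0≡0 : F 0 ≡ 0) (w ε : Carrier) (0<ε : 0# < ε)
             (K₀ x₀ : Carrier)
             (hyp : ∀ s M → x₀ ≤ exp s → IsFloor (exp s) M →
                    ∣ fromℕ (F M) - main s ∣ ≤ K₀ * exp ((w + ε) * s)) where

      v : Carrier
      v = w ⊔ ⅓

      abstract
        w≤v : w ≤ v
        w≤v = proj₁ (⊔-supremum w ⅓)

        ⅓≤v : ⅓ ≤ v
        ⅓≤v = proj₁ (proj₂ (⊔-supremum w ⅓))

        0≤v+ε : 0# ≤ v + ε
        0≤v+ε = +-nonneg (≤-trans (<⇒≤ 0<⅓) ⅓≤v) (<⇒≤ 0<ε)

        -- Removes the threshold `x₀`: below it the count and the main term are both bounded, and
        -- exp((v + ε) s) ≥ 1. Splitting at `x₀` is legitimate because the conclusion is a `≤`.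
        error-nonneg : ∃[ K ] (0# ≤ K × (∀ s M → 0# ≤ s → IsFloor (exp s) M →
          ∣ fromℕ (F M) - main s ∣ ≤ K * exp ((v + ε) * s)))
        error-nonneg =
          let M₀ , x₀<M₀ = archimedean x₀
              K₁ , 0≤K₁ , bounded = main-bounded (fromℕ M₀)
              -- The sum serves as an upper bound for every value of `F` below `M₀`.
              K₂ = ∑ M₀ (fromℕ ∘ F)
              0≤K₂ = ∑-nonneg M₀ {fromℕ ∘ F} (λ a → fromℕ-nonneg (F a))
              0≤K₂+K₁ = +-nonneg 0≤K₂ 0≤K₁
          in ∣ K₀ ∣ + (K₂ + K₁) , +-nonneg (0≤∣x∣ K₀) 0≤K₂+K₁ , λ s M 0≤s fl →
            ≤-cases (exp s) x₀
              (λ es<x₀ →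
                let es<M₀ = <-trans es<x₀ x₀<M₀
                    M<M₀ = ℕₚ.≰⇒> λ M₀≤M → <-irrefl refl (<-≤-trans es<M₀ (≤-trans (fromℕ-mono M₀≤M) (proj₁ fl)))
                in ≤-trans (∣x-y∣≤∣x∣+∣y∣ _ _) (≤-trans (+-mono-≤
                  (≤-trans (≤-reflexive (0≤x⇒∣x∣≈x (fromℕ-nonneg (F M))))
                    (≤∑ M₀ {fromℕ ∘ F} (λ a → fromℕ-nonneg (F a)) M M<M₀))
                  (bounded s 0≤s (<⇒≤ es<M₀)))
                (≤-trans (≤-trans (≤-reflexive (sym (*-identityʳ _)))
                    (*-monoˡ-≤ _ 0≤K₂+K₁ (1≤exp[κ*x] 0≤v+ε 0≤s)))
                  (*-monoʳ-≤ _ (exp-nonneg _) (≤-diff ∣ K₀ ∣ (0≤∣x∣ K₀) (+-comm _ _))))))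
              (λ x₀≤es → ≤-trans (hyp s M x₀≤es fl) (≤-trans
                (*-monoʳ-≤ _ (exp-nonneg _) (x≤∣x∣ K₀)) (≤-trans
                (*-monoˡ-≤ _ (0≤∣x∣ K₀) (exp-mono-≤ (*-monoʳ-≤ s 0≤s (+-mono-≤ w≤v ≤-refl))))
                (*-monoʳ-≤ _ (exp-nonneg _) (≤-diff (K₂ + K₁) 0≤K₂+K₁ refl)))))

        -- The sign of the real `s` cannot be tested, but its floor data can: M = 0 forces exp s < 1
        -- and so s ≤ 0, while M ≥ 1 forces s ≥ 0.
        byFloor : ∀ {s b} M → IsFloor (exp s) M → (s ≤ 0# → ∣ main s ∣ ≤ b) →
          (∀ M → 0# ≤ s → IsFloor (exp s) M → ∣ fromℕ (F M) - main s ∣ ≤ b) →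
          ∣ fromℕ (F M) - main s ∣ ≤ b
        byFloor {s} zero fl neg nonneg = ≤-trans
          (≤-trans (∣∣-mono (trans (+-congʳ (reflexive (≡.cong fromℕ F0≡0))) (+-identityˡ _)))
            (≤-reflexive (∣-x∣≈∣x∣ (main s))))
          (neg (exp-cancel-≤ (≤-trans (<⇒≤ (proj₂ fl)) (≤-reflexive (trans (+-identityʳ 1#) (sym exp-0))))))
        byFloor {s} (suc M) fl neg nonneg = nonneg (suc M)
          (exp-cancel-≤ (≤-trans (≤-reflexive exp-0) (≤-trans (1≤fromℕ M) (proj₁ fl)))) fl

        exp-absorb : ∀ {K K′ s a b} → 0# ≤ K → K ≤ K′ → s ≤ a + b → K * exp s ≤ K′ * exp a * exp b
        exp-absorb {K} 0≤K K≤K′ s≤a+b = ≤-trans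
          (*-mono-≤ 0≤K (*-nonneg (exp-nonneg _) (exp-nonneg _)) K≤K′
            (≤-trans (exp-mono-≤ s≤a+b) (≤-reflexive (exp-+ _ _))))
          (≤-reflexive (sym (*-assoc _ _ _)))

        -- Write u = v + ε ≥ σ and s = t - ln m. If s ≥ 0, then exp(u s) = exp(u t) m^(-u) ≤ exp(u
        -- t) m^(-σ); if s ≤ 0, then exp(σ s) = exp(σ t) m^(-σ) ≤ exp(u t) m^(-σ). One majorant
        -- covers both.
        error-combine : ∀ {σ K₊ K₋} → 0# ≤ K₊ → 0# ≤ K₋ → σ ≤ v + ε →
          (∀ s M → 0# ≤ s → IsFloor (exp s) M → ∣ fromℕ (F M) - main s ∣ ≤ K₊ * exp ((v + ε) * s)) →
          (∀ s → s ≤ 0# → ∣ main s ∣ ≤ K₋ * exp (σ * s)) →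
          ∀ t N → 0# ≤ t → IsFloor (exp t) N → ∀ m →
          ∣ fromℕ (F (N ℕ./ suc m)) - main (t - ln (suc m)) ∣ ≤ (K₊ + K₋) * exp ((v + ε) * t) * ν σ (suc m)
        error-combine {σ} {K₊} {K₋} 0≤K₊ 0≤K₋ σ≤v+ε h₊ h₋ t N 0≤t fl m =
          byFloor (N ℕ./ suc m) (floor-÷ t N m fl)
            (λ s≤0 → ≤-trans (h₋ _ s≤0) (exp-absorb 0≤K₋ (≤-diff K₊ 0≤K₊ (+-comm _ _))
              (≤-diff ((v + ε - σ) * t) (*-nonneg (0≤y-x σ≤v+ε) 0≤t)
                (solve 4 (λ u t σ l → u :* t :+ :- (σ :* l) := σ :* (t :- l) :+ (u :- σ) :* t)
                  refl (v + ε) t σ (ln (suc m))))))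
            (λ M 0≤s fl′ → ≤-trans (h₊ _ M 0≤s fl′) (exp-absorb 0≤K₊ (≤-diff K₋ 0≤K₋ refl)
              (≤-diff ((v + ε - σ) * ln (suc m)) (*-nonneg (0≤y-x σ≤v+ε) (0≤ln (suc m)))
                (solve 4 (λ u t σ l → u :* t :+ :- (σ :* l) := u :* (t :- l) :+ (u :- σ) :* l)
                  refl (v + ε) t σ (ln (suc m))))))

        -- The Euler product will be bounded for σ > ⅓, while the majorant asks for σ ≤ v + ε; as ⅓
        -- ≤ v, every σ ≤ ⅓ + ε is admissible.
        error-dominated : ∀ {σ} → σ < ½ → σ ≤ ⅓ + ε →
          ∃[ K ] (∀ t N → 0# ≤ t → IsFloor (exp t) N → ∀ m →
            ∣ fromℕ (F (N ℕ./ suc m)) - main (t - ln (suc m)) ∣ ≤ K * exp ((v + ε) * t) * ν σ (suc m))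
        error-dominated σ<½ σ≤⅓+ε =
          let K₊ , 0≤K₊ , h₊ = error-nonneg
              K₋ , 0≤K₋ , h₋ = main-negative σ<½
          in K₊ + K₋ , error-combine 0≤K₊ 0≤K₋ (≤-trans σ≤⅓+ε (+-mono-≤ ⅓≤v ≤-refl)) h₊ h₋

-- The main terms as limits, and the expansion of the summatory function.

module ExponentialDivisors {c ℓ₁ ℓ₂} (ℝ : RealNumbers c ℓ₁ ℓ₂) where
  open RealNumbers ℝ hiding (zero)
  open FieldProperties ℝ
  open Sums ℝ
  open Limits ℝ
  open Exponential ℝ
  open Sieve ℝ
  open Powers ℝ
  open EulerProducts ℝ
  open LocalFactors ℝ
  open Counting ℝ
  open Polynomials ℝ
  open Assembly ℝ
  open Solver using (solve; _:=_; _:+_; _:*_; _:-_; :-_; con)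

  module _ (k l : ℕ) (𝔱2≡1+l : 𝔱 k 2 ≡ suc l) where

    u : ℕ → ℕ → Carrier
    u = localFactor (𝔱-coefficient k) l

    -- An exponent strictly between 1/3 and 1/2, fixed once: the constants of the main terms must
    -- not depend on ε, unlike the exponent used for the error.
    σ₀ : Carrier
    σ₀ = ⅓ + gap

    abstract
      u-cubeFull : CubeFull u
      u-cubeFull = localFactor-cubeFull (𝔱-coefficient k) (0≤𝔱-coefficient k) refl (𝔱-coefficient-1 k) l
        (reflexive (≡.cong fromℕ 𝔱2≡1+l)) (proj₁ (𝔱-growth k)) (proj₁ (proj₂ (𝔱-growth k)))
        (proj₂ (proj₂ (𝔱-growth k)))

      ⅓≤½ : ⅓ ≤ ½
      ⅓≤½ = ≤-diff (½ - ⅓) (<⇒≤ 0<½-⅓) ½≈⅓+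

      0<excess-½ : 0# < excess ½
      0<excess-½ = <-respʳ-≈ (sym (trans (+-congʳ (+-congʳ ½+½≈1))
        (solve 1 (λ h → con (+ 1) :+ h :- con (+ 1) := h) refl ½))) 0<½

      ⅓+η<½ : ∀ {η} → η ≤ gap → ⅓ + η < ½
      ⅓+η<½ {η} η≤gap = ≤-<-trans (+-mono-≤ ≤-refl η≤gap) (<-diff gap 0<gap
        (trans (solve 2 (λ h s → h := s :+ (h :- s)) refl ½ (⅓ + gap)) (+-congˡ ½-[⅓+gap])))

      σ₀<½ : σ₀ < ½
      σ₀<½ = ⅓+η<½ ≤-refl

      ⅓≤σ₀ : ⅓ ≤ σ₀
      ⅓≤σ₀ = ⅓≤⅓+ 0<gap

      0<excess-σ₀ : 0# < excess σ₀
      0<excess-σ₀ = 0<excess 0<gap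

    module B₀ = Bounds u-cubeFull σ₀ ⅓≤σ₀ 0<excess-σ₀

    abstract
      ν-dominated-σ₀ : ∀ {τ} → σ₀ ≤ τ → B₀.Dominated 1# (ν τ)
      ν-dominated-σ₀ {τ} σ₀≤τ m = ≤-trans (≤-reflexive (0≤x⇒∣x∣≈x (ν-nonneg τ m)))
        (≤-trans (ν-antitoneˡ σ₀≤τ m) (≤-reflexive (sym (*-identityˡ _))))

      linear-limit : ∃[ x ] ConvergesTo (λ n → euler n u n (ν 1#) 1) x
      linear-limit = B₀.euler-converges {φ = ν 1#} (ν-dominated-σ₀ (≤-trans (<⇒≤ σ₀<½) ½≤1))

      sqrt-limit : ∃[ x ] ConvergesTo (λ n → euler n u n (ν ½) 1) x
      sqrt-limit = B₀.euler-converges {φ = ν ½} (ν-dominated-σ₀ (<⇒≤ σ₀<½))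

      sqrt-limit-pos : 0# < proj₁ sqrt-limit
      -- The weight exponent is now ½ itself, so that `ν ½` is the eigenfunction whose eigenvalues
      -- form the product.
      sqrt-limit-pos = Bounds.eulerProduct-pos u-cubeFull ½ ⅓≤½ 0<excess-½
        (localFactor-pos (𝔱-coefficient k) (0≤𝔱-coefficient k) refl (𝔱-coefficient-1 k) l
          (reflexive (≡.cong fromℕ 𝔱2≡1+l)) (proj₁ (𝔱-growth k)) (proj₁ (proj₂ (𝔱-growth k)))
          (proj₂ (proj₂ (𝔱-growth k))) ⅓≤½)
        (proj₂ sqrt-limit)

    module _ {d : ℕ} (q : Vec Carrier (suc d)) where

      -- The coefficient of t^j in m^(-1/2) q(t - ln m), as a function of m.
      sqrtTerm : Fin (suc d) → ℕ → Carrier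
      sqrtTerm j m = ν ½ m * Vec.lookup (translate (ln m) q) j

      abstract
        sqrtTerm-dominated : ∃[ K ] (∀ j → B₀.Dominated K (sqrtTerm j))
        sqrtTerm-dominated =
          let C , 0≤C , bound = translate-bound q (0<y-x σ₀<½)
          in C , dominated C 0≤C bound
          where
          dominated : ∀ C → 0# ≤ C → (∀ h r → ∣ h ∣ ≤ r → ∀ j →
            ∣ Vec.lookup (translate h q) j ∣ ≤ C * exp ((½ - σ₀) * r)) → ∀ j → B₀.Dominated C (sqrtTerm j)
          dominated C 0≤C bound j zero    = ≤-reflexive
            (trans (trans (∣∣-cong (zeroˡ _)) ∣0∣≈0) (sym (zeroʳ C)))
          dominated C 0≤C bound j (suc m) = ≤-trans (∣x*y∣≤∣x∣*∣y∣ _ _) (≤-trans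
            (*-mono-≤ (0≤∣x∣ _) (*-nonneg 0≤C (exp-nonneg _))
              (≤-reflexive (0≤x⇒∣x∣≈x (ν-nonneg ½ (suc m))))
              (bound (ln (suc m)) (ln (suc m)) (≤-reflexive (0≤x⇒∣x∣≈x (0≤ln (suc m)))) j))
            (≤-reflexive (trans (solve 3 (λ a C b → a :* (C :* b) := C :* (a :* b)) refl _ C _)
              (*-congˡ (trans (sym (exp-+ _ _)) (exp-cong
                (solve 3 (λ h l s → :- (h :* l) :+ (h :- s) :* l := :- (s :* l)) refl ½ (ln (suc m)) σ₀)))))))

        sqrtTerm-limit : ∀ j → ∃[ x ] ConvergesTo (λ n → euler n u n (sqrtTerm j) 1) x
        sqrtTerm-limit j = B₀.euler-converges {φ = sqrtTerm j} (proj₂ sqrtTerm-dominated j)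

      coefficient : Fin (suc d) → Carrier
      coefficient j = proj₁ (sqrtTerm-limit j)

      abstract
        -- Translation leaves the leading coefficient unchanged, so the top `sqrtTerm` is a constant
        -- multiple of `ν ½`.
        coefficient-last : coefficient (Fin.fromℕ d) ≈ Vec.last q * proj₁ sqrt-limit
        coefficient-last = lim-unique (proj₂ (sqrtTerm-limit (Fin.fromℕ d)))
          (lim-cong (λ n → sym (trans
              (euler-cong n u n {ψ = λ m → Vec.last q * ν ½ m} (λ m → trans
                (*-congˡ (reflexive (≡.trans (lookup-last-translate (ln m) q) (≡.sym (last≡lookup q)))))
                (*-comm _ _)) 1)
              (euler-*ˡ n u n (Vec.last q) (ν ½) 1)))
            refl (lim-*ˡ (Vec.last q) (proj₂ sqrt-limit)))

        *-#0 : ∀ {x y z} → x # 0# → 0# < y → z ≈ x * y → z # 0#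
        *-#0 {x} {y} {z} x#0 0<y z≈xy =
          let w , wx≈1 = #0-inverse x#0
          in inverse-#0 {inverse 0<y * w} (trans (*-congˡ z≈xy) (trans
            (solve 4 (λ j w x y → j :* w :* (x :* y) := (w :* x) :* (j :* y)) refl _ w x y)
            (trans (*-cong wx≈1 (inverse-* 0<y)) (*-identityˡ 1#))))

        coefficient-leading : Vec.last q # 0# → Vec.last (Vec.tabulate coefficient) # 0#
        coefficient-leading q#0 = *-#0 q#0 sqrt-limit-pos (trans
          (reflexive (≡.trans (last≡lookup (Vec.tabulate coefficient))
            (Vecₚ.lookup∘tabulate coefficient (Fin.fromℕ d)))) coefficient-last)

    module _ {τ : ℕ → ℕ} (isτE : IsτE k τ) (w C₁ : Carrier) {d : ℕ} (q : Vec Carrier (suc d)) where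

      approximant : Carrier → ℕ → Carrier
      approximant t n = C₁ * exp t * euler n u n (ν 1#) 1
        + exp (½ * t) * horner (Vec.tabulate (λ j → euler n u n (sqrtTerm q j) 1)) t

      mainTerm error : ℕ → Carrier → ℕ → Carrier
      mainTerm N t m = C₁ * exp t * ν 1# m + exp (½ * t) * (ν ½ m * horner (translate (ln m) q) t)
      error N t m = count l N m - mainTerm N t m

      abstract
        euler-count : ∀ N t n → euler n u n (count l N) 1 ≈ approximant t n + euler n u n (error N t) 1
        euler-count N t n = trans
          (euler-cong n u n {ψ = λ m → mainTerm N t m + error N t m}
            (λ m → solve 2 (λ a b → a := b :+ (a :- b)) refl _ (mainTerm N t m)) 1)
          (trans (euler-+ n u n (mainTerm N t) (error N t) 1) (+-congʳ
            (trans (euler-+ n u n (λ m → C₁ * exp t * ν 1# m)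
                (λ m → exp (½ * t) * (ν ½ m * horner (translate (ln m) q) t)) 1)
              (+-cong (euler-*ˡ n u n (C₁ * exp t) (ν 1#) 1)
                (trans (euler-*ˡ n u n (exp (½ * t)) (λ m → ν ½ m * horner (translate (ln m) q) t) 1)
                  (*-congˡ (euler-horner n u n (ν ½) (λ m → translate (ln m) q) t 1)))))))

        approximant-limit : ∀ t → ConvergesTo (approximant t)
          (C₁ * exp t * proj₁ linear-limit + exp (½ * t) * horner (Vec.tabulate (coefficient q)) t)
        approximant-limit t = lim-+ (lim-*ˡ (C₁ * exp t) (proj₂ linear-limit))
          (lim-*ˡ (exp (½ * t)) (lim-horner (λ j → proj₂ (sqrtTerm-limit q j)) t))

        error-bound : ∀ {K σ t N} → (∀ m →
            ∣ fromℕ (divisorCount l (N ℕ./ suc m)) - main C₁ q (t - ln (suc m)) ∣ ≤ K * ν σ (suc m)) →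
          ∀ m → ∣ error N t m ∣ ≤ K * ν σ m
        error-bound {K} {t = t} h zero    = ≤-reflexive (trans
          (trans (∣∣-cong (solve 3 (λ a b c → con (+ 0) :- (a :* con (+ 0) :+ b :* (con (+ 0) :* c)) := con (+ 0))
            refl (C₁ * exp t) _ _)) ∣0∣≈0) (sym (zeroʳ K)))
        error-bound {t = t} h (suc m) = ≤-trans
          (∣∣-mono (+-congˡ (-‿cong (sym (main-split C₁ q t m))))) (h m)

        approximation : ∀ {K σ t N} → ⅓ ≤ σ → (0<θ : 0# < excess σ) → (∀ m →
            ∣ fromℕ (divisorCount l (N ℕ./ suc m)) - main C₁ q (t - ln (suc m)) ∣ ≤ K * ν σ (suc m)) →
          ∣ fromℕ (summatory τ N) -
            (C₁ * exp t * proj₁ linear-limit + exp (½ * t) * horner (Vec.tabulate (coefficient q)) t) ∣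
          ≤ exp (CubeFull.W u-cubeFull * inverse (0<y-x (exp[-x]<1 (CubeFull.0<κ u-cubeFull)))
                 * ζ-remainder σ 0<θ 0) * K
        -- From n ≥ N on, the exact identity applies, so the difference from the approximant is the
        -- operator product of `error`, bounded independently of n.
        approximation {K} {σ} {t} {N} ⅓≤σ 0<θ h = lim-∣∣ N (approximant-limit t) λ n N≤n → ≤-trans
          (∣∣-mono (trans (+-congʳ (trans (summatory-euler isτE l N≤n N≤n) (euler-count N t n)))
            (solve 2 (λ a e → a :+ e :- a := e) refl (approximant t n) _)))
          (Bounds.euler-bounded u-cubeFull σ ⅓≤σ 0<θ {φ = error N t} (error-bound {σ = σ} {t} {N} h) n n)

    abstract
      -- In the variable s = log x, division of x by m becomes subtraction of ln m.
      exp-hypothesis : ∀ {F d C₁ w} (Q : Polynomial d) → Expansion F C₁ Q w → ∀ ε → 0# < ε →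
        ∃[ K ] ∃[ x₀ ] ∀ s M → x₀ ≤ exp s → IsFloor (exp s) M →
          ∣ fromℕ (F M) - main C₁ (Polynomial.coefficients Q) s ∣ ≤ K * exp ((w + ε) * s)
      exp-hypothesis {F} {C₁ = C₁} Q expansion ε 0<ε =
        let K , x₀ , h = expansion ε 0<ε
        in K , x₀ , λ s M x₀≤ fl → ≤-trans
          (∣∣-mono (+-congˡ (-‿cong (+-congˡ (*-cong (exp-cong (*-congˡ (sym (log-exp s))))
            (horner-cong (Polynomial.coefficients Q) (sym (log-exp s))))))))
          (≤-trans (h (exp s) (exp-pos s) M x₀≤ fl) (≤-reflexive (*-congˡ (exp-cong (*-congˡ (log-exp s))))))
        where
        log-exp : ∀ s → log (exp s) (exp-pos s) ≈ s
        log-exp s = exp-injective (exp-log _ _)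

    resultPolynomial : ∀ {d} → Polynomial d → Polynomial d
    resultPolynomial Q = record
      { coefficients = Vec.tabulate (coefficient (Polynomial.coefficients Q))
      ; leading#0    = coefficient-leading (Polynomial.coefficients Q) (Polynomial.leading#0 Q)
      }

    abstract
      result : ∀ {τ} → IsτE k τ → ∀ w C₁ {d} (Q : Polynomial d) → Expansion (divisorCount l) C₁ Q w →
               Expansion (summatory τ) (C₁ * proj₁ linear-limit) (resultPolynomial Q) (w ⊔ ⅓)
      result {τ} isτE w C₁ Q expansion ε 0<ε =
        let K₀ , x₀ , hyp = exp-hypothesis {divisorCount l} Q expansion ε 0<ε
            -- With σ = ⅓ + η, the bound η ≤ ε keeps σ ≤ v + ε and η ≤ gap keeps σ < ½.
            η , 0<η , η≤ε , η≤gap = positive-min 0<ε 0<gap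
            K , bound = error-dominated C₁ (Polynomial.coefficients Q) (divisorCount l) ≡.refl w ε 0<ε K₀ x₀ hyp
              (⅓+η<½ η≤gap) (+-mono-≤ ≤-refl η≤ε)
        -- The inferred factor is `growthBound` at σ = ⅓ + η, and the threshold 1 makes log x
        -- nonnegative.
        in _ * K , 1# , λ x x>0 N 1≤x fl → ≤-trans
             (∣∣-mono (+-congˡ (-‿cong (+-congʳ (trans (*-congˡ (sym (exp-log x x>0)))
               (solve 3 (λ c e y → c :* y :* e := c :* e :* y) refl C₁ _ (proj₁ linear-limit)))))))
             (≤-trans (approximation isτE w C₁ (Polynomial.coefficients Q) {t = log x x>0} {N} (⅓≤⅓+ 0<η) (0<excess 0<η)
                 (bound (log x x>0) N
                   (exp-cancel-≤ (≤-trans (≤-reflexive exp-0) (≤-trans 1≤x (≤-reflexive (sym (exp-log x x>0))))))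
                   ( ≤-trans (proj₁ fl) (≤-reflexive (sym (exp-log x x>0)))
                   , <-respˡ-≈ (sym (exp-log x x>0)) (proj₂ fl))))
               (≤-reflexive (sym (*-assoc _ K _))))

-- Arithmetic of `l` and of the degrees.

module Degrees where

  half-∸ : ∀ T m → (2 ℕ.* T ℕ.∸ 2 ℕ.* m) ℕ./ 2 ≡ T ℕ.∸ m
  half-∸ T m = ≡.trans (≡.cong (ℕ._/ 2) (≡.trans (≡.sym (ℕₚ.*-distribˡ-∸ 2 T m)) (ℕₚ.*-comm 2 (T ℕ.∸ m))))
    (ℕ/.m*n/n≡m (T ℕ.∸ m) 2)

  -- Since k² + k is twice `𝔱 k 2`, the division by 2 is exact and gives l = 𝔱 k 2 - 1.
  𝔱-2 : ∀ k → 2 ℕ.≤ k → 𝔱 k 2 ≡ suc ((k ℕ.^ 2 ℕ.+ k ℕ.∸ 2) ℕ./ 2)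
  𝔱-2 k@(suc _) 2≤k = ≡.trans (positive (𝔱 k 2) (GaussianDivisors.2*𝔱-2 k))
    (≡.cong suc (≡.sym (≡.trans (≡.cong (λ m → (m ℕ.∸ 2) ℕ./ 2) (≡.sym (GaussianDivisors.2*𝔱-2 k)))
      (half-∸ (𝔱 k 2) 1))))
    where
    positive : ∀ T → 2 ℕ.* T ≡ k ℕ.^ 2 ℕ.+ k → T ≡ suc (T ℕ.∸ 1)
    positive zero    eq = ⊥-elim (ℕₚ.1+n≢0 (≡.sym (≡.trans eq (ℕₚ.+-comm (k ℕ.^ 2) k))))
    positive (suc T) _  = ≡.refl

  -- Both sides equal `𝔱 k 2` minus 2, also under truncated subtraction.
  degree : ∀ k → (k ℕ.^ 2 ℕ.+ k ℕ.∸ 2) ℕ./ 2 ℕ.∸ 1 ≡ (k ℕ.^ 2 ℕ.+ k ℕ.∸ 4) ℕ./ 2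
  degree k rewrite ≡.sym (GaussianDivisors.2*𝔱-2 k) = ≡.trans (≡.cong (ℕ._∸ 1) (half-∸ (𝔱 k 2) 1))
    (≡.trans (ℕₚ.∸-+-assoc (𝔱 k 2) 1 1) (≡.sym (half-∸ (𝔱 k 2) 2)))

theorem3 : ∀ {c ℓ₁ ℓ₂} (ℝ : RealNumbers c ℓ₁ ℓ₂) → let open RealNumbers ℝ in
    (k : ℕ) → 2 ℕ.≤ k →
    let l = (k ℕ.^ 2 ℕ.+ k ℕ.∸ 2) ℕ./ 2 in
    (τ : ℕ → ℕ) → IsτE k τ →
    (w : Carrier) →
    (Σ[ C₁ ∈ Carrier ] Σ[ Q ∈ Polynomial (l ℕ.∸ 1) ] Expansion (divisorCount l) C₁ Q w) →
    Σ[ A ∈ Carrier ] Σ[ P ∈ Polynomial ((k ℕ.^ 2 ℕ.+ k ℕ.∸ 4) ℕ./ 2) ]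
    Expansion (summatory τ) A P (w ⊔ ⅓)
theorem3 ℝ k 2≤k τ isτE w (C₁ , Q , expansion) = A , ≡.subst
  (λ d → Σ[ P ∈ Polynomial d ] Expansion (summatory τ) A P (w ⊔ ⅓)) (degree k)
  (resultPolynomial k _ 𝔱2 Q , result k _ 𝔱2 isτE w C₁ Q expansion)
  where
  open RealNumbers ℝ
  open ExponentialDivisors ℝ
  open Degrees
  𝔱2 = 𝔱-2 k 2≤k
  A : Carrier
  A = C₁ * proj₁ (linear-limit k _ 𝔱2)
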